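{- Let $n$ be a finite ordinal with $n>2$. (1) There exists a $\mathsf{PEA}_n$ atom structure $\mathbf{At}$ such that the term algebra $\mathfrak{Tm}\mathbf{At}$ is representable as a $\mathsf{PEA}_n$, but $\mathbf{At}$ is not strongly representable. In fact, for every signature $t$ between that of $\mathsf{Df}_n$ and that of $\mathsf{PEA}_n$, the $t$-reduct of the complex algebra $\mathfrak{Cm}\mathbf{At}$ is not representable. (2) Furthermore, there exists an atomic relation algebra $\mathfrak{R}$ such that the set $\mathsf{Mat}_n\mathrm{At}\mathfrak{R}$ of all $n$-dimensional basic matrices over $\mathfrak{R}$ forms an $n$-dimensional polyadic equality basis, the term algebra $\mathfrak{Tm}\,\mathsf{Mat}_n\mathrm{At}\mathfrak{R}$ is representable as a polyadic equality algebra of dimension $n$, while the diagonal-free reduct of $\mathfrak{Cm}\,\mathsf{Mat}_n\mathrm{At}\mathfrak{R}$ is not representable (as a diagonal-free cylindric algebra of dimension $n$). In particular, the relation algebra atom structure $\mathrm{At}\mathfrak{R}$ is weakly but not strongly representable.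
   Context: Signatures. $\mathsf{Df}_n$ has the Boolean operations and cylindrifiers $c_i$ ($i<n$); $\mathsf{PEA}_n$ (polyadic equality algebras of finite dimension $n$) has in addition the diagonal constants $d_{ij}$, replacement operators $s^i_j$ and transposition operators $s_{ij}$ ($i,j<n$). A signature is between them if it is obtained from that of $\mathsf{Df}_n$ by adding some of the families $d_{ij}$, $s^i_j$, $s_{ij}$ (for instance $\mathsf{Df}$, $\mathsf{Sc}$ = substitution algebras with $c_i,s^i_j$; $\mathsf{CA}$ = cylindric algebras with $c_i,d_{ij}$; $\mathsf{PA}$ with $c_i,s^i_j,s_{ij}$; $\mathsf{PEA}$). Representability. In a set algebra with unit ${}^nU$: $c_iX=\{s:\exists t\in X,\ t_j=s_j\ \forall j\ne i\}$, $d_{ij}=\{s:s_i=s_j\}$, $s^i_jX=\{s:s\circ[i|j]\in X\}$, $s_{ij}X=\{s: s\circ[i,j]\in X\}$, where $[i|j]$ sends $i$ to $j$ and fixes everything else and $[i,j]$ swaps $i$ and $j$. An algebra is representable if it is isomorphic to a subalgebra of a direct product of set algebras of the same type. Atom structures. The atom structure $\mathrm{At}\mathfrak A$ of an atomic algebra (Boolean algebra with operators) $\mathfrak A$ has as universe the atoms, with a relation $R_\Omega(a_0,\dots,a_r)\iff \Omega(a_1,\dots,a_r)\ge a_0$ for every extra-Boolean operator $\Omega$. $\mathfrak{Cm}\,S$ is the complex algebra of $S$ (all subsets of $S$, with $\Omega(X_1,\dots,X_r)=\{s:\exists s_i\in X_i,\ R_\Omega(s,s_1,\dots,s_r)\}$),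 and $\mathfrak{Tm}\,S$ is the subalgebra of $\mathfrak{Cm}\,S$ generated by the singletons. An atom structure is weakly representable if at least one atomic algebra having it as atom structure is representable (equivalently, its term algebra is representable), and strongly representable if all atomic algebras having it as atom structure are representable (equivalently its complex algebra is). Basic matrices. For an atomic relation algebra $\mathfrak R$, an $n$-dimensional basic matrix is a map $f:n\times n\to\mathrm{At}\mathfrak R$ with $f(x,x)\le 1'$, $f(y,x)=f(x,y)^{\smile}$ and $f(x,z)\le f(x,y);f(y,z)$ for all $x,y,z<n$. $\mathsf{Mat}_n\mathrm{At}\mathfrak R$, the set of all of them, is regarded as an atom structure with $R_{c_i}(f,g)$ iff $f(x,y)=g(x,y)$ for all $x,y\neq i$, $R_{d_{ij}}(f)$ iff $f(i,j)\le 1'$, $R_{s_{ij}}(f,g)$ iff $f\circ[i,j]=g$, and $R_{s^i_j}(f,g)$ iff $f\circ[i|j]=g$ (here $(f\circ\tau)(x,y)=f(\tau(x),\tau(y))$). A set $\mathcal M$ of basic matrices is an $n$-dimensional cylindric basis if: every atom is $f(0,1)$ for some $f\in\mathcal M$; if $f\in\mathcal M$, $f(x,y)\le a;b$ with $a,b$ atoms and $z\ne x,y$, there is $g\in\mathcal M$ agreeing with $f$ off $z$ with $g(x,z)=a$, $g(z,y)=b$; and if $f,g\in\mathcal M$ agree off $\{x,y\}$ there is $h\in\mathcal M$ agreeing with $f$ off $x$ and with $g$ off $y$. It is a polyadic equality basis if it is moreover closed under $f\mapsto f\circ\tau$ for all $\tau:n\to n$. -}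

module Defs where

open import Algebra.Lattice.Structures using (IsBooleanAlgebra)
open import Data.Bool.Base using (Bool; true; false; T; if_then_else_)
open import Data.Empty.Polymorphic using (⊥)
open import Data.Fin.Base using (Fin; fromℕ<)
open import Data.Fin.Permutation.Components using (transpose)
open import Data.Fin.Properties using (_≟_)
open import Data.Nat.Base using (ℕ; _<_; z<s; s<s)
import Data.Nat.Properties as ℕ
open import Data.Product.Base using (Σ-syntax; ∃; ∃-syntax; _×_; _,_; proj₁; proj₂)
open import Data.Sum.Base using (_⊎_; inj₁; inj₂)
open import Data.Unit.Base using (tt)
open import Data.Unit.Polymorphic using (⊤)
open import Data.Vec.Base using (Vec; []; _∷_; map; lookup; tabulate)
open import Data.Vec.Relation.Binary.Pointwise.Inductive as Pointwise
  using (Pointwise; []; _∷_)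
open import Data.Vec.Relation.Unary.All as All using (All)
import Data.Vec.Relation.Unary.All.Properties as All
open import Function.Base using (_∘_)
open import Function.Bundles using (Bijection; _⇔_)
open import Level using (Level; 0ℓ; _⊔_) renaming (suc to lsuc)
open import Relation.Binary.Bundles using (Setoid)
open import Relation.Binary.Core using (Rel)
open import Relation.Binary.Definitions using (_Respects_)
open import Relation.Binary.PropositionalEquality.Core using (_≡_; _≢_)
open import Relation.Binary.Structures using (IsEquivalence)
open import Relation.Nullary.Decidable.Core using (does)
open import Relation.Nullary.Negation.Core using (¬_)
open import Relation.Unary using (Pred; _∈_; _∪_; _∩_; _≐_)
import Relation.Unary as Unary
import Relation.Unary.Algebra as Unary
import Relation.Unary.Properties as Unary
import Relation.Unary.Relation.Binary.Equality as Unary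

private
  variable
    a b ℓ ℓ′ r q : Level

1ℓ : Level
1ℓ = lsuc 0ℓ

------------------------------------------------------------------------
-- Algebras with Boolean operations and extra-Boolean operators

-- A signature lists the extra-Boolean operators only.
record Signature : Set₁ where
  field
    Op    : Set
    arity : Op → ℕ

open Signature

-- Only the operations are given here; the laws are imposed separately
-- (IsPolyadicEqualityAlgebra, IsRelationAlgebra).
record Algebra (Ω : Signature) (a ℓ : Level) : Set (lsuc (a ⊔ ℓ)) where
  infix  4 _≈_ _≤_
  infixr 7 _∧_
  infixr 6 _∨_
  field
    Carrier       : Set a
    _≈_           : Rel Carrier ℓ
    isEquivalence : IsEquivalence _≈_
    _∨_ _∧_       : Carrier → Carrier → Carrier
    ∁             : Carrier → Carrier
    𝟙 𝟘           : Carrier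
    op            : (o : Op Ω) → Vec Carrier (arity Ω o) → Carrier
    ∨-cong        : ∀ {x x′ y y′} → x ≈ x′ → y ≈ y′ → (x ∨ y) ≈ (x′ ∨ y′)
    ∧-cong        : ∀ {x x′ y y′} → x ≈ x′ → y ≈ y′ → (x ∧ y) ≈ (x′ ∧ y′)
    ∁-cong        : ∀ {x x′} → x ≈ x′ → ∁ x ≈ ∁ x′
    op-cong       : ∀ o {xs ys} → Pointwise _≈_ xs ys → op o xs ≈ op o ys

  open IsEquivalence isEquivalence public using (refl; sym; trans)

  setoid : Setoid a ℓ
  setoid = record { isEquivalence = isEquivalence }

  _≤_ : Rel Carrier ℓ
  x ≤ y = (x ∧ y) ≈ x

  ≤-resp : ∀ {x x′ y y′} → x ≈ x′ → y ≈ y′ → x ≤ y → x′ ≤ y′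
  ≤-resp x≈x′ y≈y′ x≤y =
    trans (sym (∧-cong x≈x′ y≈y′)) (trans x≤y x≈x′)

  IsAtom : Pred Carrier (a ⊔ ℓ)
  IsAtom x = ¬ (x ≈ 𝟘) × (∀ y → y ≤ x → (y ≈ 𝟘) ⊎ (y ≈ x))

  Atomic : Set (a ⊔ ℓ)
  Atomic = ∀ x → ¬ (x ≈ 𝟘) → ∃[ y ] (IsAtom y × y ≤ x)

record _≅_ {Ω} (A : Algebra Ω a ℓ) (B : Algebra Ω b ℓ′) :
           Set (a ⊔ b ⊔ ℓ ⊔ ℓ′) where
  private
    module A = Algebra A
    module B = Algebra B
  field
    bijection : Bijection A.setoid B.setoid
  open Bijection bijection public using (to)
  field
    ∨-homo  : ∀ x y → to (x A.∨ y) B.≈ (to x B.∨ to y)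
    ∧-homo  : ∀ x y → to (x A.∧ y) B.≈ (to x B.∧ to y)
    ∁-homo  : ∀ x → to (A.∁ x) B.≈ B.∁ (to x)
    𝟙-homo  : to A.𝟙 B.≈ B.𝟙
    𝟘-homo  : to A.𝟘 B.≈ B.𝟘
    op-homo : ∀ o xs → to (A.op o xs) B.≈ B.op o (map to xs)

module _ {Ω : Signature} where

  record Subuniverse (A : Algebra Ω a ℓ) (r : Level) : Set (a ⊔ ℓ ⊔ lsuc r) where
    open Algebra A
    field
      Member : Pred Carrier r
      resp   : Member Respects _≈_
      ∨-mem  : ∀ {x y} → Member x → Member y → Member (x ∨ y)
      ∧-mem  : ∀ {x y} → Member x → Member y → Member (x ∧ y)
      ∁-mem  : ∀ {x} → Member x → Member (∁ x)
      𝟙-mem  : Member 𝟙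
      𝟘-mem  : Member 𝟘
      op-mem : ∀ o {xs} → All Member xs → Member (op o xs)

  subalgebra : (A : Algebra Ω a ℓ) → Subuniverse A r → Algebra Ω (a ⊔ r) ℓ
  subalgebra A B = record
    { Carrier       = Σ[ x ∈ Carrier ] Member x
    ; _≈_           = λ x y → proj₁ x ≈ proj₁ y
    ; isEquivalence = record { refl = refl ; sym = sym ; trans = trans }
    ; _∨_           = λ (x , x∈) (y , y∈) → (x ∨ y) , ∨-mem x∈ y∈
    ; _∧_           = λ (x , x∈) (y , y∈) → (x ∧ y) , ∧-mem x∈ y∈
    ; ∁             = λ (x , x∈) → ∁ x , ∁-mem x∈
    ; 𝟙             = 𝟙 , 𝟙-mem
    ; 𝟘             = 𝟘 , 𝟘-mem
    ; op            = λ o xs → op o (map proj₁ xs) ,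
                        op-mem o (All.map⁺ (All.universal proj₂ xs))
    ; ∨-cong        = ∨-cong
    ; ∧-cong        = ∧-cong
    ; ∁-cong        = ∁-cong
    ; op-cong       = λ o xs≈ys → op-cong o (Pointwise.map⁺ (λ x≈y → x≈y) xs≈ys)
    }
    where
    open Algebra A
    open Subuniverse B

  module _ (A : Algebra Ω a ℓ) (G : Pred (Algebra.Carrier A) r) where
    open Algebra A

    data Generated : Pred Carrier (a ⊔ ℓ ⊔ r) where
      gen   : ∀ {x} → G x → Generated x
      resp  : ∀ {x y} → x ≈ y → Generated x → Generated y
      ∨-gen : ∀ {x y} → Generated x → Generated y → Generated (x ∨ y)
      ∧-gen : ∀ {x y} → Generated x → Generated y → Generated (x ∧ y)
      ∁-gen : ∀ {x} → Generated x → Generated (∁ x)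
      𝟙-gen : Generated 𝟙
      𝟘-gen : Generated 𝟘
      op-gen : ∀ o {xs} → All Generated xs → Generated (op o xs)

    generatedBy : Subuniverse A (a ⊔ ℓ ⊔ r)
    generatedBy = record
      { Member = Generated
      ; resp   = resp
      ; ∨-mem  = ∨-gen
      ; ∧-mem  = ∧-gen
      ; ∁-mem  = ∁-gen
      ; 𝟙-mem  = 𝟙-gen
      ; 𝟘-mem  = 𝟘-gen
      ; op-mem = op-gen
      }

  Product : (I : Set) → (I → Algebra Ω a ℓ) → Algebra Ω a ℓ
  Product I A = record
    { Carrier       = ∀ i → Carrier (A i)
    ; _≈_           = λ x y → ∀ i → _≈_ (A i) (x i) (y i)
    ; isEquivalence = record
      { refl  = λ i → refl (A i)
      ; sym   = λ x≈y i → sym (A i) (x≈y i)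
      ; trans = λ x≈y y≈z i → trans (A i) (x≈y i) (y≈z i)
      }
    ; _∨_           = λ x y i → _∨_ (A i) (x i) (y i)
    ; _∧_           = λ x y i → _∧_ (A i) (x i) (y i)
    ; ∁             = λ x i → ∁ (A i) (x i)
    ; 𝟙             = λ i → 𝟙 (A i)
    ; 𝟘             = λ i → 𝟘 (A i)
    ; op            = λ o xs i → op (A i) o (map (λ x → x i) xs)
    ; ∨-cong        = λ x≈x′ y≈y′ i → ∨-cong (A i) (x≈x′ i) (y≈y′ i)
    ; ∧-cong        = λ x≈x′ y≈y′ i → ∧-cong (A i) (x≈x′ i) (y≈y′ i)
    ; ∁-cong        = λ x≈x′ i → ∁-cong (A i) (x≈x′ i)
    ; op-cong       = λ o xs≈ys i →
                        op-cong (A i) o (Pointwise.map⁺ (λ x≈y → x≈y i) xs≈ys)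
    }
    where open Algebra

  -- K U is the full concrete algebra with base U.
  RepresentableBy : (K : Set → Algebra Ω 1ℓ 0ℓ) → Algebra Ω a ℓ →
                    Set (lsuc (1ℓ ⊔ a) ⊔ ℓ)
  RepresentableBy {a} K A =
    Σ[ I ∈ Set ] Σ[ U ∈ (I → Set) ]
    Σ[ B ∈ Subuniverse (Product I (K ∘ U)) (1ℓ ⊔ a) ]
      A ≅ subalgebra (Product I (K ∘ U)) B

  powersetAlgebra :
    (X : Set) (op : (o : Op Ω) → Vec (Pred X 0ℓ) (arity Ω o) → Pred X 0ℓ) →
    (∀ o {Ys Zs} → Pointwise _≐_ Ys Zs → op o Ys ≐ op o Zs) →
    Algebra Ω 1ℓ 0ℓ
  powersetAlgebra X op op-cong = record
    { Carrier       = Pred X 0ℓ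
    ; _≈_           = _≐_
    ; isEquivalence = Unary.≐-isEquivalence
    ; _∨_           = _∪_
    ; _∧_           = _∩_
    ; ∁             = Unary.∁
    ; 𝟙             = λ _ → ⊤
    ; 𝟘             = λ _ → ⊥
    ; op            = op
    ; ∨-cong        = Unary.∪-cong
    ; ∧-cong        = Unary.∩-cong
    ; ∁-cong        = λ (Y⊆Z , Z⊆Y) → (λ x∉Y x∈Z → x∉Y (Z⊆Y x∈Z)) ,
                                      (λ x∉Z x∈Y → x∉Z (Y⊆Z x∈Y))
    ; op-cong       = op-cong
    }

------------------------------------------------------------------------
-- Atom structures

-- The universe is a setoid, since the atoms of an algebra are only
-- determined up to its equality.
record AtomStructure (Ω : Signature) (a ℓ : Level) : Set (lsuc (a ⊔ ℓ)) where
  infix 4 _≈_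
  field
    Atom          : Set a
    _≈_           : Rel Atom ℓ
    isEquivalence : IsEquivalence _≈_
    R             : (o : Op Ω) → Atom → Vec Atom (arity Ω o) → Set ℓ
    R-resp        : ∀ o {s t ss ts} → s ≈ t → Pointwise _≈_ ss ts →
                    R o s ss → R o t ts

  open IsEquivalence isEquivalence public using (refl; sym; trans)

  setoid : Setoid a ℓ
  setoid = record { isEquivalence = isEquivalence }

record _≅ₐ_ {Ω} (S : AtomStructure Ω a ℓ) (T : AtomStructure Ω b ℓ′) :
            Set (a ⊔ b ⊔ ℓ ⊔ ℓ′) where
  private
    module S = AtomStructure S
    module T = AtomStructure T
  field
    bijection : Bijection S.setoid T.setoid
  open Bijection bijection public using (to)
  field
    R-iso : ∀ o s ss → S.R o s ss ⇔ T.R o (to s) (map to ss)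

module _ {Ω : Signature} where

  At : Algebra Ω a ℓ → AtomStructure Ω (a ⊔ ℓ) ℓ
  At A = record
    { Atom          = Σ[ x ∈ Carrier ] IsAtom x
    ; _≈_           = λ x y → proj₁ x ≈ proj₁ y
    ; isEquivalence = record { refl = refl ; sym = sym ; trans = trans }
    ; R             = λ o x xs → proj₁ x ≤ op o (map proj₁ xs)
    ; R-resp        = λ o x≈y xs≈ys →
                        ≤-resp x≈y (op-cong o (Pointwise.map⁺ (λ e → e) xs≈ys))
    }
    where open Algebra A

  module _ (S : AtomStructure Ω ℓ ℓ) where
    open AtomStructure S

    Subset : Set (lsuc ℓ)
    Subset = Σ[ X ∈ Pred Atom ℓ ] X Respects _≈_

    Cm : Algebra Ω (lsuc ℓ) ℓ
    Cm = record
      { Carrier       = Subset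
      ; _≈_           = λ X Y → proj₁ X ≐ proj₁ Y
      ; isEquivalence = record
        { refl  = Unary.≐-refl
        ; sym   = Unary.≐-sym
        ; trans = Unary.≐-trans
        }
      ; _∨_           = λ (X , X-resp) (Y , Y-resp) → X ∪ Y , λ where
                          s≈t (inj₁ s∈X) → inj₁ (X-resp s≈t s∈X)
                          s≈t (inj₂ s∈Y) → inj₂ (Y-resp s≈t s∈Y)
      ; _∧_           = λ (X , X-resp) (Y , Y-resp) → X ∩ Y ,
                          λ s≈t (s∈X , s∈Y) → X-resp s≈t s∈X , Y-resp s≈t s∈Y
      ; ∁             = λ (X , X-resp) → Unary.∁ X ,
                          λ s≈t s∉X t∈X → s∉X (X-resp (sym s≈t) t∈X)
      ; 𝟙             = (λ _ → ⊤) , λ _ x → x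
      ; 𝟘             = (λ _ → ⊥) , λ _ x → x
      ; op            = λ o Xs →
                          (λ s → ∃[ ss ] ((∀ k → lookup ss k ∈ proj₁ (lookup Xs k))
                                          × R o s ss)) ,
                          λ s≈t (ss , ss∈Xs , r) →
                            ss , ss∈Xs ,
                            R-resp o s≈t (Pointwise.refl refl) r
      ; ∨-cong        = Unary.∪-cong
      ; ∧-cong        = Unary.∩-cong
      ; ∁-cong        = λ (X⊆Y , Y⊆X) → (λ s∉X s∈Y → s∉X (Y⊆X s∈Y)) ,
                                        (λ s∉Y s∈X → s∉Y (X⊆Y s∈X))
      ; op-cong       = λ o Xs≈Ys →
          (λ (ss , ss∈Xs , r) →
            ss , (λ k → proj₁ (Pointwise.lookup Xs≈Ys k) (ss∈Xs k)) , r) ,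
          (λ (ss , ss∈Ys , r) →
            ss , (λ k → proj₂ (Pointwise.lookup Xs≈Ys k) (ss∈Ys k)) , r)
      }

    singleton : Atom → Subset
    singleton s = (_≈ s) , λ t≈u t≈s → trans (sym t≈u) t≈s

    Tm : Algebra Ω (lsuc ℓ) ℓ
    Tm = subalgebra Cm
           (generatedBy Cm (λ X → ∃[ s ] Algebra._≈_ Cm X (singleton s)))

  -- All algebras with a given atom structure S are taken in the universe of
  -- Cm S.
  module _ (Class : Algebra Ω 1ℓ 0ℓ → Set r) (S : AtomStructure Ω 0ℓ 0ℓ) where

    HasAtomStructure : Algebra Ω 1ℓ 0ℓ → Set (1ℓ ⊔ r)
    HasAtomStructure A = Class A × Algebra.Atomic A × At A ≅ₐ S

    IsAtomStructureOf : Set (lsuc 1ℓ ⊔ r)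
    IsAtomStructureOf = ∃[ A ] HasAtomStructure A

    module _ (Rep : Algebra Ω 1ℓ 0ℓ → Set q) where

      WeaklyRepresentable : Set (lsuc 1ℓ ⊔ r ⊔ q)
      WeaklyRepresentable = ∃[ A ] (HasAtomStructure A × Rep A)

      StronglyRepresentable : Set (lsuc 1ℓ ⊔ r ⊔ q)
      StronglyRepresentable = ∀ A → HasAtomStructure A → Rep A

------------------------------------------------------------------------
-- Signatures between Df and PEA

record Similarity : Set where
  field
    diagonals replacements transpositions : Bool

open Similarity

df pea : Similarity
df  = record { diagonals = false ; replacements = false ; transpositions = false }
pea = record { diagonals = true  ; replacements = true  ; transpositions = true  }

data PolyadicOp (n : ℕ) (t : Similarity) : Set where
  cyl  : Fin n → PolyadicOp n t
  diag : T (diagonals t)      → Fin n → Fin n → PolyadicOp n t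
  repl : T (replacements t)   → Fin n → Fin n → PolyadicOp n t
  swap : T (transpositions t) → Fin n → Fin n → PolyadicOp n t

Polyadic : ℕ → Similarity → Signature
Polyadic n t = record
  { Op    = PolyadicOp n t
  ; arity = λ where
      (cyl _)      → 1
      (diag _ _ _) → 0
      (repl _ _ _) → 1
      (swap _ _ _) → 1
  }

reduct : ∀ {n} (t : Similarity) →
         Algebra (Polyadic n pea) a ℓ → Algebra (Polyadic n t) a ℓ
reduct t A = record
  { Carrier       = Carrier
  ; _≈_           = _≈_
  ; isEquivalence = isEquivalence
  ; _∨_           = _∨_
  ; _∧_           = _∧_
  ; ∁             = ∁
  ; 𝟙             = 𝟙
  ; 𝟘             = 𝟘
  ; op            = λ where
      (cyl i)      → op (cyl i)
      (diag _ i j) → op (diag tt i j)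
      (repl _ i j) → op (repl tt i j)
      (swap _ i j) → op (swap tt i j)
  ; ∨-cong        = ∨-cong
  ; ∧-cong        = ∧-cong
  ; ∁-cong        = ∁-cong
  ; op-cong       = λ where
      (cyl i)      → op-cong (cyl i)
      (diag _ i j) → op-cong (diag tt i j)
      (repl _ i j) → op-cong (repl tt i j)
      (swap _ i j) → op-cong (swap tt i j)
  }
  where open Algebra A

-- [ i ∣ j ] sends i to j and fixes everything else; the transposition [i,j]
-- is the library's transpose i j.
[_∣_] : ∀ {n} → Fin n → Fin n → Fin n → Fin n
[ i ∣ j ] k = if does (k ≟ i) then j else k

module _ (n : ℕ) (U : Set) where

  _∘ₛ_ : Vec U n → (Fin n → Fin n) → Vec U n
  s ∘ₛ τ = tabulate (lookup s ∘ τ)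

  setOp : (o : PolyadicOp n pea) →
          Vec (Pred (Vec U n) 0ℓ) (arity (Polyadic n pea) o) → Pred (Vec U n) 0ℓ
  setOp (cyl i)      (X ∷ []) s =
    ∃[ t ] (t ∈ X × (∀ j → j ≢ i → lookup t j ≡ lookup s j))
  setOp (diag _ i j) []       s = lookup s i ≡ lookup s j
  setOp (repl _ i j) (X ∷ []) s = (s ∘ₛ [ i ∣ j ]) ∈ X
  setOp (swap _ i j) (X ∷ []) s = (s ∘ₛ transpose i j) ∈ X

  setAlgebra : Algebra (Polyadic n pea) 1ℓ 0ℓ
  setAlgebra = powersetAlgebra (Vec U n) setOp λ where
    (cyl i)      ((X⊆Y , Y⊆X) ∷ []) → (λ (t , t∈X , e) → t , X⊆Y t∈X , e) ,
                                      (λ (t , t∈Y , e) → t , Y⊆X t∈Y , e)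
    (diag _ i j) []                 → Unary.≐-refl
    (repl _ i j) ((X⊆Y , Y⊆X) ∷ []) → X⊆Y , Y⊆X
    (swap _ i j) ((X⊆Y , Y⊆X) ∷ []) → X⊆Y , Y⊆X

Representable : ∀ n (t : Similarity) → Algebra (Polyadic n t) a ℓ →
                Set (lsuc (1ℓ ⊔ a) ⊔ ℓ)
Representable n t = RepresentableBy (λ U → reduct t (setAlgebra n U))

-- The finite schema of Sain and Thompson for (quasi-)polyadic equality
-- algebras; s i j is the replacement and p i j the transposition operator.
record IsPolyadicEqualityAlgebra {n : ℕ} (A : Algebra (Polyadic n pea) a ℓ) :
                                 Set (a ⊔ ℓ) where
  open Algebra A
  c : Fin n → Carrier → Carrier
  c i x = op (cyl i) (x ∷ [])
  d : Fin n → Fin n → Carrier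
  d i j = op (diag tt i j) []
  s : Fin n → Fin n → Carrier → Carrier
  s i j x = op (repl tt i j) (x ∷ [])
  p : Fin n → Fin n → Carrier → Carrier
  p i j x = op (swap tt i j) (x ∷ [])
  field
    isBooleanAlgebra : IsBooleanAlgebra _≈_ _∨_ _∧_ ∁ 𝟙 𝟘
    s-id        : ∀ i x → s i i x ≈ x
    p-id        : ∀ i x → p i i x ≈ x
    p-sym       : ∀ i j x → p i j x ≈ p j i x
    c-increases : ∀ i x → x ≤ c i x
    c-∨         : ∀ i x y → c i (x ∨ y) ≈ (c i x ∨ c i y)
    s-c         : ∀ i j x → s i j (c i x) ≈ c i x
    c-s         : ∀ i j x → i ≢ j → c i (s i j x) ≈ s i j x
    s-c-comm    : ∀ i j k x → k ≢ i → k ≢ j → s i j (c k x) ≈ c k (s i j x)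
    s-∨         : ∀ i j x y → s i j (x ∨ y) ≈ (s i j x ∨ s i j y)
    s-∁         : ∀ i j x → s i j (∁ x) ≈ ∁ (s i j x)
    p-∨         : ∀ i j x y → p i j (x ∨ y) ≈ (p i j x ∨ p i j y)
    p-∁         : ∀ i j x → p i j (∁ x) ≈ ∁ (p i j x)
    p-invol     : ∀ i j x → p i j (p i j x) ≈ x
    p-braid     : ∀ i j k x → i ≢ j → i ≢ k → j ≢ k →
                  p i j (p i k x) ≈ p j k (p i j x)
    p-s         : ∀ i j x → p i j (s i j x) ≈ s j i x
    s-d         : ∀ i j → s i j (d i j) ≈ 𝟙
    d-s         : ∀ i j x → (x ∧ d i j) ≤ s i j x

------------------------------------------------------------------------
-- Relation algebras

data RelationOp : Set where
  identity converse composition : RelationOp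

Relational : Signature
Relational = record
  { Op    = RelationOp
  ; arity = λ where
      identity    → 0
      converse    → 1
      composition → 2
  }

module RelationOps (R : Algebra Relational a ℓ) where
  open Algebra R
  infix  9 _˘
  infixr 8 _⨾_
  1′ : Carrier
  1′ = op identity []
  _˘ : Carrier → Carrier
  x ˘ = op converse (x ∷ [])
  _⨾_ : Carrier → Carrier → Carrier
  x ⨾ y = op composition (x ∷ y ∷ [])

record IsRelationAlgebra (R : Algebra Relational a ℓ) : Set (a ⊔ ℓ) where
  open Algebra R
  open RelationOps R
  field
    isBooleanAlgebra : IsBooleanAlgebra _≈_ _∨_ _∧_ ∁ 𝟙 𝟘
    ⨾-assoc     : ∀ x y z → (x ⨾ y) ⨾ z ≈ x ⨾ (y ⨾ z)
    ⨾-identityʳ : ∀ x → x ⨾ 1′ ≈ x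
    ⨾-∨         : ∀ x y z → (x ∨ y) ⨾ z ≈ (x ⨾ z ∨ y ⨾ z)
    ˘-invol     : ∀ x → (x ˘) ˘ ≈ x
    ˘-∨         : ∀ x y → (x ∨ y) ˘ ≈ (x ˘ ∨ y ˘)
    ˘-⨾         : ∀ x y → (x ⨾ y) ˘ ≈ y ˘ ⨾ x ˘
    tarski      : ∀ x y → x ˘ ⨾ ∁ (x ⨾ y) ≤ ∁ y

relationOp : (U : Set) (o : RelationOp) →
             Vec (Pred (U × U) 0ℓ) (arity Relational o) → Pred (U × U) 0ℓ
relationOp U identity    []           (x , y) = x ≡ y
relationOp U converse    (X ∷ [])     (x , y) = (y , x) ∈ X
relationOp U composition (X ∷ Y ∷ []) (x , z) =
  ∃[ y ] ((x , y) ∈ X × (y , z) ∈ Y)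

fullRelationAlgebra : Set → Algebra Relational 1ℓ 0ℓ
fullRelationAlgebra U = powersetAlgebra (U × U) (relationOp U) λ where
  identity    []                 → Unary.≐-refl
  converse    ((X⊆Y , Y⊆X) ∷ []) → X⊆Y , Y⊆X
  composition ((X⊆X′ , X′⊆X) ∷ (Y⊆Y′ , Y′⊆Y) ∷ []) →
    (λ (y , xy∈ , yz∈) → y , X⊆X′ xy∈ , Y⊆Y′ yz∈) ,
    (λ (y , xy∈ , yz∈) → y , X′⊆X xy∈ , Y′⊆Y yz∈)

RepresentableRA : Algebra Relational a ℓ → Set (lsuc (1ℓ ⊔ a) ⊔ ℓ)
RepresentableRA = RepresentableBy fullRelationAlgebra

------------------------------------------------------------------------
-- Basic matrices

module _ (n : ℕ) (𝑹 : Algebra Relational a ℓ) where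
  open Algebra 𝑹 hiding (setoid)
  open RelationOps 𝑹
  open AtomStructure (At 𝑹) using (Atom) renaming (_≈_ to _≈ₐ_)

  record BasicMatrix : Set (a ⊔ ℓ) where
    field
      entry      : Fin n → Fin n → Atom
      diagonal   : ∀ x → proj₁ (entry x x) ≤ 1′
      symmetric  : ∀ x y → proj₁ (entry y x) ≈ proj₁ (entry x y) ˘
      triangular : ∀ x y z →
                   proj₁ (entry x z) ≤ proj₁ (entry x y) ⨾ proj₁ (entry y z)

  open BasicMatrix

  _∘ₘ_ : BasicMatrix → (Fin n → Fin n) → BasicMatrix
  f ∘ₘ τ = record
    { entry      = λ x y → entry f (τ x) (τ y)
    ; diagonal   = λ x → diagonal f (τ x)
    ; symmetric  = λ x y → symmetric f (τ x) (τ y)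
    ; triangular = λ x y z → triangular f (τ x) (τ y) (τ z)
    }

  _≈ₘ_ : Rel BasicMatrix ℓ
  f ≈ₘ g = ∀ x y → entry f x y ≈ₐ entry g x y

  AgreeOff : Fin n → Rel BasicMatrix ℓ
  AgreeOff i f g = ∀ x y → x ≢ i → y ≢ i → entry f x y ≈ₐ entry g x y

  AgreeOff₂ : Fin n → Fin n → Rel BasicMatrix ℓ
  AgreeOff₂ i j f g = ∀ x y → x ≢ i → x ≢ j → y ≢ i → y ≢ j →
                      entry f x y ≈ₐ entry g x y

  MatR : (o : PolyadicOp n pea) →
         BasicMatrix → Vec BasicMatrix (arity (Polyadic n pea) o) → Set ℓ
  MatR (cyl i)      f (g ∷ []) = AgreeOff i f g
  MatR (diag _ i j) f []       = proj₁ (entry f i j) ≤ 1′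
  MatR (repl _ i j) f (g ∷ []) = (f ∘ₘ [ i ∣ j ]) ≈ₘ g
  MatR (swap _ i j) f (g ∷ []) = (f ∘ₘ transpose i j) ≈ₘ g

  Mat : AtomStructure (Polyadic n pea) (a ⊔ ℓ) ℓ
  Mat = record
    { Atom          = BasicMatrix
    ; _≈_           = _≈ₘ_
    ; isEquivalence = record
      { refl  = λ x y → refl
      ; sym   = λ f≈g x y → sym (f≈g x y)
      ; trans = λ f≈g g≈h x y → trans (f≈g x y) (g≈h x y)
      }
    ; R             = MatR
    ; R-resp        = λ where
        (cyl i)      f≈f′ (g≈g′ ∷ []) r x y x≢i y≢i →
          trans (sym (f≈f′ x y)) (trans (r x y x≢i y≢i) (g≈g′ x y))
        (diag _ i j) f≈f′ [] r → ≤-resp (f≈f′ i j) refl r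
        (repl _ i j) f≈f′ (g≈g′ ∷ []) r x y →
          trans (sym (f≈f′ _ _)) (trans (r x y) (g≈g′ x y))
        (swap _ i j) f≈f′ (g≈g′ ∷ []) r x y →
          trans (sym (f≈f′ _ _)) (trans (r x y) (g≈g′ x y))
    }

  -- The bound on n serves to name the indices 0 and 1.
  module _ (2<n : 2 < n) where

    0ₙ 1ₙ : Fin n
    0ₙ = fromℕ< (ℕ.<-trans (z<s {1}) 2<n)
    1ₙ = fromℕ< (ℕ.<-trans (s<s (z<s {0})) 2<n)

    record IsCylindricBasis (M : Pred BasicMatrix r) : Set (a ⊔ ℓ ⊔ r) where
      field
        atoms   : ∀ (α : Atom) → ∃[ f ] (f ∈ M × entry f 0ₙ 1ₙ ≈ₐ α)
        witness : ∀ f → f ∈ M → ∀ x y z (α β : Atom) →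
                  proj₁ (entry f x y) ≤ proj₁ α ⨾ proj₁ β → z ≢ x → z ≢ y →
                  ∃[ g ] (g ∈ M × AgreeOff z f g ×
                          entry g x z ≈ₐ α × entry g z y ≈ₐ β)
        amalgam : ∀ f g → f ∈ M → g ∈ M → ∀ x y → AgreeOff₂ x y f g →
                  ∃[ h ] (h ∈ M × AgreeOff x f h × AgreeOff y g h)

    record IsPolyadicEqualityBasis (M : Pred BasicMatrix r) :
                                   Set (a ⊔ ℓ ⊔ r) where
      field
        isCylindricBasis : IsCylindricBasis M
        ∘-closed         : ∀ f → f ∈ M → ∀ τ → (f ∘ₘ τ) ∈ M

{-# OPTIONS --safe #-}
-- The atoms of a symmetric relation algebra other than the identity are labels
-- arranged in n + 1 blocks, each block consisting of infinitely many cliques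
-- of N labels; a triple of labels is forbidden when it lies in one block and
-- no two of its members are distinct members of one clique. In a complex
-- algebra the labels of one block at one position of their cliques form an
-- element. These finitely many elements admit no monochromatic triangle, so by
-- Ramsey's theorem a base on which they are represented is finite, while the
-- infinitely many atoms require an infinite base. A term algebra does not
-- contain these elements: a term mentions finitely many atoms and sees only
-- which of the remaining labels lie in one clique and which are equal. With
-- N large enough such patterns cannot tell a finite clique from an infinite
-- one, so it suffices to represent the patterns, and labels of an infinite
-- clique allow every consistent one-point extension of a graph to be realised
-- by a new node, joined to all the other nodes by distinct such labels.
module Submission where

open import Defs
open import Algebra.Lattice.Structures using (IsBooleanAlgebra)
open import Axiom.ExcludedMiddle using (ExcludedMiddle)
open import Data.Bool.Base as Bool using (Bool; true; false; T)
open import Data.Bool.Properties using (T-irrelevant)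
open import Data.Empty using (⊥; ⊥-elim)
import Data.Empty.Polymorphic as Empty
open import Data.Fin.Base as Fin using (Fin; zero; suc; toℕ; fromℕ<; combine; remQuot; punchIn; punchOut)
open import Data.Fin.Permutation.Components using (transpose)
import Data.Fin.Properties as Fin
open import Data.List.Base as List using (List; []; _∷_)
open import Data.List.Membership.Propositional using (find) renaming (_∈_ to _∈ₗ_; _∉_ to _∉ₗ_)
open import Data.List.Membership.Propositional.Properties using (∈-map⁺; ∈-tabulate⁺; ∈-tabulate⁻)
open import Data.List.Properties using (length-map; length-tabulate)
open import Data.List.Relation.Unary.Any as Any using (here; there)
open import Data.List.Relation.Unary.Any.Properties using (lookup-index)
open import Data.Maybe.Base using (Maybe; just; nothing)
import Data.Maybe.Properties as Maybe
open import Data.Nat.Base using (ℕ; zero; suc; _+_; _*_; _≤_; _<_; _⊔_; z≤n; s≤s; z<s; s<s)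
import Data.Nat.Properties as ℕ
open import Data.Product.Base as Product using (∃; ∃-syntax; Σ-syntax; _×_; _,_; proj₁; proj₂)
open import Data.Product.Function.NonDependent.Propositional using (_×-⇔_)
import Data.Product.Properties as Product
open import Data.Sum.Base as Sum using (_⊎_; inj₁; inj₂)
open import Data.Sum.Function.Propositional using (_⊎-⇔_)
open import Data.Unit.Base using (⊤; tt)
import Data.Unit.Polymorphic as Unit
open import Data.Vec.Base using (Vec; []; _∷_; map; lookup; tabulate)
import Data.Vec.Properties as Vec
open import Data.Vec.Relation.Binary.Pointwise.Inductive as Pointwise using (Pointwise; []; _∷_)
open import Data.Vec.Relation.Unary.All using (All; []; _∷_)
open import Function.Base using (_∘_; id)
open import Function.Bundles using (Bijection; _⇔_; mk⇔; Equivalence)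
open import Level as Level using (Level; 0ℓ)
open import Relation.Binary.Definitions using (Tri; tri<; tri≈; tri>)
open import Relation.Binary.PropositionalEquality as ≡ using (_≡_; _≢_; refl; subst)
open import Relation.Nullary.Decidable using (does-⇔)
open import Relation.Nullary.Decidable.Core using (Dec; yes; no; does; ¬?; _×-dec_; True; toWitness; fromWitness)
open import Relation.Nullary.Negation.Core using (¬_; contradiction)
open import Relation.Unary using (Pred; _∈_; _⊆_; _≐_; _∪_; _∩_; U)
import Relation.Unary as Unary
import Relation.Unary.Algebra as Unary
import Relation.Unary.Properties as Unary

-- Both constants come from one-point extensions. A new label or node that must not conflict with n
-- labels at once uses a block which none of them meets, whence B = n + 1. Extending an n by n
-- pattern by one row involves at most n * n + n labels, so a clique of N = n * n + n + 1 labels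
-- always has a position left for the next one. As both are finite, a block together with a position
-- is one of B * N colours.
--
-- The obstacle is that a new node is joined to arbitrarily many older ones by distinct labels of
-- one clique, which a finite clique cannot supply. Hence not all labels of the graph are atoms, and
-- no single matrix describes a tuple. Tuples and matrices are compared at levels K instead: the
-- identity and the labels of the first K finite cliques correspond only to themselves; of any other
-- label only its block is kept, with its equalities and common cliques among the remaining entries.
-- Every operation preserves the level of its arguments, because a one-point extension can be copied
-- in both directions at the same K.

private
  variable
    κ κ₁ κ₂ ℓ ℓ₁ ℓ₂ ℓ₃ : Level

-- Embeddings of algebras

-- A representation is an isomorphism onto a subuniverse of a product. An embedding carries the same
-- information without the subuniverse, so it composes and restricts easily.
record Embedding {Ω} (A : Algebra Ω κ ℓ₁) (B : Algebra Ω κ₁ ℓ₂) :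
                 Set (κ Level.⊔ κ₁ Level.⊔ ℓ₁ Level.⊔ ℓ₂) where
  private
    module A = Algebra A
    module B = Algebra B
  field
    to        : A.Carrier → B.Carrier
    cong      : ∀ {x y} → x A.≈ y → to x B.≈ to y
    injective : ∀ {x y} → to x B.≈ to y → x A.≈ y
    ∨-homo    : ∀ x y → to (x A.∨ y) B.≈ (to x B.∨ to y)
    ∧-homo    : ∀ x y → to (x A.∧ y) B.≈ (to x B.∧ to y)
    ∁-homo    : ∀ x → to (A.∁ x) B.≈ B.∁ (to x)
    𝟙-homo    : to A.𝟙 B.≈ B.𝟙
    𝟘-homo    : to A.𝟘 B.≈ B.𝟘
    op-homo   : ∀ o xs → to (A.op o xs) B.≈ B.op o (map to xs)

module _ {Ω} {A : Algebra Ω κ ℓ₁} {B : Algebra Ω κ₁ ℓ₂} {C : Algebra Ω κ₂ ℓ₃} where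
  private
    module C = Algebra C

  infixr 9 _∘ₑ_
  _∘ₑ_ : Embedding B C → Embedding A B → Embedding A C
  g ∘ₑ f = record
    { to        = g.to ∘ f.to
    ; cong      = g.cong ∘ f.cong
    ; injective = f.injective ∘ g.injective
    ; ∨-homo    = λ x y → C.trans (g.cong (f.∨-homo x y)) (g.∨-homo _ _)
    ; ∧-homo    = λ x y → C.trans (g.cong (f.∧-homo x y)) (g.∧-homo _ _)
    ; ∁-homo    = λ x → C.trans (g.cong (f.∁-homo x)) (g.∁-homo _)
    ; 𝟙-homo    = C.trans (g.cong f.𝟙-homo) g.𝟙-homo
    ; 𝟘-homo    = C.trans (g.cong f.𝟘-homo) g.𝟘-homo
    ; op-homo   = λ o xs → C.trans (g.cong (f.op-homo o xs))
        (subst (λ ys → g.to (Algebra.op B o (map f.to xs)) C.≈ C.op o ys)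
          (≡.sym (Vec.map-∘ g.to f.to xs)) (g.op-homo o (map f.to xs)))
    }
    where
    module f = Embedding f
    module g = Embedding g

idₑ : ∀ {Ω} (A : Algebra Ω κ ℓ) → Embedding A A
idₑ A = record
  { to = id ; cong = id ; injective = id
  ; ∨-homo = λ _ _ → A.refl ; ∧-homo = λ _ _ → A.refl ; ∁-homo = λ _ → A.refl
  ; 𝟙-homo = A.refl ; 𝟘-homo = A.refl
  ; op-homo = λ o xs → subst (λ ys → A.op o xs A.≈ A.op o ys) (≡.sym (Vec.map-id xs)) A.refl
  }
  where module A = Algebra A

inclusion : ∀ {Ω} (A : Algebra Ω κ ℓ) (B : Subuniverse A κ₁) →
            Embedding (subalgebra A B) A
inclusion A B = record
  { to = proj₁ ; cong = id ; injective = id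
  ; ∨-homo = λ _ _ → A.refl ; ∧-homo = λ _ _ → A.refl ; ∁-homo = λ _ → A.refl
  ; 𝟙-homo = A.refl ; 𝟘-homo = A.refl ; op-homo = λ _ _ → A.refl
  }
  where module A = Algebra A

-- A single factor suffices here: the index set is `⊤` and the subuniverse is the image of the
-- embedding.
representable : ∀ {Ω} (K : Set → Algebra Ω 1ℓ 0ℓ) (U : Set) {A : Algebra Ω 1ℓ 0ℓ} →
                Embedding A (K U) → RepresentableBy K A
representable {Ω} K U {A} e = ⊤ , (λ _ → U) , image , record
  { bijection = record
    { to        = λ x → (λ _ → to x) , x , λ _ → KU.refl
    ; cong      = λ x≈y _ → cong x≈y
    ; bijective = (λ fx≈fy → injective (fx≈fy tt)) ,
                  λ (_ , x , fx≈y) → x , λ z≈x i → KU.trans (cong z≈x) (fx≈y i)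
    }
  ; ∨-homo  = λ x y _ → ∨-homo x y
  ; ∧-homo  = λ x y _ → ∧-homo x y
  ; ∁-homo  = λ x _ → ∁-homo x
  ; 𝟙-homo  = λ _ → 𝟙-homo
  ; 𝟘-homo  = λ _ → 𝟘-homo
  ; op-homo = λ o xs _ → subst (λ ys → to (A.op o xs) KU.≈ KU.op o ys)
      (≡.trans (Vec.map-∘ (λ x → x tt) (λ x _ → to x) xs)
        (≡.cong (map (λ x → x tt)) (Vec.map-∘ proj₁ _ xs)))
      (op-homo o xs)
  }
  where
  module A = Algebra A
  module KU = Algebra (K U)
  open Embedding e
  Member : Pred (⊤ → KU.Carrier) 1ℓ
  Member y = ∃[ x ] ∀ i → to x KU.≈ y i
  preimages : ∀ {m} {ys : Vec (⊤ → KU.Carrier) m} → All Member ys →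
    Σ[ xs ∈ Vec A.Carrier m ] Pointwise KU._≈_ (map to xs) (map (λ y → y tt) ys)
  preimages []              = [] , []
  preimages ((x , e) ∷ all) with xs , es ← preimages all = x ∷ xs , e tt ∷ es
  image : Subuniverse (Product ⊤ (λ _ → K U)) 1ℓ
  image = record
    { Member = Member
    ; resp   = λ y≈z (x , e) → x , λ i → KU.trans (e i) (y≈z i)
    ; ∨-mem  = λ (x , d) (y , e) → x A.∨ y , λ i → KU.trans (∨-homo x y) (KU.∨-cong (d i) (e i))
    ; ∧-mem  = λ (x , d) (y , e) → x A.∧ y , λ i → KU.trans (∧-homo x y) (KU.∧-cong (d i) (e i))
    ; ∁-mem  = λ (x , d) → A.∁ x , λ i → KU.trans (∁-homo x) (KU.∁-cong (d i))
    ; 𝟙-mem  = A.𝟙 , λ _ → 𝟙-homo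
    ; 𝟘-mem  = A.𝟘 , λ _ → 𝟘-homo
    ; op-mem = λ o all → let xs , es = preimages all in
        A.op o xs , λ _ → KU.trans (op-homo o xs) (KU.op-cong o es)
    }

-- Transfer of equations along embeddings

data Term (Ω : Signature) (m : ℕ) : Set where
  var     : Fin m → Term Ω m
  _∨′_    : Term Ω m → Term Ω m → Term Ω m
  _∧′_    : Term Ω m → Term Ω m → Term Ω m
  ∁′      : Term Ω m → Term Ω m
  𝟙′ 𝟘′   : Term Ω m
  op′     : (o : Signature.Op Ω) → Vec (Term Ω m) (Signature.arity Ω o) → Term Ω m

v₀ : ∀ {Ω m} → Term Ω (suc m)
v₀ = var zero

v₁ : ∀ {Ω m} → Term Ω (suc (suc m))
v₁ = var (suc zero)

v₂ : ∀ {Ω m} → Term Ω (suc (suc (suc m)))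
v₂ = var (suc (suc zero))

module _ {Ω} (A : Algebra Ω κ ℓ) where
  open Algebra A

  eval  : ∀ {m} → Vec Carrier m → Term Ω m → Carrier
  evals : ∀ {m k} → Vec Carrier m → Vec (Term Ω m) k → Vec Carrier k
  eval ρ (var x)   = lookup ρ x
  eval ρ (t ∨′ u)  = eval ρ t ∨ eval ρ u
  eval ρ (t ∧′ u)  = eval ρ t ∧ eval ρ u
  eval ρ (∁′ t)    = ∁ (eval ρ t)
  eval ρ 𝟙′        = 𝟙
  eval ρ 𝟘′        = 𝟘
  eval ρ (op′ o ts) = op o (evals ρ ts)
  evals ρ []       = []
  evals ρ (t ∷ ts) = eval ρ t ∷ evals ρ ts

module Transfer {Ω} {A : Algebra Ω κ ℓ₁} {B : Algebra Ω κ₁ ℓ₂} (e : Embedding A B) where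
  private
    module A = Algebra A
    module B = Algebra B
  open Embedding e

  to-eval  : ∀ {m} (ρ : Vec A.Carrier m) t → to (eval A ρ t) B.≈ eval B (map to ρ) t
  to-evals : ∀ {m k} (ρ : Vec A.Carrier m) (ts : Vec (Term Ω m) k) →
             Pointwise B._≈_ (map to (evals A ρ ts)) (evals B (map to ρ) ts)
  to-eval ρ (var x)    = B.sym (subst (λ y → lookup (map to ρ) x B.≈ y) (Vec.lookup-map x to ρ) B.refl)
  to-eval ρ (t ∨′ u)   = B.trans (∨-homo _ _) (B.∨-cong (to-eval ρ t) (to-eval ρ u))
  to-eval ρ (t ∧′ u)   = B.trans (∧-homo _ _) (B.∧-cong (to-eval ρ t) (to-eval ρ u))
  to-eval ρ (∁′ t)     = B.trans (∁-homo _) (B.∁-cong (to-eval ρ t))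
  to-eval ρ 𝟙′         = 𝟙-homo
  to-eval ρ 𝟘′         = 𝟘-homo
  to-eval ρ (op′ o ts) = B.trans (op-homo o _) (B.op-cong o (to-evals ρ ts))
  to-evals ρ []        = []
  to-evals ρ (t ∷ ts)  = to-eval ρ t ∷ to-evals ρ ts

  -- Embeddings preserve terms and are injective, so they reflect equations. Each law below is then
  -- cited as a pair of terms.
  transfer : ∀ {m} (t u : Term Ω m) (ρ : Vec A.Carrier m) →
    eval B (map to ρ) t B.≈ eval B (map to ρ) u → eval A ρ t A.≈ eval A ρ u
  transfer t u ρ eq =
    injective (B.trans (to-eval ρ t) (B.trans eq (B.sym (to-eval ρ u))))

  transfer-isBooleanAlgebra :
    IsBooleanAlgebra B._≈_ B._∨_ B._∧_ B.∁ B.𝟙 B.𝟘 →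
    IsBooleanAlgebra A._≈_ A._∨_ A._∧_ A.∁ A.𝟙 A.𝟘
  transfer-isBooleanAlgebra isBA = record
    { isDistributiveLattice = record
      { isLattice = record
        { isEquivalence = A.isEquivalence
        ; ∨-comm     = λ x y → transfer (v₀ ∨′ v₁) (v₁ ∨′ v₀) (x ∷ y ∷ []) (∨-comm _ _)
        ; ∨-assoc    = λ x y z → transfer ((v₀ ∨′ v₁) ∨′ v₂) (v₀ ∨′ (v₁ ∨′ v₂)) (x ∷ y ∷ z ∷ []) (∨-assoc _ _ _)
        ; ∨-cong     = A.∨-cong
        ; ∧-comm     = λ x y → transfer (v₀ ∧′ v₁) (v₁ ∧′ v₀) (x ∷ y ∷ []) (∧-comm _ _)
        ; ∧-assoc    = λ x y z → transfer ((v₀ ∧′ v₁) ∧′ v₂) (v₀ ∧′ (v₁ ∧′ v₂)) (x ∷ y ∷ z ∷ []) (∧-assoc _ _ _)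
        ; ∧-cong     = A.∧-cong
        ; absorptive =
            (λ x y → transfer (v₀ ∨′ (v₀ ∧′ v₁)) v₀ (x ∷ y ∷ []) (∨-absorbs-∧ _ _)) ,
            (λ x y → transfer (v₀ ∧′ (v₀ ∨′ v₁)) v₀ (x ∷ y ∷ []) (∧-absorbs-∨ _ _))
        }
      ; ∨-distrib-∧ =
          (λ x y z → transfer (v₀ ∨′ (v₁ ∧′ v₂)) ((v₀ ∨′ v₁) ∧′ (v₀ ∨′ v₂)) (x ∷ y ∷ z ∷ []) (∨-distribˡ-∧ _ _ _)) ,
          (λ x y z → transfer ((v₁ ∧′ v₂) ∨′ v₀) ((v₁ ∨′ v₀) ∧′ (v₂ ∨′ v₀)) (x ∷ y ∷ z ∷ []) (∨-distribʳ-∧ _ _ _))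
      ; ∧-distrib-∨ =
          (λ x y z → transfer (v₀ ∧′ (v₁ ∨′ v₂)) ((v₀ ∧′ v₁) ∨′ (v₀ ∧′ v₂)) (x ∷ y ∷ z ∷ []) (∧-distribˡ-∨ _ _ _)) ,
          (λ x y z → transfer ((v₁ ∨′ v₂) ∧′ v₀) ((v₁ ∧′ v₀) ∨′ (v₂ ∧′ v₀)) (x ∷ y ∷ z ∷ []) (∧-distribʳ-∨ _ _ _))
      }
    ; ∨-complement =
        (λ x → transfer (∁′ v₀ ∨′ v₀) 𝟙′ (x ∷ []) (∨-complementˡ _)) ,
        (λ x → transfer (v₀ ∨′ ∁′ v₀) 𝟙′ (x ∷ []) (∨-complementʳ _))
    ; ∧-complement =
        (λ x → transfer (∁′ v₀ ∧′ v₀) 𝟘′ (x ∷ []) (∧-complementˡ _)) ,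
        (λ x → transfer (v₀ ∧′ ∁′ v₀) 𝟘′ (x ∷ []) (∧-complementʳ _))
    ; ¬-cong = A.∁-cong
    }
    where open IsBooleanAlgebra isBA

module _ {A : Algebra Relational κ ℓ₁} {B : Algebra Relational κ₁ ℓ₂} (e : Embedding A B) where
  open Transfer e

  transfer-isRelationAlgebra : IsRelationAlgebra B → IsRelationAlgebra A
  transfer-isRelationAlgebra isRA = record
    { isBooleanAlgebra = transfer-isBooleanAlgebra (isBooleanAlgebra)
    ; ⨾-assoc     = λ x y z → transfer ((v₀ ⨾ v₁) ⨾ v₂) (v₀ ⨾ (v₁ ⨾ v₂)) (x ∷ y ∷ z ∷ []) (⨾-assoc _ _ _)
    ; ⨾-identityʳ = λ x → transfer (v₀ ⨾ op′ identity []) v₀ (x ∷ []) (⨾-identityʳ _)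
    ; ⨾-∨         = λ x y z → transfer ((v₀ ∨′ v₁) ⨾ v₂) ((v₀ ⨾ v₂) ∨′ (v₁ ⨾ v₂)) (x ∷ y ∷ z ∷ []) (⨾-∨ _ _ _)
    ; ˘-invol     = λ x → transfer (v₀ ˘ ˘) v₀ (x ∷ []) (˘-invol _)
    ; ˘-∨         = λ x y → transfer ((v₀ ∨′ v₁) ˘) ((v₀ ˘) ∨′ (v₁ ˘)) (x ∷ y ∷ []) (˘-∨ _ _)
    ; ˘-⨾         = λ x y → transfer ((v₀ ⨾ v₁) ˘) ((v₁ ˘) ⨾ (v₀ ˘)) (x ∷ y ∷ []) (˘-⨾ _ _)
    -- The order abbreviates `x ∧ y ≈ x`, which makes this law an equation between terms too.
    ; tarski      = λ x y → transfer (((v₀ ˘) ⨾ ∁′ (v₀ ⨾ v₁)) ∧′ ∁′ v₁) ((v₀ ˘) ⨾ ∁′ (v₀ ⨾ v₁))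
                                     (x ∷ y ∷ []) (tarski _ _)
    }
    where
    open IsRelationAlgebra isRA
    _⨾_ : ∀ {m} → Term Relational m → Term Relational m → Term Relational m
    t ⨾ u = op′ composition (t ∷ u ∷ [])
    _˘ : ∀ {m} → Term Relational m → Term Relational m
    t ˘ = op′ converse (t ∷ [])

-- Complex algebras and their atoms

module ComplexAlgebra (em : ∀ {ℓ} → ExcludedMiddle ℓ) {Ω} (S : AtomStructure Ω 0ℓ 0ℓ) where
  private
    module S = AtomStructure S
    module C = Algebra (Cm S)

  Cm-isBooleanAlgebra : IsBooleanAlgebra C._≈_ C._∨_ C._∧_ C.∁ C.𝟙 C.𝟘
  Cm-isBooleanAlgebra = record
    { isDistributiveLattice = record
      { isLattice = record
        { isEquivalence = C.isEquivalence
        ; ∨-comm     = λ (X , _) (Y , _) → Unary.∪-comm X Y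
        ; ∨-assoc    = λ (X , _) (Y , _) (Z , _) → Unary.∪-assoc X Y Z
        ; ∨-cong     = λ {w} {x} {y} {z} → C.∨-cong {w} {x} {y} {z}
        ; ∧-comm     = λ (X , _) (Y , _) → Unary.∩-comm X Y
        ; ∧-assoc    = λ (X , _) (Y , _) (Z , _) → Unary.∩-assoc X Y Z
        ; ∧-cong     = λ {w} {x} {y} {z} → C.∧-cong {w} {x} {y} {z}
        ; absorptive = (λ (X , _) (Y , _) → Unary.∪-abs-∩ X Y) , λ (X , _) (Y , _) → Unary.∩-abs-∪ X Y
        }
      ; ∨-distrib-∧ = (λ (X , _) (Y , _) (Z , _) → Unary.∪-distribˡ-∩ X Y Z) ,
                      (λ (X , _) (Y , _) (Z , _) → Unary.∪-distribʳ-∩ X Y Z)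
      ; ∧-distrib-∨ = (λ (X , _) (Y , _) (Z , _) → Unary.∩-distribˡ-∪ X Y Z) ,
                      (λ (X , _) (Y , _) (Z , _) → Unary.∩-distribʳ-∪ X Y Z)
      }
    ; ∨-complement = (λ (X , _) → _ , λ {s} _ → [∁∪] X s) , (λ (X , _) → _ , λ {s} _ → [∪∁] X s)
    ; ∧-complement = (λ (X , _) → (λ (s∉ , s∈) → contradiction s∈ s∉) , λ ()) ,
                     (λ (X , _) → (λ (s∈ , s∉) → contradiction s∈ s∉) , λ ())
    ; ¬-cong = λ {x} {y} → C.∁-cong {x} {y}
    }
    where
    [∁∪] : ∀ X s → (¬ X s) ⊎ X s
    [∁∪] X s with em {P = X s}
    ... | yes s∈ = inj₂ s∈
    ... | no  ∉ = inj₁ ∉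
    [∪∁] : ∀ X s → X s ⊎ (¬ X s)
    [∪∁] X s with em {P = X s}
    ... | yes s∈ = inj₁ s∈
    ... | no  ∉ = inj₂ ∉

  -- Shared by `𝑹`, the complex algebras and the term algebras. Each of them embeds into a complex
  -- algebra with all singletons in the image, and this determines its atoms.
  module Atoms {A : Algebra Ω κ 0ℓ} (e : Embedding A (Cm S))
               (point : ∀ s → ∃[ x ] Embedding.to e x C.≈ singleton S s) where
    private
      module A = Algebra A
    open Embedding e

    nonempty : ∀ x → ¬ (x A.≈ A.𝟘) → ∃[ s ] s ∈ proj₁ (to x)
    nonempty x x≉𝟘 with em {P = ∃[ s ] s ∈ proj₁ (to x)}
    ... | yes s∈ = s∈
    ... | no  ∉  = contradiction
      (injective (Unary.≐-trans ((λ s∈ → contradiction (_ , s∈) ∉) , λ ()) (Unary.≐-sym 𝟘-homo))) x≉𝟘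

    ≤⇒⊆ : ∀ {x y} → x A.≤ y → proj₁ (to x) ⊆ proj₁ (to y)
    ≤⇒⊆ {x} {y} x≤y s∈ = proj₂ (proj₁ (∧-homo x y) (proj₂ (cong x≤y) s∈))

    ⊆⇒≤ : ∀ {x y} → proj₁ (to x) ⊆ proj₁ (to y) → x A.≤ y
    ⊆⇒≤ {x} {y} x⊆y = injective (Unary.≐-trans (∧-homo x y) (proj₁ , λ s∈ → s∈ , x⊆y s∈))

    atom : S.Atom → A.Carrier
    atom s = proj₁ (point s)

    ∈-atom : ∀ s → s ∈ proj₁ (to (atom s))
    ∈-atom s = proj₂ (proj₂ (point s)) S.refl

    atom-≤ : ∀ {x s} → s ∈ proj₁ (to x) → atom s A.≤ x
    atom-≤ {x} {s} s∈x = ⊆⇒≤ λ t∈ → proj₂ (to x) (S.sym (proj₁ (proj₂ (point s)) t∈)) s∈x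

    inhabited : ∀ {x s} → s ∈ proj₁ (to x) → ¬ (x A.≈ A.𝟘)
    inhabited s∈x x≈𝟘 with () ← proj₁ 𝟘-homo (proj₁ (cong x≈𝟘) s∈x)

    atom-isAtom : ∀ s → A.IsAtom (atom s)
    atom-isAtom s = inhabited (∈-atom s) , λ y y≤ → minimal y y≤ em
      where
      minimal : ∀ y → y A.≤ atom s → Dec (s ∈ proj₁ (to y)) → (y A.≈ A.𝟘) ⊎ (y A.≈ atom s)
      minimal y y≤ (yes s∈y) = inj₂ (injective (≤⇒⊆ y≤ ,
        λ t∈ → proj₂ (to y) (S.sym (proj₁ (proj₂ (point s)) t∈)) s∈y))
      minimal y y≤ (no s∉y) = inj₁ (injective (Unary.≐-trans
        ((λ t∈ → contradiction (proj₂ (to y) (proj₁ (proj₂ (point s)) (≤⇒⊆ y≤ t∈)) t∈) s∉y) , λ ())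
        (Unary.≐-sym 𝟘-homo)))

    atomic : A.Atomic
    atomic x x≉𝟘 with s , s∈x ← nonempty x x≉𝟘 = atom s , atom-isAtom s , atom-≤ s∈x

    el : ∃ A.IsAtom → S.Atom
    el (x , x≉𝟘 , _) = proj₁ (nonempty x x≉𝟘)

    ∈-el : ∀ α → el α ∈ proj₁ (to (proj₁ α))
    ∈-el (x , x≉𝟘 , _) = proj₂ (nonempty x x≉𝟘)

    -- The singleton at `el α` is a nonzero element below the atom, so minimality makes the two
    -- equal.
    to-atom : ∀ α → to (proj₁ α) C.≈ singleton S (el α)
    to-atom α@(x , _ , minimal) with minimal (atom (el α)) (atom-≤ (∈-el α))
    ... | inj₁ ≈𝟘 = contradiction ≈𝟘 (inhabited (∈-atom _))
    ... | inj₂ ≈x = Unary.≐-trans (Unary.≐-sym (cong ≈x)) (proj₂ (point (el α)))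

    el-unique : ∀ α {s} → s ∈ proj₁ (to (proj₁ α)) → s S.≈ el α
    el-unique α = proj₁ (to-atom α)

    atom≤⇔∈ : ∀ α {x} → (proj₁ α A.≤ x) ⇔ (el α ∈ proj₁ (to x))
    atom≤⇔∈ α {x} = mk⇔ (λ α≤x → ≤⇒⊆ α≤x (∈-el α))
      (λ α∈x → ⊆⇒≤ λ t∈ → proj₂ (to x) (S.sym (el-unique α t∈)) α∈x)

    R-iso : ∀ o α αs → (proj₁ α A.≤ A.op o (map proj₁ αs)) ⇔ S.R o (el α) (map el αs)
    R-iso o α αs = mk⇔
      (λ α≤ → let ss , ss∈ , r = proj₁ (op-homo o xs) (Equivalence.to (atom≤⇔∈ α) α≤) in
        S.R-resp o S.refl (elements αs ss∈) r)
      (λ r → Equivalence.from (atom≤⇔∈ α)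
        (proj₂ (op-homo o xs) (map el αs , (λ k → element αs k) , r)))
      where
      xs = map proj₁ αs
      elements : ∀ {k} (αs : Vec (∃ A.IsAtom) k) {ss} →
        (∀ i → lookup ss i ∈ proj₁ (lookup (map to (map proj₁ αs)) i)) → Pointwise S._≈_ ss (map el αs)
      elements []       {[]}     _  = []
      elements (α ∷ αs) {s ∷ ss} ∈s = el-unique α (∈s zero) ∷ elements αs (∈s ∘ suc)
      element : ∀ {k} (αs : Vec (∃ A.IsAtom) k) i →
        lookup (map el αs) i ∈ proj₁ (lookup (map to (map proj₁ αs)) i)
      element (α ∷ αs) zero    = ∈-el α
      element (α ∷ αs) (suc i) = element αs i

    el-cong : ∀ {α β} → proj₁ α A.≈ proj₁ β → el α S.≈ el β
    el-cong {α} {β} α≈β = el-unique β (proj₁ (cong α≈β) (∈-el α))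

    el-injective : ∀ {α β} → el α S.≈ el β → proj₁ α A.≈ proj₁ β
    el-injective {α} {β} e = injective (Unary.≐-trans (to-atom α)
      (Unary.≐-trans ((λ ≈α → S.trans ≈α e) , (λ ≈β → S.trans ≈β (S.sym e))) (Unary.≐-sym (to-atom β))))

    el-atom : ∀ s → el (atom s , atom-isAtom s) S.≈ s
    el-atom s = S.sym (el-unique (atom s , atom-isAtom s) (∈-atom s))

    At≅ : At A ≅ₐ S
    At≅ = record
      { bijection = record
        { to        = el
        ; cong      = λ {α} {β} → el-cong {α} {β}
        ; bijective = (λ {α} {β} → el-injective {α} {β}) ,
            λ s → (atom s , atom-isAtom s) ,
              λ {β} β≈ → S.trans (el-cong {β} {atom s , atom-isAtom s} β≈) (el-atom s)
        }
      ; R-iso = R-iso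
      }

-- Carries the relation algebra axioms from `colours`, where equality is propositional, to the
-- setoid `At 𝑹`. Sets are transported as preimages under the inverse isomorphism.
Cm-embedding : ∀ {Ω} {S S′ : AtomStructure Ω 0ℓ 0ℓ} → S ≅ₐ S′ → Embedding (Cm S) (Cm S′)
Cm-embedding {Ω} {S} {S′} i = record
  { to        = λ (X , X-resp) → (λ s → from s ∈ X) , λ s≈t → X-resp (from-cong s≈t)
  ; cong      = λ (X⊆Y , Y⊆X) → X⊆Y , Y⊆X
  ; injective = λ {X} {Y} (X⊆Y , Y⊆X) →
      (λ {s} s∈ → proj₂ Y (from-to s) (X⊆Y (proj₂ X (S.sym (from-to s)) s∈))) ,
      (λ {s} s∈ → proj₂ X (from-to s) (Y⊆X (proj₂ Y (S.sym (from-to s)) s∈)))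
  ; ∨-homo    = λ _ _ → id , id
  ; ∧-homo    = λ _ _ → id , id
  ; ∁-homo    = λ _ → id , id
  ; 𝟙-homo    = id , id
  ; 𝟘-homo    = id , id
  ; op-homo   = λ o Xs →
      (λ (ss , ss∈ , r) → map to ss , forth Xs ss ss∈ ,
         S′.R-resp o (to-from _) (Pointwise.refl S′.refl) (Equivalence.to (R-iso o _ ss) r)) ,
      (λ {s} (ss , ss∈ , r) → map from ss , back Xs ss ss∈ ,
         Equivalence.from (R-iso o _ (map from ss))
           (S′.R-resp o (S′.sym (to-from s)) (to-froms ss) r))
  }
  where
  module S = AtomStructure S
  module S′ = AtomStructure S′
  open _≅ₐ_ i
  open Bijection bijection using (cong; injective; strictlySurjective)
  from : S′.Atom → S.Atom
  from s = proj₁ (strictlySurjective s)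
  to-from : ∀ s → to (from s) S′.≈ s
  to-from s = proj₂ (strictlySurjective s)
  from-cong : ∀ {s t} → s S′.≈ t → from s S.≈ from t
  from-cong e = injective (S′.trans (to-from _) (S′.trans e (S′.sym (to-from _))))
  from-to : ∀ s → from (to s) S.≈ s
  from-to s = injective (to-from (to s))
  F : Subset S → Subset S′
  F (X , X-resp) = (λ s → from s ∈ X) , λ s≈t → X-resp (from-cong s≈t)
  forth : ∀ {k} (Xs : Vec (Subset S) k) ss → (∀ j → lookup ss j ∈ proj₁ (lookup Xs j)) →
          ∀ j → lookup (map to ss) j ∈ proj₁ (lookup (map F Xs) j)
  forth ((X , X-resp) ∷ Xs) (s ∷ ss) ss∈ zero    = X-resp (S.sym (from-to s)) (ss∈ zero)
  forth (X ∷ Xs)            (s ∷ ss) ss∈ (suc j) = forth Xs ss (ss∈ ∘ suc) j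
  back : ∀ {k} (Xs : Vec (Subset S) k) ss → (∀ j → lookup ss j ∈ proj₁ (lookup (map F Xs) j)) →
         ∀ j → lookup (map from ss) j ∈ proj₁ (lookup Xs j)
  back (X ∷ Xs) (s ∷ ss) ss∈ zero    = ss∈ zero
  back (X ∷ Xs) (s ∷ ss) ss∈ (suc j) = back Xs ss (ss∈ ∘ suc) j
  to-froms : ∀ {k} (ss : Vec S′.Atom k) → Pointwise S′._≈_ ss (map to (map from ss))
  to-froms []       = []
  to-froms (s ∷ ss) = S′.sym (to-from s) ∷ to-froms ss

open ≡ using (sym; trans; cong; cong₂; subst₂)
open Equivalence using (to; from)

-- Labels and patterns of labels

⇔-refl : ∀ {a} {A : Set a} → A ⇔ A
⇔-refl = mk⇔ id id

⇔-sym : ∀ {a b} {A : Set a} {B : Set b} → A ⇔ B → B ⇔ A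
⇔-sym f = mk⇔ (from f) (to f)

⇔-trans : ∀ {a b c} {A : Set a} {B : Set b} {C : Set c} →
          A ⇔ B → B ⇔ C → A ⇔ C
⇔-trans f g = mk⇔ (to g ∘ to f) (from f ∘ from g)

-- Pigeonhole: m values cannot exhaust the m + 1 numbers up to m. The bound on p keeps spare blocks
-- below `B` and spare positions below `N`.
fresh : ∀ {m} (g : Fin m → ℕ) → ∃[ p ] (p ≤ m × ∀ x → g x ≢ p)
fresh {m} g with Fin.any? {n = suc m} (λ p → Fin.all? λ x → ¬? (g x ℕ.≟ toℕ p))
... | yes (p , p∉) = toℕ p , ℕ.≤-pred (Fin.toℕ<n p) , p∉
... | no  all-hit  = ⊥-elim (i≢j (Fin.toℕ-injective (trans (sym (proj₂ (hit i)))
                       (trans (cong g same) (proj₂ (hit j))))))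
  where
  hit : ∀ p → ∃[ x ] g x ≡ toℕ p
  hit p with Fin.any? (λ x → g x ℕ.≟ toℕ p)
  ... | yes h = h
  ... | no ¬h = ⊥-elim (all-hit (p , λ x e → ¬h (x , e)))
  clash = Fin.pigeonhole (ℕ.n<1+n m) (proj₁ ∘ hit)
  i = proj₁ clash
  j = proj₁ (proj₂ clash)
  same = proj₂ (proj₂ (proj₂ clash))
  i≢j : i ≢ j
  i≢j = Fin.<⇒≢ (proj₁ (proj₂ (proj₂ clash)))

fresh-list : (xs : List ℕ) → ∃[ p ] (p ≤ List.length xs × p ∉ₗ xs)
fresh-list xs with p , p≤ , p∉ ← fresh (List.lookup xs) =
  p , p≤ , λ p∈ → p∉ (Any.index p∈) (sym (lookup-index p∈))

upper-bound : ∀ {m} (g : Fin m → ℕ) → ∃[ K ] ∀ x → g x ≤ K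
upper-bound {zero}  g = 0 , λ ()
upper-bound {suc m} g with K , ≤K ← upper-bound (g ∘ suc) =
  g zero ⊔ K , λ where
    zero    → ℕ.m≤m⊔n _ _
    (suc x) → ℕ.≤-trans (≤K x) (ℕ.m≤n⊔m (g zero) K)

upper-bound-list : (xs : List ℕ) → ∃[ K ] ∀ {x} → x ∈ₗ xs → x ≤ K
upper-bound-list xs with K , ≤K ← upper-bound (List.lookup xs) =
  K , λ x∈ → subst (_≤ K) (sym (lookup-index x∈)) (≤K (Any.index x∈))

-- The label lab i k p lies in block i, in the clique number k of that block,
-- at position p of the clique.
data Label : Set where
  one : Label
  lab : (i k p : ℕ) → Label

lab-injective : ∀ {i k p i′ k′ p′} → lab i k p ≡ lab i′ k′ p′ →
                i ≡ i′ × k ≡ k′ × p ≡ p′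
lab-injective refl = refl , refl , refl

_≟ₗ_ : (a b : Label) → Dec (a ≡ b)
one       ≟ₗ one          = yes refl
one       ≟ₗ lab _ _ _    = no λ ()
lab _ _ _ ≟ₗ one          = no λ ()
lab i k p ≟ₗ lab i′ k′ p′ with i ℕ.≟ i′ | k ℕ.≟ k′ | p ℕ.≟ p′
... | yes refl | yes refl | yes refl = yes refl
... | no i≢    | _        | _        = no λ e → i≢ (proj₁ (lab-injective e))
... | yes _    | no k≢    | _        = no λ e → k≢ (proj₁ (proj₂ (lab-injective e)))
... | yes _    | yes _    | no p≢    = no λ e → p≢ (proj₂ (proj₂ (lab-injective e)))

block position : Label → ℕ
block one = 0
block (lab i _ _) = i
position one = 0
position (lab _ _ p) = p

clique : Label → Maybe (ℕ × ℕ)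
clique one         = nothing
clique (lab i k _) = just (i , k)

clique-number : Label → ℕ
clique-number one         = 0
clique-number (lab _ k _) = k

clique⇒one : ∀ {a b} → clique a ≡ clique b → a ≡ one → b ≡ one
clique⇒one {b = one} _ refl = refl

clique⇒block : ∀ {a b} → clique a ≡ clique b → block a ≡ block b
clique⇒block {one}       {one}       _    = refl
clique⇒block {lab _ _ _} {lab _ _ _} refl = refl

clique⇒number : ∀ {a b} → clique a ≡ clique b → clique-number a ≡ clique-number b
clique⇒number {one}       {one}       _    = refl
clique⇒number {lab _ _ _} {lab _ _ _} refl = refl

Separated : Label → Label → Set
Separated a b = block a ≢ block b ⊎ (clique a ≡ clique b × a ≢ b)

separated-sym : ∀ {a b} → Separated a b → Separated b a
separated-sym (inj₁ i≢)      = inj₁ (i≢ ∘ sym)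
separated-sym (inj₂ (e , ≢)) = inj₂ (sym e , ≢ ∘ sym)

-- The consistent triples: a triple of non-identity labels is forbidden when
-- its members lie in one block and no two of them are distinct members of a
-- clique.
data Triangle : Label → Label → Label → Set where
  one₁ : ∀ {b} → Triangle one b b
  one₂ : ∀ {b} → Triangle b one b
  one₃ : ∀ {b} → Triangle b b one
  gen  : ∀ {a b c} → a ≢ one → b ≢ one → c ≢ one →
         Separated a b ⊎ Separated b c ⊎ Separated a c → Triangle a b c

swap-triangle : ∀ {a b c} → Triangle a b c → Triangle b a c
swap-triangle one₁ = one₂
swap-triangle one₂ = one₁
swap-triangle one₃ = one₃
swap-triangle (gen a b c (inj₁ s))        = gen b a c (inj₁ (separated-sym s))
swap-triangle (gen a b c (inj₂ (inj₁ s))) = gen b a c (inj₂ (inj₂ s))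
swap-triangle (gen a b c (inj₂ (inj₂ s))) = gen b a c (inj₂ (inj₁ s))

rotate-triangle : ∀ {a b c} → Triangle a b c → Triangle b c a
rotate-triangle one₁ = one₃
rotate-triangle one₂ = one₁
rotate-triangle one₃ = one₂
rotate-triangle (gen a b c (inj₁ s))        = gen b c a (inj₂ (inj₂ (separated-sym s)))
rotate-triangle (gen a b c (inj₂ (inj₁ s))) = gen b c a (inj₁ s)
rotate-triangle (gen a b c (inj₂ (inj₂ s))) = gen b c a (inj₂ (inj₁ (separated-sym s)))

flip-triangle : ∀ {a b c} → Triangle a b c → Triangle a c b
flip-triangle t = swap-triangle (rotate-triangle (rotate-triangle t))

triangle-one₁ : ∀ {b c} → Triangle one b c → b ≡ c
triangle-one₁ one₁ = refl
triangle-one₁ one₂ = refl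
triangle-one₁ one₃ = refl
triangle-one₁ (gen ≢ _ _ _) = contradiction refl ≢

triangle-one₂ : ∀ {b c} → Triangle b one c → b ≡ c
triangle-one₂ t = triangle-one₁ (swap-triangle t)

triangle-one₃ : ∀ {a b} → Triangle a b one → a ≡ b
triangle-one₃ t = triangle-one₁ (rotate-triangle (rotate-triangle t))

no-monochromatic-triangle : ∀ {a b c} → a ≢ one → b ≢ one → c ≢ one →
  block a ≡ block b → block b ≡ block c →
  position a ≡ position b → position b ≡ position c → ¬ Triangle a b c
no-monochromatic-triangle a≢ b≢ c≢ _ _ _ _ one₁ = a≢ refl
no-monochromatic-triangle a≢ b≢ c≢ _ _ _ _ one₂ = b≢ refl
no-monochromatic-triangle a≢ b≢ c≢ _ _ _ _ one₃ = c≢ refl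
no-monochromatic-triangle {a} {b} {c} _ _ _ ab bc ab′ bc′ (gen _ _ _ s) = apart s
  where
  same : ∀ {a b} → block a ≡ block b → position a ≡ position b → ¬ Separated a b
  same e _ (inj₁ ≢) = ≢ e
  same {one}       {one}       _ _    (inj₂ (_ , ≢))    = ≢ refl
  same {lab _ _ _} {lab _ _ _} _ refl (inj₂ (refl , ≢)) = ≢ refl
  apart : ¬ (Separated a b ⊎ Separated b c ⊎ Separated a c)
  apart (inj₁ s)        = same ab ab′ s
  apart (inj₂ (inj₁ s)) = same bc bc′ s
  apart (inj₂ (inj₂ s)) = same (trans ab bc) (trans ab′ bc′) s

-- These are the labels known by name at level K. The lower bound excludes clique number 0, which is
-- reserved for the infinite clique, at every level.
Fixed : ℕ → Label → Set
Fixed K a = a ≡ one ⊎ (0 < clique-number a × clique-number a ≤ K)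

fixed? : ∀ K a → Dec (Fixed K a)
fixed? K one = yes (inj₁ refl)
fixed? K (lab i zero p) = no λ { (inj₁ ()) ; (inj₂ (() , _)) }
fixed? K (lab i (suc k) p) with suc k ℕ.≤? K
... | yes ≤K = yes (inj₂ (s≤s z≤n , ≤K))
... | no ≰K  = no λ { (inj₁ ()) ; (inj₂ (_ , ≤K)) → ≰K ≤K }

fixed-resp : ∀ {K a b} → clique a ≡ clique b → Fixed K a → Fixed K b
fixed-resp e (inj₁ a≡one) = inj₁ (clique⇒one e a≡one)
fixed-resp {a = a} {b} e (inj₂ (0<k , k≤K)) rewrite clique⇒number {a} {b} e = inj₂ (0<k , k≤K)

fixed-mono : ∀ {K L a} → K ≤ L → Fixed K a → Fixed L a
fixed-mono K≤L (inj₁ e)           = inj₁ e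
fixed-mono K≤L (inj₂ (0<k , k≤K)) = inj₂ (0<k , ℕ.≤-trans k≤K K≤L)

-- A fixed label corresponds to itself alone. Of a moved one only the block is remembered; how it
-- relates to other labels is the business of `Alike`.
data Agree (K : ℕ) : Label → Label → Set where
  fixed : ∀ {a} → Fixed K a → Agree K a a
  moved : ∀ {a b} → ¬ Fixed K a → ¬ Fixed K b → block a ≡ block b → Agree K a b

agree-refl : ∀ K a → Agree K a a
agree-refl K a with fixed? K a
... | yes f = fixed f
... | no ¬f = moved ¬f ¬f refl

agree-sym : ∀ {K a b} → Agree K a b → Agree K b a
agree-sym (fixed f)     = fixed f
agree-sym (moved f g e) = moved g f (sym e)

agree-antimono : ∀ {K L a b} → K ≤ L → Agree L a b → Agree K a b
agree-antimono {K} {a = a} K≤L (fixed _) = agree-refl K a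
agree-antimono K≤L (moved f g e) = moved (f ∘ fixed-mono K≤L) (g ∘ fixed-mono K≤L) e

agree-block : ∀ {K a b} → Agree K a b → block a ≡ block b
agree-block (fixed _)     = refl
agree-block (moved _ _ e) = e

agree-one : ∀ {K a b} → Agree K a b → a ≡ one → b ≡ one
agree-one (fixed _)     e = e
agree-one (moved f _ _) e = contradiction (inj₁ e) f

agree-fixed : ∀ {K a b} → Agree K a b → Fixed K b → a ≡ b
agree-fixed (fixed _)     _ = refl
agree-fixed (moved _ g _) f = contradiction f g

-- Two families of labels are compared entry by entry: p and q are pairs of
-- corresponding entries.
record Alike (p q : Label × Label) : Set where
  constructor alike
  field
    ≡-alike      : (proj₁ p ≡ proj₁ q) ⇔ (proj₂ p ≡ proj₂ q)
    clique-alike : (clique (proj₁ p) ≡ clique (proj₁ q)) ⇔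
                   (clique (proj₂ p) ≡ clique (proj₂ q))
open Alike public

alike-refl : ∀ {p} → Alike p p
alike-refl = alike (mk⇔ (λ _ → refl) (λ _ → refl)) (mk⇔ (λ _ → refl) (λ _ → refl))

alike-sym : ∀ {p q} → Alike p q → Alike q p
alike-sym (alike e c) = alike (mk⇔ (sym ∘ to e ∘ sym) (sym ∘ from e ∘ sym))
                              (mk⇔ (sym ∘ to c ∘ sym) (sym ∘ from c ∘ sym))

alike-flip : ∀ {a b c d} → Alike (a , b) (c , d) → Alike (b , a) (d , c)
alike-flip (alike e c) = alike (⇔-sym e) (⇔-sym c)

separated-transfer : ∀ {K a b a′ b′} → Agree K a a′ → Agree K b b′ →
  Alike (a , a′) (b , b′) → Separated a b → Separated a′ b′
separated-transfer aa′ bb′ _ (inj₁ i≢) =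
  inj₁ λ e → i≢ (trans (agree-block aa′) (trans e (sym (agree-block bb′))))
separated-transfer aa′ bb′ al (inj₂ (c , ≢)) =
  inj₂ (to (clique-alike al) c , ≢ ∘ from (≡-alike al))

-- Consistency depends only on which labels are the identity, on their blocks, and on equality and
-- common cliques, all of which are preserved.
triangle-transfer : ∀ {K a b c a′ b′ c′} →
  Agree K a a′ → Agree K b b′ → Agree K c c′ →
  Alike (a , a′) (b , b′) → Alike (b , b′) (c , c′) → Alike (a , a′) (c , c′) →
  Triangle a b c → Triangle a′ b′ c′
triangle-transfer a b c ab bc ac one₁
  rewrite agree-one a refl | to (≡-alike bc) refl = one₁
triangle-transfer a b c ab bc ac one₂
  rewrite agree-one b refl | to (≡-alike ac) refl = one₂
triangle-transfer a b c ab bc ac one₃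
  rewrite agree-one c refl | to (≡-alike ab) refl = one₃
triangle-transfer a b c ab bc ac (gen a≢ b≢ c≢ s) =
  gen (a≢ ∘ agree-one (agree-sym a)) (b≢ ∘ agree-one (agree-sym b))
      (c≢ ∘ agree-one (agree-sym c)) (separated s)
  where
  separated : _ → _
  separated (inj₁ s)        = inj₁ (separated-transfer a b ab s)
  separated (inj₂ (inj₁ s)) = inj₂ (inj₁ (separated-transfer b c bc s))
  separated (inj₂ (inj₂ s)) = inj₂ (inj₂ (separated-transfer a c ac s))

-- Copies of patterns of labels

module Bounded (B N : ℕ) where

  -- Clique number 0 is the infinite clique; the flag says whether it is
  -- admitted.
  data Good (ω : Bool) : Label → Set where
    one      : Good ω one
    finite   : ∀ {i k p} → i < B → p < N → 0 < k → Good ω (lab i k p)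
    infinite : ∀ {i p} → T ω → i < B → Good ω (lab i 0 p)

  good-weaken : ∀ {ω a} → Good ω a → Good true a
  good-weaken one            = one
  good-weaken (finite i p k) = finite i p k
  good-weaken (infinite _ i) = infinite _ i

  good-block : ∀ {ω i k p} → Good ω (lab i k p) → i < B
  good-block (finite i _ _)   = i
  good-block (infinite _ i)   = i

  good-fixed : ∀ {ω K a} → Fixed K a → Good true a → Good ω a
  good-fixed _ one = one
  good-fixed _ (finite i p k) = finite i p k
  good-fixed (inj₁ ()) (infinite _ _)
  good-fixed (inj₂ (() , _)) (infinite _ _)

  finite⇒fixed : ∀ {a K} → Good false a → clique-number a ≤ K → Fixed K a
  finite⇒fixed one            _   = inj₁ refl
  finite⇒fixed (finite _ _ k) k≤K = inj₂ (k , k≤K)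

  good-move : ∀ {ω i k p p′} → Good ω (lab i k p) → p′ < N → Good ω (lab i k p′)
  good-move (finite i _ k)   p = finite i p k
  good-move (infinite ω i)   p = infinite ω i

  -- In each pair the first label is the copy and the second the original. With ω false the copies
  -- are confined to labels of atoms; with ω true they may use the infinite cliques.
  record Pattern (ω : Bool) (K : ℕ) (ps : List (Label × Label)) : Set where
    field
      good  : ∀ {a b} → (a , b) ∈ₗ ps → Good ω a
      agree : ∀ {a b} → (a , b) ∈ₗ ps → Agree K a b
      like  : ∀ {p q} → p ∈ₗ ps → q ∈ₗ ps → Alike p q
  open Pattern

  pattern-cons : ∀ {ω K ps a b} → Pattern ω K ps → Good ω a → Agree K a b →
    (∀ {a′ b′} → (a′ , b′) ∈ₗ ps → Alike (a , b) (a′ , b′)) → Pattern ω K ((a , b) ∷ ps)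
  pattern-cons P g u l = record
    { good  = λ { (here refl) → g ; (there m) → good P m }
    ; agree = λ { (here refl) → u ; (there m) → agree P m }
    ; like  = λ { (here refl) (here refl) → alike-refl
                ; (here refl) (there m)   → l m
                ; (there m)   (here refl) → alike-sym (l m)
                ; (there m)   (there m′)  → like P m m′ }
    }

  -- The counterpart a of b is a known one if b or its clique is known,
  -- otherwise it lies in a fresh clique.
  extend₁ : ∀ {ω K ps} → Pattern ω K ps → List.length ps < N → ∀ b → Good true b →
    ∃[ a ] Pattern ω K ((a , b) ∷ ps)
  extend₁ {ω} {K} {ps} P len b gb with fixed? K b
  ... | yes f = b , pattern-cons P (good-fixed f gb) (fixed f) alike-fixed
    where
    alike-fixed : ∀ {a′ b′} → (a′ , b′) ∈ₗ ps → Alike (b , b) (a′ , b′)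
    alike-fixed m with agree P m
    ... | fixed _     = alike ⇔-refl ⇔-refl
    ... | moved g h _ =
      alike (mk⇔ (λ { refl → contradiction f g }) (λ { refl → contradiction f h }))
            (mk⇔ (λ e → contradiction (fixed-resp e f) g)
                 (λ e → contradiction (fixed-resp e f) h))
  ... | no ¬f with Any.any? (λ p → proj₂ p ≟ₗ b) ps
  ...   | yes b∈ with find b∈
  ...     | (a , .b) , m , refl = a , pattern-cons P (good P m) (agree P m) (like P m)
  extend₁ {ω} {K} {ps} P len one gb | no ¬f | no b∉ = contradiction (inj₁ refl) ¬f
  extend₁ {ω} {K} {ps} P len b@(lab i k p) gb | no ¬f | no b∉
    with Any.any? (λ q → Maybe.≡-dec (Product.≡-dec ℕ._≟_ ℕ._≟_) (clique (proj₂ q)) (clique b)) ps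
  ... | no c∉ = lab i (suc (K ⊔ M)) 0 ,
      pattern-cons P (finite (good-block gb) (ℕ.≤-<-trans z≤n len) (s≤s z≤n))
        (moved ¬fixed ¬f refl)
        λ m → alike (mk⇔ (λ e → contradiction (cong clique e) (new m))
                         (λ e → contradiction (cong clique e) (c≢ m)))
                    (mk⇔ (λ e → contradiction e (new m)) (λ e → contradiction e (c≢ m)))
    where
    bound = upper-bound-list (List.map (clique-number ∘ proj₁) ps)
    M = proj₁ bound
    ¬fixed : ¬ Fixed K (lab i (suc (K ⊔ M)) 0)
    ¬fixed (inj₂ (_ , ≤K)) = ℕ.<⇒≱ (s≤s (ℕ.m≤m⊔n K M)) ≤K
    new : ∀ {a′ b′} → (a′ , b′) ∈ₗ ps → clique (lab i (suc (K ⊔ M)) 0) ≢ clique a′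
    new {lab _ k′ _} m refl =
      ℕ.<⇒≱ (s≤s (ℕ.m≤n⊔m K M)) (proj₂ bound (∈-map⁺ (clique-number ∘ proj₁) m))
    c≢ : ∀ {a′ b′} → (a′ , b′) ∈ₗ ps → clique b ≢ clique b′
    c≢ m e = c∉ (Any.map (λ { refl → sym e }) m)
  ... | yes c∈ with find c∈
  ...   | (one , b′) , m , e =
          contradiction (inj₁ (clique⇒one {b′} e (agree-one (agree P m) refl))) ¬f
  ...   | (a′@(lab i′ k′ p′) , b′) , m , e = lab i′ k′ q ,
          pattern-cons P (good-move (good P m) (ℕ.≤-trans (s≤s q≤) len))
            (moved (¬f′ ∘ fixed-resp refl) ¬f (trans (agree-block (agree P m)) (clique⇒block {b′} {b} e)))
            λ m″ → alike (mk⇔ (λ e″ → contradiction e″ (new m″))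
                              (λ e″ → contradiction e″ (b≢ m″)))
                         (⇔-trans (clique-alike (like P m m″))
                                  (mk⇔ (trans (sym e)) (trans e)))
    where
    -- Fewer than `N` pairs are listed, so a position below `N` is free in the clique.
    freshly = fresh-list (List.map (position ∘ proj₁) ps)
    q = proj₁ freshly
    q≤ : q ≤ List.length ps
    q≤ = subst (q ≤_) (length-map _ ps) (proj₁ (proj₂ freshly))
    ¬f′ : ¬ Fixed K a′
    ¬f′ f with agree P m
    ... | fixed f′    = ¬f (fixed-resp e f′)
    ... | moved g _ _ = g f
    new : ∀ {a″ b″} → (a″ , b″) ∈ₗ ps → lab i′ k′ q ≢ a″
    new m″ refl = proj₂ (proj₂ freshly) (∈-map⁺ (position ∘ proj₁) m″)
    b≢ : ∀ {a″ b″} → (a″ , b″) ∈ₗ ps → b ≢ b″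
    b≢ m″ refl = b∉ (Any.map (λ { refl → refl }) m″)

  -- The resulting list retains all earlier pairs, so the new copies fit the old ones as well as
  -- each other.
  extend : ∀ {m ω K ps} → Pattern ω K ps → List.length ps + m ≤ N →
    (b : Fin m → Label) → (∀ w → Good true (b w)) →
    Σ[ a ∈ (Fin m → Label) ] ∃[ qs ] (Pattern ω K qs ×
      (∀ {p} → p ∈ₗ ps → p ∈ₗ qs) × (∀ w → (a w , b w) ∈ₗ qs))
  extend {zero}  {ps = ps} P len b gb = (λ ()) , ps , P , id , λ ()
  extend {suc m} {ps = ps} P len b gb
    with len′ ← subst (_≤ N) (ℕ.+-suc (List.length ps) m) len
    with a₀ , P₀ ← extend₁ P (ℕ.≤-trans (s≤s (ℕ.m≤m+n _ m)) len′) (b zero) (gb zero)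
    with a , qs , Q , ⊆ , m ← extend P₀ len′ (b ∘ suc) (gb ∘ suc)
    = (λ { zero → a₀ ; (suc w) → a w }) , qs , Q , ⊆ ∘ there ,
      λ { zero → ⊆ (here refl) ; (suc w) → m w }

-- The universal labelled graph

record Enumeration (A : Set) : Set where
  field
    enum      : ℕ → A
    code      : A → ℕ
    enum-code : ∀ x → enum (code x) ≡ x
open Enumeration

ℕ-enumeration : Enumeration ℕ
ℕ-enumeration = record { enum = id ; code = id ; enum-code = λ _ → refl }

-- Cantor's walk along the diagonals.
next : ℕ × ℕ → ℕ × ℕ
next (zero  , y) = suc y , zero
next (suc x , y) = x , suc y

unpair : ℕ → ℕ × ℕ
unpair zero    = zero , zero
unpair (suc n) = next (unpair n)

-- The walk reaches no diagonal x + y before step x + y. This is what pushes codes beyond a given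
-- bound in `task-node`.
unpair-bound : ∀ n → proj₁ (unpair n) + proj₂ (unpair n) ≤ n
unpair-bound zero = z≤n
unpair-bound (suc n) with unpair n | unpair-bound n
... | zero  , y | y≤n = s≤s (subst (_≤ n) (sym (ℕ.+-identityʳ y)) y≤n)
... | suc x , y | ≤n  = ℕ.m≤n⇒m≤1+n (subst (_≤ n) (sym (ℕ.+-suc x y)) ≤n)

-- Induction on the diagonal: the walk enters it at (s , 0), descends to (0 , s), and the next step
-- enters the following diagonal.
unpair-surjective : ∀ x y → ∃[ n ] unpair n ≡ (x , y)
unpair-surjective x y = along x y (start (x + y))
  where
  along : ∀ x y → ∃[ n ] unpair n ≡ (x + y , 0) → ∃[ n ] unpair n ≡ (x , y)
  along x zero    (n , e) = n , trans e (cong (_, 0) (ℕ.+-identityʳ x))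
  along x (suc y) (n , e)
    with m , e′ ← along (suc x) y (n , trans e (cong (_, 0) (ℕ.+-suc x y))) =
    suc m , cong next e′
  start : ∀ s → ∃[ n ] unpair n ≡ (s , 0)
  start zero    = 0 , refl
  start (suc s) with n , e ← along 0 s (start s) = suc n , cong next e

×-enumeration : ∀ {A C} → Enumeration A → Enumeration C → Enumeration (A × C)
×-enumeration a c = record
  { enum      = λ n → enum a (proj₁ (unpair n)) , enum c (proj₂ (unpair n))
  ; code      = λ (x , y) → proj₁ (unpair-surjective (code a x) (code c y))
  ; enum-code = λ (x , y) → let e = proj₂ (unpair-surjective (code a x) (code c y)) in
      cong₂ _,_ (trans (cong (enum a ∘ proj₁) e) (enum-code a x))
                (trans (cong (enum c ∘ proj₂) e) (enum-code c y))
  }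

List-enumeration : ∀ {A} → Enumeration A → Enumeration (List A)
List-enumeration {A} a = record
  { enum      = λ n → decode (proj₁ (unpair n)) (proj₂ (unpair n))
  ; code      = λ xs → proj₁ (unpair-surjective (List.length xs) (encode xs))
  ; enum-code = λ xs → trans
      (cong (λ (l , n) → decode l n) (proj₂ (unpair-surjective (List.length xs) (encode xs))))
      (decode-encode xs)
  }
  where
  decode : ℕ → ℕ → List A
  decode zero    n = []
  decode (suc l) n = enum a (proj₁ (unpair n)) ∷ decode l (proj₂ (unpair n))
  encode : List A → ℕ
  encode []       = 0
  encode (x ∷ xs) = proj₁ (unpair-surjective (code a x) (encode xs))
  decode-encode : ∀ xs → decode (List.length xs) (encode xs) ≡ xs
  decode-encode []       = refl
  decode-encode (x ∷ xs) with n , e ← unpair-surjective (code a x) (encode xs)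
    rewrite e | enum-code a x | decode-encode xs = refl

Label-enumeration : Enumeration Label
Label-enumeration = record
  { enum      = λ n → label (enum codes n)
  ; code      = λ { one → code codes (0 , 0 , 0 , 0) ; (lab i k p) → code codes (1 , i , k , p) }
  ; enum-code = λ { one → cong label (enum-code codes (0 , 0 , 0 , 0)) ; (lab i k p) → cong label (enum-code codes (1 , i , k , p)) }
  }
  where
  codes = ×-enumeration ℕ-enumeration (×-enumeration ℕ-enumeration (×-enumeration ℕ-enumeration ℕ-enumeration))
  label : ℕ × ℕ × ℕ × ℕ → Label
  label (zero  , _)         = one
  label (suc _ , i , k , p) = lab i k p

-- A node z is a code of a block and of a list of labelled older nodes. The
-- nodes w < z not listed are joined to z by the label of the infinite clique
-- of that block at position z + w. Two of these labels at z are separated, and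
-- they are separated from the listed ones, since the listed labels avoid the
-- block. The sum makes the position symmetric in z and w and injective in w.
tasks : Enumeration (ℕ × (ℕ × List (ℕ × Label)))
tasks = ×-enumeration ℕ-enumeration
  (×-enumeration ℕ-enumeration (List-enumeration (×-enumeration ℕ-enumeration Label-enumeration)))

spare : ℕ → ℕ
spare z = proj₁ (proj₂ (enum tasks z))

links : ℕ → List (ℕ × Label)
links z = proj₂ (proj₂ (enum tasks z))

-- The first component of a task is padding: a code is at least as large as what it codes there, so
-- every block and list recur at arbitrarily late numbers.
task-node : ∀ K i ls → ∃[ z ] (K ≤ z × spare z ≡ i × links z ≡ ls)
task-node K i ls = code tasks t ,
  subst (_≤ code tasks t) (cong proj₁ (enum-code tasks t))
    (ℕ.≤-trans (ℕ.m≤m+n _ _) (unpair-bound (code tasks t))) ,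
  cong (proj₁ ∘ proj₂) (enum-code tasks t) , cong (proj₂ ∘ proj₂) (enum-code tasks t)
  where t = K , i , ls

find-link : ∀ (ls : List (ℕ × Label)) w →
            (∃[ a ] (w , a) ∈ₗ ls) ⊎ (∀ a → (w , a) ∉ₗ ls)
find-link []             w = inj₂ λ _ ()
find-link ((v , a) ∷ ls) w with v ℕ.≟ w | find-link ls w
... | yes refl | _            = inj₁ (a , here refl)
... | no _     | inj₁ (b , m) = inj₁ (b , there m)
... | no v≢w   | inj₂ none    = inj₂ λ { _ (here refl) → v≢w refl ; b (there m) → none b m }

down : ℕ → ℕ → Label
down z w with find-link (links z) w
... | inj₁ (a , _) = a
... | inj₂ _       = lab (spare z) 0 (z + w)

opaque
  -- The later endpoint decides the label, which makes the labelling symmetric. Opacity confines the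
  -- case split on the comparison to this block.
  edge : ℕ → ℕ → Label
  edge x y with ℕ.<-cmp x y
  ... | tri< _ _ _ = down y x
  ... | tri≈ _ _ _ = one
  ... | tri> _ _ _ = down x y

  edge-refl : ∀ x → edge x x ≡ one
  edge-refl x with ℕ.<-cmp x x
  ... | tri< x<x _ _ = contradiction x<x (ℕ.<-irrefl refl)
  ... | tri≈ _ _ _   = refl
  ... | tri> _ _ x<x = contradiction x<x (ℕ.<-irrefl refl)

  edge-down : ∀ {z w} → w < z → edge z w ≡ down z w
  edge-down {z} {w} w<z with ℕ.<-cmp z w
  ... | tri< z<w _ _  = contradiction z<w (ℕ.<-asym w<z)
  ... | tri≈ _ refl _ = contradiction w<z (ℕ.<-irrefl refl)
  ... | tri> _ _ _    = refl

  edge-sym : ∀ x y → edge x y ≡ edge y x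
  edge-sym x y with ℕ.<-cmp x y
  ... | tri< x<y _ _  = sym (edge-down x<y)
  ... | tri≈ _ refl _ = sym (edge-refl x)
  ... | tri> x≮y x≢y y<x with ℕ.<-cmp y x
  ...   | tri< _ _ _      = refl
  ...   | tri≈ y≮x _ _    = contradiction y<x y≮x
  ...   | tri> y≮x _ _    = contradiction y<x y≮x

  edge-cases : ∀ x y → (x < y × edge x y ≡ down y x) ⊎ (x ≡ y × edge x y ≡ one) ⊎ (y < x × edge x y ≡ down x y)
  edge-cases x y with ℕ.<-cmp x y
  ... | tri< x<y _ _ = inj₁ (x<y , refl)
  ... | tri≈ _ e _   = inj₂ (inj₁ (e , refl))
  ... | tri> _ _ y<x = inj₂ (inj₂ (y<x , refl))

-- The graph on the valid codes

module Model (em : ∀ {ℓ} → ExcludedMiddle ℓ) (B N : ℕ) where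
  open Bounded B N

  -- Codes that describe no consistent extension are discarded. For w = v the condition
  -- `link-triangle` has a side `one`, so a number listed repeatedly carries one label.
  record Valid (z : ℕ) : Set where
    field
      spare-bound : spare z < B
      link-good   : ∀ {w a} → (w , a) ∈ₗ links z → Good true a × a ≢ one × block a ≢ spare z
      link-triangle : ∀ {w a v b} → (w , a) ∈ₗ links z → (v , b) ∈ₗ links z →
                      Triangle a b (edge w v)
  open Valid

  -- Validity is stored as the truth of a Boolean, which has at most one proof; a node is thus
  -- determined by its number.
  Node : Set
  Node = Σ[ z ∈ ℕ ] True (em {P = Valid z})

  valid : (x : Node) → Valid (proj₁ x)
  valid x = toWitness (proj₂ x)

  node-≡ : ∀ {x y : Node} → proj₁ x ≡ proj₁ y → x ≡ y
  node-≡ {x , t} {_ , t′} refl = cong (x ,_) (T-irrelevant t t′)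

  label : Node → Node → Label
  label x y = edge (proj₁ x) (proj₁ y)

  label-refl : ∀ x → label x x ≡ one
  label-refl x = edge-refl (proj₁ x)

  label-sym : ∀ x y → label x y ≡ label y x
  label-sym x y = edge-sym (proj₁ x) (proj₁ y)

  down-proper : ∀ {z w} → Valid z → Good true (down z w) × down z w ≢ one
  down-proper {z} {w} v with find-link (links z) w
  ... | inj₁ (_ , m) = proj₁ (link-good v m) , proj₁ (proj₂ (link-good v m))
  ... | inj₂ _       = infinite _ (spare-bound v) , λ ()

  edge-proper : ∀ (x y : Node) → Good true (label x y) × (label x y ≡ one → x ≡ y)
  edge-proper x y with edge-cases (proj₁ x) (proj₁ y)
  ... | inj₁ (_ , e)        = subst (Good true) (sym e) (proj₁ (down-proper (valid y))) ,
                              λ e′ → contradiction (trans (sym e) e′) (proj₂ (down-proper (valid y)))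
  ... | inj₂ (inj₁ (x≡y , e)) = subst (Good true) (sym e) one , λ _ → node-≡ x≡y
  ... | inj₂ (inj₂ (_ , e)) = subst (Good true) (sym e) (proj₁ (down-proper (valid x))) ,
                              λ e′ → contradiction (trans (sym e) e′) (proj₂ (down-proper (valid x)))

  label-good : ∀ x y → Good true (label x y)
  label-good x y = proj₁ (edge-proper x y)

  label-one : ∀ x y → label x y ≡ one → x ≡ y
  label-one x y = proj₂ (edge-proper x y)

  down-triangle : ∀ {z w v} → Valid z → w ≢ v → edge w v ≢ one →
                  Triangle (down z w) (down z v) (edge w v)
  down-triangle {z} {w} {v} valid-z w≢v e≢
    with find-link (links z) w | find-link (links z) v
  ... | inj₁ (_ , m) | inj₁ (_ , m′) = link-triangle valid-z m m′
  ... | inj₁ (_ , m) | inj₂ _ =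
        gen (proj₁ (proj₂ (link-good valid-z m))) (λ ()) e≢ (inj₁ (inj₁ (proj₂ (proj₂ (link-good valid-z m)))))
  ... | inj₂ _ | inj₁ (_ , m) =
        gen (λ ()) (proj₁ (proj₂ (link-good valid-z m))) e≢ (inj₁ (inj₁ (proj₂ (proj₂ (link-good valid-z m)) ∘ sym)))
  ... | inj₂ _ | inj₂ _ =
        gen (λ ()) (λ ()) e≢ (inj₁ (inj₂ (refl , λ e → w≢v (ℕ.+-cancelˡ-≡ z w v (proj₂ (proj₂ (lab-injective e)))))))

  -- Among three distinct nodes the latest decides two of the sides, and `down-triangle` applies
  -- there. A coincidence gives a degenerate triangle.
  label-triangle : ∀ x y z → Triangle (label x y) (label y z) (label x z)
  label-triangle x y z = by-cases (ℕ.<-cmp (proj₁ x) (proj₁ y)) (ℕ.<-cmp (proj₁ y) (proj₁ z)) (ℕ.<-cmp (proj₁ x) (proj₁ z))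
    where
    top : ∀ x y z → proj₁ y < proj₁ x → proj₁ z < proj₁ x → proj₁ y ≢ proj₁ z →
          Triangle (label x y) (label x z) (label y z)
    top x y z y<x z<x y≢z = subst₂ (λ a b → Triangle a b (label y z))
      (sym (edge-down y<x)) (sym (edge-down z<x))
      (down-triangle (valid x) y≢z (λ e → y≢z (cong proj₁ (label-one y z e))))
    x-top : proj₁ y < proj₁ x → proj₁ z < proj₁ x → proj₁ y ≢ proj₁ z → Triangle (label x y) (label y z) (label x z)
    x-top y<x z<x y≢z = flip-triangle (top x y z y<x z<x y≢z)
    y-top : proj₁ x < proj₁ y → proj₁ z < proj₁ y → proj₁ x ≢ proj₁ z → Triangle (label x y) (label y z) (label x z)
    y-top x<y z<y x≢z rewrite label-sym x y = top y x z x<y z<y x≢z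
    z-top : proj₁ x < proj₁ z → proj₁ y < proj₁ z → proj₁ x ≢ proj₁ y → Triangle (label x y) (label y z) (label x z)
    z-top x<z y<z x≢y rewrite label-sym x z | label-sym y z =
      swap-triangle (rotate-triangle (top z x y x<z y<z x≢y))
    by-cases : Tri _ _ _ → Tri _ _ _ → Tri _ _ _ → Triangle (label x y) (label y z) (label x z)
    by-cases (tri≈ _ e _) _ _ rewrite node-≡ {x} {y} e | label-refl y = one₁
    by-cases _ (tri≈ _ e _) _ rewrite node-≡ {y} {z} e | label-refl z = one₂
    by-cases _ _ (tri≈ _ e _) rewrite node-≡ {x} {z} e | label-refl z | label-sym z y = one₃
    by-cases (tri< x<y x≢y _) (tri< y<z y≢z _) (tri< x<z x≢z _) = z-top x<z y<z x≢y
    by-cases (tri< x<y x≢y _) (tri< y<z y≢z _) (tri> _ x≢z z<x) = contradiction (ℕ.<-trans (ℕ.<-trans x<y y<z) z<x) (ℕ.<-irrefl refl)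
    by-cases (tri< x<y x≢y _) (tri> _ y≢z z<y) (tri< x<z x≢z _) = y-top x<y z<y x≢z
    by-cases (tri< x<y x≢y _) (tri> _ y≢z z<y) (tri> _ x≢z z<x) = y-top x<y z<y x≢z
    by-cases (tri> _ x≢y y<x) (tri< y<z y≢z _) (tri< x<z x≢z _) = z-top x<z y<z x≢y
    by-cases (tri> _ x≢y y<x) (tri< y<z y≢z _) (tri> _ x≢z z<x) = x-top y<x z<x y≢z
    by-cases (tri> _ x≢y y<x) (tri> _ y≢z z<y) (tri< x<z x≢z _) = contradiction (ℕ.<-trans (ℕ.<-trans x<z z<y) y<x) (ℕ.<-irrefl refl)
    by-cases (tri> _ x≢y y<x) (tri> _ y≢z z<y) (tri> _ x≢z z<x) = x-top y<x z<x y≢z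

  attach : ∀ {m} (s : Fin m → Node) (a : Fin m → Label) →
    (∀ w → Good true (a w)) → (∀ w → a w ≢ one) →
    (∀ w v → Triangle (a w) (a v) (label (s w) (s v))) →
    ∀ z → spare z < B → (∀ w → block (a w) ≢ spare z) → (∀ w → proj₁ (s w) < z) →
    links z ≡ List.tabulate (λ w → proj₁ (s w) , a w) →
    Σ[ x ∈ Node ] ∀ w → label x (s w) ≡ a w
  attach s a good proper tri z spare<B avoid s<z links-z =
    (z , fromWitness z-valid) , λ w → trans (edge-down (s<z w)) (down-z w)
    where
    listed : ∀ {x b} → (x , b) ∈ₗ links z → ∃[ w ] (x , b) ≡ (proj₁ (s w) , a w)
    listed {x} {b} x∈ = ∈-tabulate⁻ (subst ((x , b) ∈ₗ_) links-z x∈)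
    link-good′ : ∀ {x b} → ∃[ w ] (x , b) ≡ (proj₁ (s w) , a w) →
                 Good true b × b ≢ one × block b ≢ spare z
    link-good′ (w , refl) = good w , proper w , avoid w
    link-triangle′ : ∀ {x b y c} → ∃[ w ] (x , b) ≡ (proj₁ (s w) , a w) →
      ∃[ v ] (y , c) ≡ (proj₁ (s v) , a v) → Triangle b c (edge x y)
    link-triangle′ (w , refl) (v , refl) = tri w v
    z-valid : Valid z
    z-valid = record
      { spare-bound   = spare<B
      ; link-good     = λ x∈ → link-good′ (listed x∈)
      ; link-triangle = λ x∈ y∈ → link-triangle′ (listed x∈) (listed y∈)
      }
    -- Several w may name the same node. The triangle over its loop makes the labels equal, so any
    -- listing found by the search is the right one.
    same : ∀ {w b} → ∃[ v ] (proj₁ (s w) , b) ≡ (proj₁ (s v) , a v) → b ≡ a w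
    same {w} (v , e) with refl ← cong proj₂ e =
      sym (triangle-one₃ (subst (Triangle (a w) (a v))
        (trans (cong (edge (proj₁ (s w))) (sym (cong proj₁ e))) (edge-refl (proj₁ (s w)))) (tri w v)))
    down-z : ∀ w → down z (proj₁ (s w)) ≡ a w
    down-z w with find-link (links z) (proj₁ (s w))
    ... | inj₁ (b , m) = same (listed m)
    ... | inj₂ none    = contradiction (subst (_ ∈ₗ_) (sym links-z) (∈-tabulate⁺ w)) (none (a w))

  -- A prescribed identity points to an old node, which is then the answer. Otherwise the m labels
  -- leave one of the first m + 1 blocks free, and that block becomes the spare one.
  realise : ∀ {m} → m < B → (s : Fin m → Node) (a : Fin m → Label) →
    (∀ w → Good true (a w)) → (∀ w v → Triangle (a w) (a v) (label (s w) (s v))) →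
    Σ[ z ∈ Node ] ∀ w → label z (s w) ≡ a w
  realise {m} m<B s a good tri with Fin.any? (λ w → a w ≟ₗ one)
  ... | yes (w , a≡one) = s w , λ v →
        sym (triangle-one₁ (subst (λ b → Triangle b (a v) (label (s w) (s v))) a≡one (tri w v)))
  ... | no proper
    with i , i≤m , avoid ← fresh (block ∘ a) | K , ≤K ← upper-bound (proj₁ ∘ s)
    with z , K<z , refl , links-z ← task-node (suc K) i (List.tabulate (λ w → proj₁ (s w) , a w)) =
      attach s a good (λ w e → proper (w , e)) tri z (ℕ.≤-<-trans i≤m m<B) avoid
        (λ w → ℕ.≤-trans (s≤s (≤K w)) K<z) links-z

-- Representing a term algebra by a graded simulation

-- The relation x ~[ K ] a refines as K grows. An element of Tm S lies in the
-- finite level of some K, where it is a union of ~[ K ]-classes, and is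
-- represented by the points related to its members.
module Shadow {Ω} (S : AtomStructure Ω 0ℓ 0ℓ) {X : Set}
  (_~[_]_ : X → ℕ → AtomStructure.Atom S → Set)
  (coarsen : ∀ {K L x a} → K ≤ L → x ~[ L ] a → x ~[ K ] a)
  (shadow : ∀ K x → ∃[ a ] x ~[ K ] a) where

  private
    module S = AtomStructure S
    module C = Algebra (Cm S)
    module T = Algebra (Tm S)

  record Invariant (K : ℕ) (Y : Pred S.Atom 0ℓ) : Set where
    constructor invariant
    field
      move : ∀ {x a b} → x ~[ K ] a → x ~[ K ] b → a ∈ Y → b ∈ Y
  open Invariant

  invariant-mono : ∀ {K L Y} → K ≤ L → Invariant K Y → Invariant L Y
  invariant-mono K≤L inv = invariant λ x~a x~b → move inv (coarsen K≤L x~a) (coarsen K≤L x~b)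

  invariant-resp : ∀ {K Y Z} → Y ≐ Z → Invariant K Y → Invariant K Z
  invariant-resp (Y⊆Z , Z⊆Y) inv = invariant λ x~a x~b → Y⊆Z ∘ move inv x~a x~b ∘ Z⊆Y

  ∪-invariant : ∀ {K Y Z} → Invariant K Y → Invariant K Z → Invariant K (Y ∪ Z)
  ∪-invariant inv inv′ = invariant λ p q → Sum.map (move inv p q) (move inv′ p q)

  ∩-invariant : ∀ {K Y Z} → Invariant K Y → Invariant K Z → Invariant K (Y ∩ Z)
  ∩-invariant inv inv′ = invariant λ p q → Product.map (move inv p q) (move inv′ p q)

  ∁-invariant : ∀ {K Y} → Invariant K Y → Invariant K (Unary.∁ Y)
  ∁-invariant inv = invariant λ p q a∉ b∈ → a∉ (move inv q p b∈)

  -- Quantifying over the level inside makes `lift` independent of any choice of level. By `lift-⇔`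
  -- every level of invariance and every related atom give the same answer.
  lift : Pred S.Atom 0ℓ → Pred X 0ℓ
  lift Y x = ∃[ K ] (Invariant K Y × ∃[ a ] (x ~[ K ] a × a ∈ Y))

  lift-⇔ : ∀ {K Y x a} → Invariant K Y → x ~[ K ] a → (a ∈ Y) ⇔ (x ∈ lift Y)
  lift-⇔ {K} {Y} {x} {a} inv x~a = mk⇔ (λ a∈ → K , inv , a , x~a , a∈) back
    where
    back : x ∈ lift Y → a ∈ Y
    -- The two levels are compared through a shadow at their maximum, which is related to x at both.
    back (L , inv′ , b , x~b , b∈) with c , x~c ← shadow (K ⊔ L) x =
      move inv (coarsen (ℕ.m≤m⊔n K L) x~c) x~a
          (move inv′ x~b (coarsen (ℕ.m≤n⊔m K L) x~c) b∈)

  lift-cong : ∀ {Y Z} → Y ≐ Z → lift Y ≐ lift Z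
  lift-cong Y≐Z@(Y⊆Z , Z⊆Y) =
    (λ (K , inv , a , x~a , a∈) → K , invariant-resp Y≐Z inv , a , x~a , Y⊆Z a∈) ,
    (λ (K , inv , a , x~a , a∈) → K , invariant-resp (Z⊆Y , Y⊆Z) inv , a , x~a , Z⊆Y a∈)

  -- The three main hypotheses have separate tasks: `cast` yields injectivity, `isolate` places the
  -- singletons at finite levels, and `step` is the back-and-forth for the operations.
  module Simulation
    (cast : ∀ K a → ∃[ x ] x ~[ K ] a)
    (isolate : ∀ a → ∃[ K ] ∀ {x b c} → x ~[ K ] b → x ~[ K ] c → b S.≈ a → c S.≈ a)
    (opX : (o : Signature.Op Ω) → Vec (Pred X 0ℓ) (Signature.arity Ω o) → Pred X 0ℓ)
    (opX-cong : ∀ o {Ys Zs} → Pointwise _≐_ Ys Zs → opX o Ys ≐ opX o Zs)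
    (step : ∀ o {K} (Ys : Vec (Subset S) (Signature.arity Ω o)) →
            (∀ k → Invariant K (proj₁ (lookup Ys k))) → ∀ {x a} → x ~[ K ] a →
            (a ∈ proj₁ (Algebra.op (Cm S) o Ys)) ⇔ (x ∈ opX o (map (lift ∘ proj₁) Ys)))
    where

    -- By `step`, membership of either atom amounts to one and the same statement about the point
    -- they share. Operations therefore do not raise the level.
    op-invariant : ∀ o {K} (Ys : Vec (Subset S) (Signature.arity Ω o)) →
      (∀ k → Invariant K (proj₁ (lookup Ys k))) → Invariant K (proj₁ (C.op o Ys))
    op-invariant o Ys inv = invariant λ x~a x~b → from (step o Ys inv x~b) ∘ to (step o Ys inv x~a)

    InTm : Pred (Subset S) _
    InTm = Generated (Cm S) (λ Y → ∃[ s ] Y C.≈ singleton S s)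

    level  : ∀ {Y} → InTm Y → ∃[ K ] Invariant K (proj₁ Y)
    levels : ∀ {k} {Ys : Vec (Subset S) k} →
             All InTm Ys →
             ∃[ K ] ∀ j → Invariant K (proj₁ (lookup Ys j))
    level (gen (s , Y⊆s , s⊆Y)) with K , iso ← isolate s =
      K , invariant λ x~a x~b a∈ → s⊆Y (iso x~a x~b (Y⊆s a∈))
    level (resp Y≈Z g) with K , inv ← level g = K , invariant-resp Y≈Z inv
    level (∨-gen g h) with K , inv ← level g | L , inv′ ← level h =
      K ⊔ L , ∪-invariant (invariant-mono (ℕ.m≤m⊔n K L) inv) (invariant-mono (ℕ.m≤n⊔m K L) inv′)
    level (∧-gen g h) with K , inv ← level g | L , inv′ ← level h =
      K ⊔ L , ∩-invariant (invariant-mono (ℕ.m≤m⊔n K L) inv) (invariant-mono (ℕ.m≤n⊔m K L) inv′)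
    level (∁-gen g) with K , inv ← level g = K , ∁-invariant inv
    level 𝟙-gen = 0 , invariant λ _ _ t → t
    level 𝟘-gen = 0 , invariant λ _ _ ()
    level (op-gen o {Ys} gs) with K , inv ← levels gs = K , op-invariant o Ys inv
    levels [] = 0 , λ ()
    levels (g ∷ gs) with K , inv ← level g | L , invs ← levels gs = K ⊔ L , λ where
      zero    → invariant-mono (ℕ.m≤m⊔n K L) inv
      (suc j) → invariant-mono (ℕ.m≤n⊔m K L) (invs j)

    pointwise : ∀ {Y Z : Pred X 0ℓ} → (∀ x → (x ∈ Y) ⇔ (x ∈ Z)) → Y ≐ Z
    pointwise e = (λ {x} → to (e x)) , (λ {x} → from (e x))

    ∪-lift : ∀ {K} {Y Z : Pred S.Atom 0ℓ} → Invariant K Y → Invariant K Z → lift (Y ∪ Z) ≐ lift Y ∪ lift Z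
    ∪-lift {K} inv inv′ = pointwise λ x → let a , x~a = shadow K x in
      ⇔-trans (⇔-sym (lift-⇔ (∪-invariant inv inv′) x~a))
              (lift-⇔ inv x~a ⊎-⇔ lift-⇔ inv′ x~a)

    ∩-lift : ∀ {K} {Y Z : Pred S.Atom 0ℓ} → Invariant K Y → Invariant K Z → lift (Y ∩ Z) ≐ lift Y ∩ lift Z
    ∩-lift {K} inv inv′ = pointwise λ x → let a , x~a = shadow K x in
      ⇔-trans (⇔-sym (lift-⇔ (∩-invariant inv inv′) x~a))
              (lift-⇔ inv x~a ×-⇔ lift-⇔ inv′ x~a)

    ∁-lift : ∀ {K} {Y : Pred S.Atom 0ℓ} → Invariant K Y → lift (Unary.∁ Y) ≐ Unary.∁ (lift Y)
    ∁-lift {K} inv = pointwise λ x → let a , x~a = shadow K x in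
      ⇔-trans (⇔-sym (lift-⇔ (∁-invariant inv) x~a))
              (mk⇔ (_∘ from (lift-⇔ inv x~a)) (_∘ to (lift-⇔ inv x~a)))

    common : ∀ (Y Z : T.Carrier) →
      ∃[ K ] (Invariant K (proj₁ (proj₁ Y)) × Invariant K (proj₁ (proj₁ Z)))
    common Y Z with K , inv ← level (proj₂ Y) | L , inv′ ← level (proj₂ Z) =
      K ⊔ L , invariant-mono (ℕ.m≤m⊔n K L) inv , invariant-mono (ℕ.m≤n⊔m K L) inv′

    embedding : Embedding (Tm S) (powersetAlgebra X opX opX-cong)
    embedding = record
      { to        = lift ∘ proj₁ ∘ proj₁
      ; cong      = lift-cong
      ; injective = λ {Y} {Z} (Y⊆Z , Z⊆Y) → reflect Y Z Y⊆Z , reflect Z Y Z⊆Y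
      ; ∨-homo    = λ Y Z → let K , inv , inv′ = common Y Z in ∪-lift inv inv′
      ; ∧-homo    = λ Y Z → let K , inv , inv′ = common Y Z in ∩-lift inv inv′
      ; ∁-homo    = λ Y → ∁-lift (proj₂ (level (proj₂ Y)))
      ; 𝟙-homo    = _ , λ {x} _ → 0 , invariant (λ _ _ t → t) , proj₁ (shadow 0 x) , proj₂ (shadow 0 x) , _
      ; 𝟘-homo    = (λ { (_ , _ , _ , _ , ()) }) , λ ()
      ; op-homo   = λ o Ys → let K , inv = levels (members Ys) in
          pointwise λ x → let a , x~a = shadow K x in
            ⇔-trans (⇔-sym (lift-⇔ (op-invariant o (map proj₁ Ys) inv) x~a))
              (subst (λ Zs → (a ∈ proj₁ (C.op o (map proj₁ Ys))) ⇔ (x ∈ opX o Zs))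
                (≡.sym (Vec.map-∘ (lift ∘ proj₁) proj₁ Ys)) (step o (map proj₁ Ys) inv x~a))
      }
      where
      members : ∀ {k} (Ys : Vec T.Carrier k) → All InTm (map proj₁ Ys)
      members []       = []
      members (Y ∷ Ys) = proj₂ Y ∷ members Ys
      reflect : ∀ (Y Z : T.Carrier) → lift (proj₁ (proj₁ Y)) ⊆ lift (proj₁ (proj₁ Z)) →
                proj₁ (proj₁ Y) ⊆ proj₁ (proj₁ Z)
      reflect Y Z Y⊆Z {a} a∈ with K , inv , inv′ ← common Y Z with x , x~a ← cast K a =
        from (lift-⇔ inv′ x~a) (Y⊆Z (to (lift-⇔ inv x~a) a∈))

-- The relation algebra

module Relation (em : ∀ {ℓ} → ExcludedMiddle ℓ) (b N : ℕ) (2≤b : 2 ≤ b) (0<N : 0 < N) where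

  B : ℕ
  B = suc b

  data Colour : Set where
    𝟏   : Colour
    col : Fin B → Fin N → ℕ → Colour

  -- The shift of k by one keeps clique number 0, the infinite clique, out of the algebra.
  ι : Colour → Label
  ι 𝟏           = one
  ι (col i p k) = lab (toℕ i) (suc k) (toℕ p)

  open Bounded B N

  ι-injective : ∀ {c d} → ι c ≡ ι d → c ≡ d
  ι-injective {𝟏}         {𝟏}            _ = refl
  ι-injective {col i p k} {col i′ p′ k′} e
    with i≡ , k≡ , p≡ ← lab-injective e
    with refl ← Fin.toℕ-injective i≡ | refl ← Fin.toℕ-injective p≡ | refl ← ℕ.suc-injective k≡ = refl

  ι-good : ∀ c → Good false (ι c)
  ι-good 𝟏           = one
  ι-good (col i p k) = finite (Fin.toℕ<n i) (Fin.toℕ<n p) (s≤s z≤n)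

  ι-surjective : ∀ {a} → Good false a → ∃[ c ] ι c ≡ a
  ι-surjective one = 𝟏 , refl
  ι-surjective (finite {k = suc k} i<B p<N _) = col (fromℕ< i<B) (fromℕ< p<N) k ,
    cong₂ (λ i p → lab i (suc k) p) (Fin.toℕ-fromℕ< i<B) (Fin.toℕ-fromℕ< p<N)

  colours : AtomStructure Relational 0ℓ 0ℓ
  colours = record
    { Atom = Colour ; _≈_ = _≡_ ; isEquivalence = ≡.isEquivalence
    ; R = related
    ; R-resp = λ where
        identity    refl []              r → r
        converse    refl (refl ∷ [])        r → r
        composition refl (refl ∷ refl ∷ []) r → r
    }
    where
    related : (o : RelationOp) → Colour → Vec Colour (Signature.arity Relational o) → Set
    related identity    c []           = c ≡ 𝟏
    related converse    c (d ∷ [])     = c ≡ d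
    related composition c (d ∷ e ∷ []) = Triangle (ι d) (ι e) (ι c)

  -- In an amalgam of two triangles with a common side, a colour outside two
  -- given blocks completes any proper diagonal.
  diagonal-colour : ∀ {a b c d e} → Triangle (ι a) (ι b) (ι e) → Triangle (ι e) (ι c) (ι d) →
    ∃[ f ] (Triangle (ι b) (ι c) (ι f) × Triangle (ι a) (ι f) (ι d))
  diagonal-colour {𝟏} {b} {c} {d} s t with refl ← ι-injective {b} (triangle-one₁ s) = d , t , one₁
  diagonal-colour {a} {𝟏} {c} s t with refl ← ι-injective {a} (triangle-one₂ s) = c , one₁ , t
  diagonal-colour {a} {b} {𝟏} {d} {e} s t with refl ← ι-injective {e} {d} (triangle-one₂ t) = b , one₂ , s
  diagonal-colour {a} {b} {c} {𝟏} {e} s t with refl ← ι-injective {e} {c} (triangle-one₃ t) =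
    a , rotate-triangle s , one₃
  diagonal-colour {col i _ _} {col j _ _} {col _ _ _} {col _ _ _} s t
    with q , q≤2 , q∉ ← fresh {2} (λ { zero → toℕ i ; (suc zero) → toℕ j })
    with f , refl′ ← ι-surjective (finite {ω = false} {q} {1} {0} (s≤s (ℕ.≤-trans q≤2 2≤b)) 0<N (s≤s z≤n)) =
    f , subst (λ g → Triangle _ _ g) (sym refl′) (gen (λ ()) (λ ()) (λ ()) (inj₂ (inj₂ (inj₁ (q∉ (suc zero)))))) ,
    subst (λ g → Triangle _ g _) (sym refl′) (gen (λ ()) (λ ()) (λ ()) (inj₁ (inj₁ (q∉ zero))))

  private
    module C = Algebra (Cm colours)
  open RelationOps (Cm colours)

  compose : ∀ {X Y : Subset colours} {c d e} → c ∈ proj₁ X → d ∈ proj₁ Y → Triangle (ι c) (ι d) (ι e) →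
            e ∈ proj₁ (X ⨾ Y)
  compose c∈ d∈ t = (_ ∷ _ ∷ []) , (λ { zero → c∈ ; (suc zero) → d∈ }) , t

  convert : ∀ {X : Subset colours} {c} → c ∈ proj₁ X → c ∈ proj₁ (X ˘)
  convert c∈ = (_ ∷ []) , (λ { zero → c∈ }) , refl

  decompose : ∀ {X Y : Subset colours} {e} → e ∈ proj₁ (X ⨾ Y) →
              ∃[ c ] ∃[ d ] (c ∈ proj₁ X × d ∈ proj₁ Y × Triangle (ι c) (ι d) (ι e))
  decompose ((c ∷ d ∷ []) , h , t) = c , d , h zero , h (suc zero) , t

  unconvert : ∀ {X : Subset colours} {c} → c ∈ proj₁ (X ˘) → c ∈ proj₁ X
  unconvert ((_ ∷ []) , h , refl) = h zero

  Cm-isRelationAlgebra : IsRelationAlgebra (Cm colours)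
  Cm-isRelationAlgebra = record
    { isBooleanAlgebra = ComplexAlgebra.Cm-isBooleanAlgebra em colours
    ; ⨾-assoc = λ X Y Z →
        (λ d∈ → let _ , c , e∈ , c∈ , t = decompose {X ⨾ Y} {Z} d∈
                    a , b , a∈ , b∈ , s = decompose {X} {Y} e∈
                    f , u , v = diagonal-colour {a} {b} {c} s t
                in compose {X} {Y ⨾ Z} a∈ (compose {Y} {Z} b∈ c∈ u) v) ,
        (λ d∈ → let a , _ , a∈ , e∈ , t = decompose {X} {Y ⨾ Z} d∈
                    b , c , b∈ , c∈ , s = decompose {Y} {Z} e∈
                    -- The mirror image of the other inclusion, as triangles are symmetric in their
                    -- first two sides.
                    f , u , v = diagonal-colour {c} {b} {a} (swap-triangle s) (swap-triangle t)
                in compose {X ⨾ Y} {Z} (compose {X} {Y} a∈ b∈ (swap-triangle u)) c∈ (swap-triangle v))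
    ; ⨾-identityʳ = λ X →
        (λ d∈ → let _ , _ , a∈ , c∈ , t = decompose {X} {1′} d∈ in proj₂ X (right c∈ t) a∈) ,
        (λ c∈ → compose {X} {1′} {d = 𝟏} c∈ ([] , (λ ()) , refl) one₂)
    ; ⨾-∨ = λ X Y Z →
        (λ d∈ → let _ , _ , a∈ , c∈ , t = decompose {X C.∨ Y} {Z} d∈ in
           Sum.map (λ x∈ → compose {X} {Z} x∈ c∈ t) (λ y∈ → compose {Y} {Z} y∈ c∈ t) a∈) ,
        Sum.[
          (λ d∈ → let _ , _ , a∈ , c∈ , t = decompose {X} {Z} d∈ in compose {X C.∨ Y} {Z} (inj₁ a∈) c∈ t) ,
          (λ d∈ → let _ , _ , a∈ , c∈ , t = decompose {Y} {Z} d∈ in compose {X C.∨ Y} {Z} (inj₂ a∈) c∈ t) ]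
    ; ˘-invol = λ X →
        (λ c∈ → unconvert {X} (unconvert {X ˘} c∈)) , (λ c∈ → convert {X ˘} (convert {X} c∈))
    ; ˘-∨ = λ X Y →
        (λ c∈ → Sum.map (convert {X}) (convert {Y}) (unconvert {X C.∨ Y} c∈)) ,
        (λ c∈ → convert {X C.∨ Y} (Sum.map (unconvert {X}) (unconvert {Y}) c∈))
    ; ˘-⨾ = λ X Y →
        (λ c∈ → let _ , _ , a∈ , b∈ , t = decompose {X} {Y} (unconvert {X ⨾ Y} c∈) in
           compose {Y ˘} {X ˘} (convert {Y} b∈) (convert {X} a∈) (swap-triangle t)) ,
        (λ c∈ → let _ , _ , b∈ , a∈ , t = decompose {Y ˘} {X ˘} c∈ in
           convert {X ⨾ Y} (compose {X} {Y} (unconvert {X} a∈) (unconvert {Y} b∈) (swap-triangle t)))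
    ; tarski = λ X Y → proj₁ , λ d∈ → d∈ ,
        let _ , _ , a∈ , ∉ , t = decompose {X ˘} {C.∁ (X ⨾ Y)} d∈ in
        λ c∈ → ∉ (compose {X} {Y} (unconvert {X} a∈) c∈ (flip-triangle t))
    }
    where
    right : ∀ {a c d} → d ∈ proj₁ 1′ → Triangle (ι a) (ι d) (ι c) → a ≡ c
    right ([] , _ , refl) t = ι-injective (triangle-one₂ t)

  decided : ∀ {P : Set} (d : Dec P) → (does d ≡ true) ⇔ P
  decided (yes p) = mk⇔ (λ _ → p) (λ _ → refl)
  decided (no ¬p) = mk⇔ (λ ()) (λ p → contradiction p ¬p)

  ⟦_⟧ : (Colour → Bool) → Subset colours
  ⟦ x ⟧ = (λ c → x c ≡ true) , λ { refl h → h }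

  -- The complex algebra of colours, made small by deciding membership.
  𝑹 : Algebra Relational 0ℓ 0ℓ
  𝑹 = record
    { Carrier       = Colour → Bool
    ; _≈_           = λ x y → ∀ c → x c ≡ y c
    ; isEquivalence = record
      { refl  = λ _ → refl
      ; sym   = λ e c → sym (e c)
      ; trans = λ e f c → trans (e c) (f c)
      }
    ; _∨_           = λ x y c → x c Bool.∨ y c
    ; _∧_           = λ x y c → x c Bool.∧ y c
    ; ∁             = λ x c → Bool.not (x c)
    ; 𝟙             = λ _ → true
    ; 𝟘             = λ _ → false
    ; op            = λ o xs c → does (em {P = c ∈ proj₁ (C.op o (map ⟦_⟧ xs))})
    ; ∨-cong        = λ e f c → cong₂ Bool._∨_ (e c) (f c)
    ; ∧-cong        = λ e f c → cong₂ Bool._∧_ (e c) (f c)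
    ; ∁-cong        = λ e c → cong Bool.not (e c)
    ; op-cong       = λ o es c → let f , g = C.op-cong o (Pointwise.map⁺ ⟦⟧-cong es) in
                                 does-⇔ (mk⇔ f g) em em
    }
    where
    ⟦⟧-cong : ∀ {x y : Colour → Bool} → (∀ c → x c ≡ y c) → ⟦ x ⟧ C.≈ ⟦ y ⟧
    ⟦⟧-cong e = (λ {c} h → trans (sym (e c)) h) , (λ {c} h → trans (e c) h)

  𝑹-embedding : Embedding 𝑹 (Cm colours)
  𝑹-embedding = record
    { to        = ⟦_⟧
    ; cong      = λ e → (λ {c} h → trans (sym (e c)) h) , (λ {c} h → trans (e c) h)
    ; injective = λ (f , g) c → same f g
    ; ∨-homo    = λ x y → (λ {c} → ∨⇒⊎ (x c)) , (λ {c} → ⊎⇒∨ (x c))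
    ; ∧-homo    = λ x y → (λ {c} → ∧⇒× (x c)) , (λ {c} (h , g) → cong₂ Bool._∧_ h g)
    ; ∁-homo    = λ x → (λ {c} → ∁⇒¬ (x c)) , (λ {c} → ¬⇒∁ (x c))
    ; 𝟙-homo    = _ , λ _ → refl
    ; 𝟘-homo    = (λ ()) , λ ()
    ; op-homo   = λ o xs → (λ {c} → to (decided em)) , (λ {c} → from (decided em))
    }
    where
    same : ∀ {x y : Bool} → (x ≡ true → y ≡ true) → (y ≡ true → x ≡ true) → x ≡ y
    same {true}  {y}     f g = sym (f refl)
    same {false} {true}  f g = g refl
    same {false} {false} f g = refl
    ∨⇒⊎ : ∀ x {y} → x Bool.∨ y ≡ true → x ≡ true ⊎ y ≡ true
    ∨⇒⊎ true  h = inj₁ refl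
    ∨⇒⊎ false h = inj₂ h
    ⊎⇒∨ : ∀ x {y} → x ≡ true ⊎ y ≡ true → x Bool.∨ y ≡ true
    ⊎⇒∨ true  _        = refl
    ⊎⇒∨ false (inj₂ h) = h
    ∧⇒× : ∀ x {y} → x Bool.∧ y ≡ true → x ≡ true × y ≡ true
    ∧⇒× true h = refl , h
    ∁⇒¬ : ∀ x → Bool.not x ≡ true → x ≢ true
    ∁⇒¬ false _ ()
    ¬⇒∁ : ∀ x → x ≢ true → Bool.not x ≡ true
    ¬⇒∁ true  h = contradiction refl h
    ¬⇒∁ false _ = refl

  𝑹-isRelationAlgebra : IsRelationAlgebra 𝑹
  𝑹-isRelationAlgebra = transfer-isRelationAlgebra 𝑹-embedding Cm-isRelationAlgebra

  open ComplexAlgebra em colours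
  open Atoms 𝑹-embedding
    (λ s → (λ c → does (em {P = c ≡ s})) , (λ {c} → to (decided em)) , (λ {c} → from (decided em)))
    public using (atomic; el; atom; atom-isAtom; el-atom; el-cong; el-injective; At≅; R-iso; ⊆⇒≤; ≤⇒⊆)

  private
    module 𝑹 = Algebra 𝑹
    module R𝑹 = RelationOps 𝑹

  Atom : Set
  Atom = AtomStructure.Atom (At 𝑹)

  -- From here on atoms are handled through their labels, in which the conditions on basic matrices
  -- become statements about `one`, equality and `Triangle`.
  paint : Atom → Label
  paint α = ι (el α)

  paint-injective : ∀ {α β} → paint α ≡ paint β → proj₁ α 𝑹.≈ proj₁ β
  paint-injective {α} {β} e = el-injective {α} {β} (ι-injective e)

  paint-cong : ∀ {α β} → proj₁ α 𝑹.≈ proj₁ β → paint α ≡ paint β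
  paint-cong {α} {β} e = cong ι (el-cong {α} {β} e)

  paint-surjective : ∀ {a} → Good false a → ∃[ α ] paint α ≡ a
  paint-surjective g with c , refl ← ι-surjective g = (atom c , atom-isAtom c) , cong ι (el-atom c)

  ≤1′⇔ : ∀ α → (proj₁ α 𝑹.≤ R𝑹.1′) ⇔ (paint α ≡ one)
  ≤1′⇔ α = ⇔-trans (R-iso identity α []) (mk⇔ (cong ι) ι-injective)

  ≤⨾⇔ : ∀ α β γ → (proj₁ γ 𝑹.≤ proj₁ α R𝑹.⨾ proj₁ β) ⇔ Triangle (paint α) (paint β) (paint γ)
  ≤⨾⇔ α β γ = R-iso composition γ (α ∷ β ∷ [])

  ˘-trivial : ∀ x → x R𝑹.˘ 𝑹.≈ x
  ˘-trivial x = Embedding.injective 𝑹-embedding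
    ((λ {c} c∈ → unconvert {⟦ x ⟧} (to (decided em) c∈)) , (λ {c} c∈ → from (decided em) (convert {⟦ x ⟧} c∈)))

  ≈˘⇔ : ∀ α β → (proj₁ α 𝑹.≈ proj₁ β R𝑹.˘) ⇔ (paint α ≡ paint β)
  ≈˘⇔ α β = mk⇔ (λ e → paint-cong {α} {β} (𝑹.trans e (˘-trivial (proj₁ β))))
                (λ e → 𝑹.trans (paint-injective {α} {β} e) (𝑹.sym (˘-trivial (proj₁ β))))

-- Basic matrices

-- Stated for labels, so as to cover tuples of nodes as well, whose labels may lie in infinite
-- cliques.
record IsMatrix {n} (F : Fin n → Fin n → Label) : Set where
  field
    diagonal   : ∀ x → F x x ≡ one
    symmetric  : ∀ x y → F x y ≡ F y x
    triangular : ∀ x y z → Triangle (F x y) (F y z) (F x z)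

  -- A triangle with one side `one` has its other sides equal, so vertices joined by the identity
  -- are interchangeable.
  merge : ∀ {x y} z → F x y ≡ one → F x z ≡ F y z
  merge {x} {y} z e = sym (triangle-one₁ (subst (λ a → Triangle a (F y z) (F x z)) e (triangular x y z)))

  star : ∀ z x y → Triangle (F z x) (F z y) (F x y)
  star z x y = subst (λ a → Triangle a (F z y) (F x y)) (symmetric x z) (triangular x z y)

isMatrix-∘ : ∀ {n} {F : Fin n → Fin n → Label} (τ : Fin n → Fin n) → IsMatrix F →
             IsMatrix (λ x y → F (τ x) (τ y))
isMatrix-∘ τ M = record
  { diagonal   = λ x → diagonal (τ x)
  ; symmetric  = λ x y → symmetric (τ x) (τ y)
  ; triangular = λ x y z → triangular (τ x) (τ y) (τ z)
  }
  where open IsMatrix M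

adjoin : ∀ {n} → (Fin n → Fin n → Label) → Fin n → (Fin n → Label) → Fin n → Fin n → Label
adjoin F z a x y with x Fin.≟ z | y Fin.≟ z
... | yes _ | _     = a y
... | no _  | yes _ = a x
... | no _  | no _  = F x y

module _ {n} (F : Fin n → Fin n → Label) (z : Fin n) (a : Fin n → Label) where

  adjoinˡ : ∀ y → adjoin F z a z y ≡ a y
  adjoinˡ y with z Fin.≟ z | y Fin.≟ z
  ... | yes _  | _ = refl
  ... | no z≢z | _ = contradiction refl z≢z

  adjoin-off : ∀ {x y} → x ≢ z → y ≢ z → adjoin F z a x y ≡ F x y
  adjoin-off {x} {y} x≢z y≢z with x Fin.≟ z | y Fin.≟ z
  ... | yes x≡z | _       = contradiction x≡z x≢z
  ... | no _    | yes y≡z = contradiction y≡z y≢z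
  ... | no _    | no _    = refl

  adjoin-all : ∀ {ℓ} (P : Fin n → Fin n → Label → Set ℓ) →
    (∀ y → P z y (a y)) → (∀ x → P x z (a x)) → (∀ x y → P x y (F x y)) →
    ∀ x y → P x y (adjoin F z a x y)
  adjoin-all P l r f x y with x Fin.≟ z | y Fin.≟ z
  ... | yes refl | _        = l y
  ... | no _     | yes refl = r x
  ... | no _     | no _     = f x y

  adjoin-isMatrix : IsMatrix F → a z ≡ one →
    (∀ x y → x ≢ z → y ≢ z → Triangle (a x) (a y) (F x y)) → IsMatrix (adjoin F z a)
  adjoin-isMatrix isM az≡one tri = record
    { diagonal = reflexive ; symmetric = symm ; triangular = tria }
    where
    open IsMatrix isM
    reflexive : ∀ x → adjoin F z a x x ≡ one
    reflexive x with x Fin.≟ z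
    ... | yes refl = az≡one
    ... | no _     = diagonal x
    symm : ∀ x y → adjoin F z a x y ≡ adjoin F z a y x
    symm x y with x Fin.≟ z | y Fin.≟ z
    ... | yes refl | yes refl = refl
    ... | yes refl | no _     = refl
    ... | no _     | yes refl = refl
    ... | no _     | no _     = symmetric x y
    tria : ∀ x y w → Triangle (adjoin F z a x y) (adjoin F z a y w) (adjoin F z a x w)
    tria x y w with x Fin.≟ z | y Fin.≟ z | w Fin.≟ z
    ... | yes refl | yes refl | _        rewrite az≡one = one₁
    ... | yes refl | no y≢    | yes refl rewrite az≡one = one₃
    ... | yes refl | no y≢    | no w≢    = flip-triangle (tri y w y≢ w≢)
    ... | no x≢    | yes refl | yes refl rewrite az≡one = one₂
    ... | no x≢    | yes refl | no w≢    = tri x w x≢ w≢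
    ... | no x≢    | no y≢    | yes refl = swap-triangle (rotate-triangle (tri x y x≢ y≢))
    ... | no x≢    | no y≢    | no w≢    = triangular x y w

-- One-point extensions and amalgams of matrices

first : ∀ {m} {P : Fin m → Set} → (∀ x → Dec (P x)) → ℕ
first {zero}  P? = 0
first {suc m} P? with P? zero
... | yes _ = 0
... | no  _ = suc (first (P? ∘ suc))

first-≤ : ∀ {m} {P : Fin m → Set} (P? : ∀ x → Dec (P x)) → first P? ≤ m
first-≤ {zero}  P? = z≤n
first-≤ {suc m} P? with P? zero
... | yes _ = z≤n
... | no  _ = s≤s (first-≤ (P? ∘ suc))

first-cong : ∀ {m} {P Q : Fin m → Set} (P? : ∀ x → Dec (P x)) (Q? : ∀ x → Dec (Q x)) →
             (∀ x → P x ⇔ Q x) → first P? ≡ first Q?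
first-cong {zero}  P? Q? e = refl
first-cong {suc m} P? Q? e with P? zero | Q? zero
... | yes _ | yes _ = refl
... | yes p | no ¬q = contradiction (to (e zero) p) ¬q
... | no ¬p | yes q = contradiction (from (e zero) q) ¬p
... | no _  | no _  = cong suc (first-cong (P? ∘ suc) (Q? ∘ suc) (e ∘ suc))

first-holds : ∀ {m} {P : Fin m → Set} (P? : ∀ x → Dec (P x)) {y} → P y →
              ∃[ x ] (P x × toℕ x ≡ first P?)
first-holds {suc m} P? {y} py with P? zero
... | yes p = zero , p , refl
first-holds {suc m} P? {zero}  py | no ¬p = contradiction py ¬p
first-holds {suc m} P? {suc y} py | no ¬p with x , px , e ← first-holds (P? ∘ suc) py = suc x , px , cong suc e

one? : ∀ a → Dec (a ≡ one)
one? a = a ≟ₗ one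

module Stars (n N : ℕ) (2<n : 2 < n) (n<N : n < N) where
  open Bounded (suc n) N

  fresh-block : ∀ {m} → m ≤ n → (g : Fin m → Label) → ∃[ i ] (i < suc n × ∀ x → block (g x) ≢ i)
  fresh-block m≤n g with i , i≤m , i∉ ← fresh (block ∘ g) = i , s≤s (ℕ.≤-trans i≤m m≤n) , i∉

  rooted : ∀ {ω} (z : Fin n) (a : Fin n → Label) → (∀ x → Good ω (a x)) →
    Σ[ a′ ∈ (Fin n → Label) ] ((∀ x → Good ω (a′ x)) × a′ z ≡ one × (∀ {x} → x ≢ z → a′ x ≡ a x))
  rooted {ω} z a good = a′ , good′ , a′z , a′≡
    where
    a′ : Fin n → Label
    a′ w with w Fin.≟ z
    ... | yes _ = one
    ... | no _  = a w
    a′≡ : ∀ {w} → w ≢ z → a′ w ≡ a w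
    a′≡ {w} w≢ with w Fin.≟ z
    ... | yes e = contradiction e w≢
    ... | no _  = refl
    a′z : a′ z ≡ one
    a′z with z Fin.≟ z
    ... | yes _ = refl
    ... | no ≢  = contradiction refl ≢
    good′ : ∀ w → Good ω (a′ w)
    good′ w with w Fin.≟ z
    ... | yes _ = one
    ... | no _  = good w

  module _ {F : Fin n → Fin n → Label} (isM : IsMatrix F) (F-good : ∀ x y → Good false (F x y)) where
    open IsMatrix isM

    -- Numbers the classes of vertices joined by `one` by their least members. Labels at position
    -- `rank w` are thus constant on each class and distinct for distinct classes.
    rank : Fin n → ℕ
    rank w = first (λ u → one? (F w u))

    rank-cong : ∀ {v w} → F v w ≡ one → rank v ≡ rank w
    rank-cong e = first-cong _ _ λ u → mk⇔ (trans (sym (merge u e))) (trans (merge u e))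

    rank-injective : ∀ {v w} → rank v ≡ rank w → F v w ≡ one
    rank-injective {v} {w} e
      with u , vu , eq ← first-holds (λ u → one? (F v u)) {v} (diagonal v)
      with u′ , wu , eq′ ← first-holds (λ u → one? (F w u)) {w} (diagonal w)
      with refl ← Fin.toℕ-injective (trans eq (trans e (sym eq′))) =
      trans (merge w vu) (trans (symmetric u w) wu)

    far : ∀ {v w u} → F v u ≡ one → F w u ≢ one → F v w ≢ one
    far {v} {w} {u} vu wu vw = wu (trans (symmetric w u) (trans (sym (merge w vu)) vw))

    -- The new vertex is joined to vertices outside the classes of x and y by
    -- distinct members of one clique, in a block that a and b avoid.
    third-vertex : ∀ {a b} → Good false a → Good false b → ∀ x y → Triangle a b (F x y) →
      Σ[ c ∈ (Fin n → Label) ] ((∀ w → Good false (c w)) × c x ≡ a × c y ≡ b ×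
        ∀ z → ∀ v w → v ≢ z → w ≢ z → Triangle (c v) (c w) (F v w))
    third-vertex {a} {b} a-good b-good x y t = cases (one? a) (one? b)
      where
      Result : Set
      Result = Σ[ c ∈ (Fin n → Label) ] ((∀ w → Good false (c w)) × c x ≡ a × c y ≡ b ×
        ∀ z → ∀ v w → v ≢ z → w ≢ z → Triangle (c v) (c w) (F v w))
      cases : Dec (a ≡ one) → Dec (b ≡ one) → Result
      cases (yes a≡one) _ = F x , F-good x , trans (diagonal x) (sym a≡one) ,
        sym (triangle-one₁ (subst (λ a → Triangle a b (F x y)) a≡one t)) , λ _ v w _ _ → star x v w
      cases (no _) (yes b≡one) = F y , F-good y ,
        trans (symmetric y x) (sym (triangle-one₂ (subst (λ b → Triangle a b (F x y)) b≡one t))) ,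
        trans (diagonal y) (sym b≡one) , λ _ v w _ _ → star y v w
      cases (no a≢) (no b≢)
        with i , i<B , i∉ ← fresh-block {2} (ℕ.<⇒≤ 2<n) (λ { zero → a ; (suc _) → b }) =
        c , good , cx , cy , λ _ v w _ _ → tri v w
        where
        c : Fin n → Label
        c w with one? (F w x) | one? (F w y)
        ... | yes _ | _     = a
        ... | no _  | yes _ = b
        ... | no _  | no _  = lab i 1 (rank w)
        good : ∀ w → Good false (c w)
        good w with one? (F w x) | one? (F w y)
        ... | yes _ | _     = a-good
        ... | no _  | yes _ = b-good
        ... | no _  | no _  = finite i<B (ℕ.≤-<-trans (first-≤ _) n<N) z<s
        cx : c x ≡ a
        cx with one? (F x x)
        ... | yes _ = refl
        ... | no ≢  = contradiction (diagonal x) ≢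
        cy : c y ≡ b
        cy with one? (F y x) | one? (F y y)
        -- If x and y coincide in F, the given triangle makes a and b equal, so the two
        -- prescriptions do not clash.
        ... | yes e | _     = triangle-one₃ (subst (Triangle a b) (trans (symmetric x y) e) t)
        ... | no _  | yes _ = refl
        ... | no _  | no ≢  = contradiction (diagonal y) ≢
        tri : ∀ v w → Triangle (c v) (c w) (F v w)
        tri v w with one? (F v x) | one? (F v y) | one? (F w x) | one? (F w y)
        ... | yes vx | _ | yes wx | _ =
              subst (Triangle a a) (sym (trans (merge w vx) (trans (symmetric x w) wx))) one₃
        ... | yes vx | _ | no _ | yes wy =
              subst (Triangle a b) (sym (trans (merge w vx) (trans (symmetric x w) (trans (merge x wy) (symmetric y x))))) t
        ... | yes vx | _ | no wx | no _ = gen a≢ (λ ()) (far vx wx) (inj₁ (inj₁ (i∉ zero)))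
        ... | no _ | yes vy | yes wx | _ =
              subst (Triangle b a) (sym (trans (merge w vy) (trans (symmetric y w) (merge y wx)))) (swap-triangle t)
        ... | no _ | yes vy | no _ | yes wy =
              subst (Triangle b b) (sym (trans (merge w vy) (trans (symmetric y w) wy))) one₃
        ... | no _ | yes vy | no _ | no wy = gen b≢ (λ ()) (far vy wy) (inj₁ (inj₁ (i∉ (suc zero))))
        ... | no vx | no _ | yes wx | _ =
              gen (λ ()) a≢ (far wx vx ∘ trans (symmetric w v)) (inj₁ (inj₁ (i∉ zero ∘ sym)))
        ... | no _ | no vy | no _ | yes wy =
              gen (λ ()) b≢ (far wy vy ∘ trans (symmetric w v)) (inj₁ (inj₁ (i∉ (suc zero) ∘ sym)))
        ... | no _ | no _ | no _ | no _ = apart (one? (F v w))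
          where
          apart : Dec (F v w ≡ one) → Triangle (lab i 1 (rank v)) (lab i 1 (rank w)) (F v w)
          apart (yes vw) = subst₂ (λ r d → Triangle (lab i 1 (rank v)) (lab i 1 r) d) (rank-cong vw) (sym vw) one₃
          apart (no ¬vw) = gen (λ ()) (λ ()) ¬vw
            (inj₁ (inj₂ (refl , λ e → ¬vw (rank-injective (proj₂ (proj₂ (lab-injective e)))))))

  -- Row x of the amalgam comes from G except at y, where neither matrix prescribes anything. If G
  -- identifies x, or F identifies y, with a vertex v outside both, the entry is forced. Otherwise a
  -- label from a block absent from row x of G completes every triangle over that edge; avoiding n
  -- labels takes n + 1 blocks.
  far-vertex : ∀ {F G : Fin n → Fin n → Label} → IsMatrix F → IsMatrix G →
    (∀ x y → Good false (F x y)) → (∀ x y → Good false (G x y)) → ∀ {x y} → y ≢ x →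
    (∀ {u v} → u ≢ x → u ≢ y → v ≢ x → v ≢ y → F u v ≡ G u v) →
    Σ[ a ∈ (Fin n → Label) ] ((∀ w → Good false (a w)) × (∀ {w} → w ≢ y → a w ≡ G x w) ×
      ∀ v w → v ≢ x → w ≢ x → Triangle (a v) (a w) (F v w))
  far-vertex {F} {G} isF isG F-good G-good {x} {y} y≢x F≡G = a , good , a≡ , tri
    where
    module F = IsMatrix isF
    module G = IsMatrix isG
    new-edge : ∃[ e ] (Good false e × (∀ w → w ≢ x → w ≢ y → Triangle e (G x w) (F y w)))
    new-edge with Fin.any? (λ w → ¬? (w Fin.≟ x) ×-dec ¬? (w Fin.≟ y) ×-dec one? (G x w))
    ... | yes (v , v≢x , v≢y , xv) = F v y , F-good v y , λ w w≢x w≢y →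
          subst (λ b → Triangle (F v y) b (F y w))
            (trans (F≡G v≢x v≢y w≢x w≢y) (sym (G.merge w xv))) (flip-triangle (F.triangular v y w))
    ... | no ¬xv with Fin.any? (λ w → ¬? (w Fin.≟ x) ×-dec ¬? (w Fin.≟ y) ×-dec one? (F y w))
    ...   | yes (v , v≢x , v≢y , yv) = G x v , G-good x v , λ w w≢x w≢y →
          subst (Triangle (G x v) (G x w)) (trans (sym (F≡G v≢x v≢y w≢x w≢y)) (sym (F.merge w yv))) (G.star x v w)
    ...   | no ¬yv with i , i<B , i∉ ← fresh-block ℕ.≤-refl (G x) =
          lab i 1 0 , finite i<B (ℕ.≤-<-trans z≤n n<N) z<s , λ w w≢x w≢y →
            gen (λ ()) (λ xw → ¬xv (w , w≢x , w≢y , xw)) (λ yw → ¬yv (w , w≢x , w≢y , yw))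
              (inj₁ (inj₁ (i∉ w ∘ sym)))
    e = proj₁ new-edge
    e-good = proj₁ (proj₂ new-edge)
    e-tri = proj₂ (proj₂ new-edge)
    a : Fin n → Label
    a w with w Fin.≟ y
    ... | yes _ = e
    ... | no _  = G x w
    good : ∀ w → Good false (a w)
    good w with w Fin.≟ y
    ... | yes _ = e-good
    ... | no _  = G-good x w
    a≡ : ∀ {w} → w ≢ y → a w ≡ G x w
    a≡ {w} w≢ with w Fin.≟ y
    ... | yes w≡y = contradiction w≡y w≢
    ... | no _  = refl
    tri : ∀ v w → v ≢ x → w ≢ x → Triangle (a v) (a w) (F v w)
    tri v w v≢ w≢ with v Fin.≟ y | w Fin.≟ y
    ... | yes refl | yes refl = subst (Triangle e e) (sym (F.diagonal y)) one₃
    ... | yes refl | no w≢y   = e-tri w w≢ w≢y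
    ... | no v≢y   | yes refl = subst (Triangle (G x v) e) (F.symmetric y v) (swap-triangle (e-tri v v≢ v≢y))
    ... | no v≢y   | no w≢y   = subst (Triangle (G x v) (G x w)) (sym (F≡G v≢ v≢y w≢ w≢y)) (G.star x v w)

-- The polyadic equality basis of all basic matrices

module Matrices (em : ∀ {ℓ} → ExcludedMiddle ℓ) (n : ℕ) (2<n : 2 < n) where

  -- An n by n matrix has n * n entries and an extension copies one more row of n, for which
  -- `extend` must find positions. The successor makes n < N immediate.
  N : ℕ
  N = suc (n * n + n)

  open Relation em n N (ℕ.<⇒≤ 2<n) z<s public
  open Bounded B N public
  open Stars n N 2<n (s≤s (ℕ.m≤n+m n (n * n))) public

  private
    module 𝑹 = Algebra 𝑹

  𝑴 : Set
  𝑴 = BasicMatrix n 𝑹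

  open BasicMatrix

  labels : 𝑴 → Fin n → Fin n → Label
  labels f x y = paint (entry f x y)

  labels-good : ∀ f x y → Good false (labels f x y)
  labels-good f x y = ι-good (el (entry f x y))

  labels-isMatrix : ∀ f → IsMatrix (labels f)
  labels-isMatrix f = record
    { diagonal   = λ x → to (≤1′⇔ (entry f x x)) (diagonal f x)
    ; symmetric  = λ x y → to (≈˘⇔ (entry f x y) (entry f y x)) (symmetric f y x)
    ; triangular = λ x y z → to (≤⨾⇔ (entry f x y) (entry f y z) (entry f x z)) (triangular f x y z)
    }

  matrix : ∀ {F : Fin n → Fin n → Label} → IsMatrix F → (∀ x y → Good false (F x y)) →
           Σ[ f ∈ 𝑴 ] ∀ x y → labels f x y ≡ F x y
  matrix {F} isM good = f , eq
    where
    module F = IsMatrix isM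
    e : Fin n → Fin n → Atom
    e x y = proj₁ (paint-surjective (good x y))
    eq : ∀ x y → paint (e x y) ≡ F x y
    eq x y = proj₂ (paint-surjective (good x y))
    f : 𝑴
    f = record
      { entry      = e
      ; diagonal   = λ x → from (≤1′⇔ (e x x)) (trans (eq x x) (F.diagonal x))
      ; symmetric  = λ x y → from (≈˘⇔ (e y x) (e x y)) (trans (eq y x) (trans (F.symmetric y x) (sym (eq x y))))
      ; triangular = λ x y z → from (≤⨾⇔ (e x y) (e y z) (e x z))
          (subst₂ (λ a b → Triangle a b (paint (e x z))) (sym (eq x y)) (sym (eq y z))
            (subst (Triangle (F x y) (F y z)) (sym (eq x z)) (F.triangular x y z)))
      }

  _≈ᴹ_ : 𝑴 → 𝑴 → Set
  _≈ᴹ_ = _≈ₘ_ n 𝑹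

  ≈ᴹ⇒ : ∀ {f g} → f ≈ᴹ g → ∀ x y → labels f x y ≡ labels g x y
  ≈ᴹ⇒ {f} {g} e x y = paint-cong {entry f x y} {entry g x y} (e x y)

  ⇒≈ : ∀ f g {x y u v} → labels f x y ≡ labels g u v → proj₁ (entry f x y) 𝑹.≈ proj₁ (entry g u v)
  ⇒≈ f g {x} {y} {u} {v} e = paint-injective {entry f x y} {entry g u v} e

  off : ∀ {z f g} → AgreeOff n 𝑹 z f g → ∀ {x y} → x ≢ z → y ≢ z → labels f x y ≡ labels g x y
  off {z} {f} {g} e {x} {y} x≢ y≢ = paint-cong {entry f x y} {entry g x y} (e x y x≢ y≢)

  x₀ x₁ : Fin n
  x₀ = 0ₙ n 𝑹 2<n
  x₁ = 1ₙ n 𝑹 2<n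

  x₁≢x₀ : x₁ ≢ x₀
  x₁≢x₀ e with () ← trans (sym (Fin.toℕ-fromℕ< (ℕ.<-trans (s<s (z<s {0})) 2<n)))
                     (trans (cong toℕ e) (Fin.toℕ-fromℕ< (ℕ.<-trans (z<s {1}) 2<n)))

  constant-isMatrix : IsMatrix {n} (λ _ _ → one)
  constant-isMatrix = record { diagonal = λ _ → refl ; symmetric = λ _ _ → refl ; triangular = λ _ _ _ → one₁ }

  adjoinᴹ : (f : 𝑴) (z : Fin n) (a : Fin n → Label) → (∀ x → Good false (a x)) →
    (∀ x y → x ≢ z → y ≢ z → Triangle (a x) (a y) (labels f x y)) →
    Σ[ g ∈ 𝑴 ] (AgreeOff n 𝑹 z f g × ∀ x → x ≢ z → labels g z x ≡ a x)
  adjoinᴹ f z a good tri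
    with a′ , good′ , a′z , a′≡ ← rooted z a good
    with g , eq ← matrix (adjoin-isMatrix (labels f) z a′ (labels-isMatrix f) a′z
        (λ x y x≢ y≢ → subst₂ (λ b c → Triangle b c (labels f x y)) (sym (a′≡ x≢)) (sym (a′≡ y≢)) (tri x y x≢ y≢)))
      (adjoin-all (labels f) z a′ (λ _ _ → Good false) good′ good′ (labels-good f)) =
    g , (λ x y x≢ y≢ → ⇒≈ f g (sym (trans (eq x y) (adjoin-off (labels f) z a′ x≢ y≢)))) ,
    λ x x≢ → trans (eq z x) (trans (adjoinˡ (labels f) z a′ x) (a′≡ x≢))

  symᴹ : ∀ f x y → labels f x y ≡ labels f y x
  symᴹ f = IsMatrix.symmetric (labels-isMatrix f)

  -- In the constant matrix all vertices coincide. Moving x₀ away to distance α leaves the others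
  -- together, so each triangle keeps a side `one`.
  atoms : ∀ α → Σ[ f ∈ 𝑴 ] labels f x₀ x₁ ≡ paint α
  atoms α
    with c , constant ← matrix constant-isMatrix (λ _ _ → one)
    with g , _ , eq ← adjoinᴹ c x₀ (λ _ → paint α) (λ _ → ι-good (el α))
           (λ x y _ _ → subst (Triangle (paint α) (paint α)) (sym (constant x y)) one₃) =
    g , eq x₁ x₁≢x₀

  witness : ∀ f x y z α β → Triangle (paint α) (paint β) (labels f x y) → z ≢ x → z ≢ y →
    Σ[ g ∈ 𝑴 ] (AgreeOff n 𝑹 z f g × labels g x z ≡ paint α × labels g z y ≡ paint β)
  witness f x y z α β t z≢x z≢y
    with a , good , ax , ay , tri ← third-vertex (labels-isMatrix f) (labels-good f)
           (ι-good (el α)) (ι-good (el β)) x y t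
    with g , agree , eq ← adjoinᴹ f z a good (tri z) =
      g , agree , trans (symᴹ g x z) (trans (eq x (z≢x ∘ sym)) ax) , trans (eq y (z≢y ∘ sym)) ay

  amalgam : ∀ f g x y → AgreeOff₂ n 𝑹 x y f g →
    Σ[ h ∈ 𝑴 ] (AgreeOff n 𝑹 x f h × AgreeOff n 𝑹 y g h)
  amalgam f g x y agree with y Fin.≟ x
  ... | yes refl = f , (λ _ _ _ _ → 𝑹.refl) , λ u v u≢ v≢ → 𝑹.sym (agree u v u≢ u≢ v≢ v≢)
  ... | no y≢x
    with a , good , a≡ , tri ← far-vertex (labels-isMatrix f) (labels-isMatrix g) (labels-good f) (labels-good g) y≢x
           (λ {u} {v} u≢x u≢y v≢x v≢y → paint-cong {entry f u v} {entry g u v} (agree u v u≢x u≢y v≢x v≢y))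
    with h , agree-h , eq ← adjoinᴹ f x a good tri =
      h , agree-h , λ u v u≢ v≢ → ⇒≈ g h (sym (other u v u≢ v≢ (u Fin.≟ x) (v Fin.≟ x)))
    where
    other : ∀ u v → u ≢ y → v ≢ y → Dec (u ≡ x) → Dec (v ≡ x) → labels h u v ≡ labels g u v
    other u v u≢ v≢ (no u≢x)   (no v≢x)   = trans (sym (off {x} {f} {h} agree-h u≢x v≢x))
      (paint-cong {entry f u v} {entry g u v} (agree u v u≢x u≢ v≢x v≢))
    other u v u≢ v≢ (yes refl) (no v≢x)   = trans (eq v v≢x) (a≡ v≢)
    other u v u≢ v≢ (no u≢x)   (yes refl) =
      trans (symᴹ h u v) (trans (trans (eq u u≢x) (a≡ u≢)) (symᴹ g v u))
    other u v u≢ v≢ (yes refl) (yes refl) =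
      trans (IsMatrix.diagonal (labels-isMatrix h) u) (sym (IsMatrix.diagonal (labels-isMatrix g) u))

  isPolyadicEqualityBasis : IsPolyadicEqualityBasis n 𝑹 2<n U
  isPolyadicEqualityBasis = record
    { isCylindricBasis = record
      { atoms   = λ α → let f , e = atoms α in f , _ , paint-injective {entry f x₀ x₁} {α} e
      ; witness = λ f _ x y z α β t z≢x z≢y →
          let g , agree , xz , zy = witness f x y z α β (to (≤⨾⇔ α β (entry f x y)) t) z≢x z≢y in
          g , _ , agree , paint-injective {entry g x z} {α} xz , paint-injective {entry g z y} {β} zy
      ; amalgam = λ f g _ _ x y agree → let h , a , b = amalgam f g x y agree in h , _ , a , b
      }
    ; ∘-closed = λ _ _ _ → _
    }

-- Tuples of nodes and matrices with the same pattern

record Similar (K : ℕ) {n : ℕ} (F G : Fin n → Fin n → Label) : Set where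
  field
    agree : ∀ x y → Agree K (F x y) (G x y)
    like  : ∀ x y u v → Alike (F x y , G x y) (F u v , G u v)

module _ {n : ℕ} where

  similar-sym : ∀ {K} {F G : Fin n → Fin n → Label} → Similar K F G → Similar K G F
  similar-sym S = record
    { agree = λ x y → agree-sym (agree x y)
    ; like  = λ x y u v → alike-flip (like x y u v)
    }
    where open Similar S

  similar-coarsen : ∀ {K L} {F G : Fin n → Fin n → Label} → K ≤ L → Similar L F G → Similar K F G
  similar-coarsen K≤L S = record { agree = λ x y → agree-antimono K≤L (agree x y) ; like = like }
    where open Similar S

  equal⇒similar : ∀ {K} {F G : Fin n → Fin n → Label} → (∀ x y → F x y ≡ G x y) → Similar K F G
  equal⇒similar {K} {F} e = record
    { agree = λ x y → subst (Agree K (F x y)) (e x y) (agree-refl K (F x y))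
    ; like  = λ x y u v → subst₂ (λ a b → Alike (F x y , a) (F u v , b)) (e x y) (e u v)
                            (alike ⇔-refl ⇔-refl)
    }

  similar-∘ : ∀ {K} {F G : Fin n → Fin n → Label} (τ : Fin n → Fin n) → Similar K F G →
              Similar K (λ x y → F (τ x) (τ y)) (λ x y → G (τ x) (τ y))
  similar-∘ τ S = record { agree = λ x y → agree (τ x) (τ y) ; like = λ x y u v → like (τ x) (τ y) (τ u) (τ v) }
    where open Similar S

  similar-resp : ∀ {K} {F F′ G G′ : Fin n → Fin n → Label} →
    (∀ x y → F x y ≡ F′ x y) → (∀ x y → G x y ≡ G′ x y) → Similar K F G → Similar K F′ G′
  similar-resp {K} f g S = record
    { agree = λ x y → subst₂ (Agree K) (f x y) (g x y) (agree x y)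
    ; like  = λ x y u v → subst₂ Alike (cong₂ _,_ (f x y) (g x y)) (cong₂ _,_ (f u v) (g u v)) (like x y u v)
    }
    where open Similar S

  -- The matrix conditions concern only the identity, equalities of entries and consistency of
  -- triples, which similarity preserves. A copy of a matrix is thus a matrix at once.
  similar-isMatrix : ∀ {K} {F G : Fin n → Fin n → Label} → Similar K F G → IsMatrix G → IsMatrix F
  similar-isMatrix S M = record
    { diagonal   = λ x → agree-one (agree-sym (agree x x)) (diagonal x)
    ; symmetric  = λ x y → from (≡-alike (like x y y x)) (symmetric x y)
    ; triangular = λ x y z → triangle-transfer
        (agree-sym (agree x y)) (agree-sym (agree y z)) (agree-sym (agree x z))
        (alike-flip (like x y y z)) (alike-flip (like y z x z)) (alike-flip (like x y x z))
        (triangular x y z)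
    }
    where
    open Similar S
    open IsMatrix M

module MatrixExtension (B n N : ℕ) (enough : n * n + n ≤ N) where
  open Bounded B N
  open Pattern

  -- Both sides of a pair are read off one list, through the bijection
  -- combine between pairs of indices and numbers below n * n.
  pairs : (F G : Fin n → Fin n → Label) → List (Label × Label)
  pairs F G = List.tabulate {n = n * n} λ k → let x , y = remQuot {n} n k in F x y , G x y

  ∈-pairs : ∀ F G x y → (F x y , G x y) ∈ₗ pairs F G
  ∈-pairs F G x y = subst (λ (u , v) → (F u v , G u v) ∈ₗ pairs F G)
    (Fin.remQuot-combine x y) (∈-tabulate⁺ (combine x y))

  finite-copy : ∀ K {G : Fin n → Fin n → Label} → (∀ x y → Good true (G x y)) →
    Σ[ F ∈ (Fin n → Fin n → Label) ] (Similar K F G × ∀ x y → Good false (F x y))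
  finite-copy K {G} G-good
    with a , qs , P , _ , ∈qs ← extend {ω = false} {K} {[]}
           (record { good = λ () ; agree = λ () ; like = λ () })
           (ℕ.≤-trans (ℕ.m≤m+n (n * n) n) enough)
           (λ k → G (proj₁ (remQuot {n} n k)) (proj₂ (remQuot {n} n k))) (λ k → G-good _ _) =
    F , record { agree = λ x y → agree P (mem x y) ; like = λ x y u v → like P (mem x y) (mem u v) } ,
    λ x y → good P (mem x y)
    where
    F : Fin n → Fin n → Label
    F x y = a (combine x y)
    mem : ∀ x y → (F x y , G x y) ∈ₗ qs
    mem x y = subst (λ (u , v) → (F x y , G u v) ∈ₗ qs) (Fin.remQuot-combine x y) (∈qs (combine x y))

  pairs-pattern : ∀ {ω K F G} → Similar K F G → (∀ x y → Good ω (F x y)) → Pattern ω K (pairs F G)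
  pairs-pattern {ω} {K} {F} {G} S F-good = record
    { good  = λ m → good-pair (listed m)
    ; agree = λ m → agree-pair (listed m)
    ; like  = λ m m′ → like-pair (listed m) (listed m′)
    }
    where
    open Similar S renaming (agree to agreeₛ; like to likeₛ)
    listed : ∀ {p} → p ∈ₗ pairs F G → ∃[ x ] ∃[ y ] p ≡ (F x y , G x y)
    listed m with k , e ← ∈-tabulate⁻ m = _ , _ , e
    good-pair : ∀ {a b} → ∃[ x ] ∃[ y ] (a , b) ≡ (F x y , G x y) → Good ω a
    good-pair (x , y , refl) = F-good x y
    agree-pair : ∀ {a b} → ∃[ x ] ∃[ y ] (a , b) ≡ (F x y , G x y) → Agree K a b
    agree-pair (x , y , refl) = agreeₛ x y
    like-pair : ∀ {p q} → ∃[ x ] ∃[ y ] p ≡ (F x y , G x y) → ∃[ x ] ∃[ y ] q ≡ (F x y , G x y) → Alike p q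
    like-pair (x , y , refl) (u , v , refl) = likeₛ x y u v

  -- Serves both halves of the back-and-forth: with ω true the copy becomes a tuple of nodes, with ω
  -- false a basic matrix. Only row z is copied anew, and the symmetry of G′ settles the column.
  extend-similar : ∀ {ω K} {F G G′ : Fin n → Fin n → Label} z → Similar K F G →
    (∀ x y → Good ω (F x y)) → (∀ x y → Good true (G′ x y)) → IsMatrix G′ →
    (∀ x y → x ≢ z → y ≢ z → G x y ≡ G′ x y) →
    Σ[ F′ ∈ (Fin n → Fin n → Label) ] (Similar K F′ G′ × (∀ x y → Good ω (F′ x y)) ×
      ∀ x y → x ≢ z → y ≢ z → F x y ≡ F′ x y)
  extend-similar {ω} {K} {F} {G} {G′} z S F-good G′-good isM same
    with a , qs , P , ⊆qs , ∈qs ← extend {n} {ω} {K} {pairs F G} (pairs-pattern S F-good)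
           (subst (λ l → l + n ≤ N) (sym (length-tabulate _)) enough) (G′ z) (G′-good z) =
    F′ , record { agree = λ x y → agree P (mem x y) ; like = λ x y u v → like P (mem x y) (mem u v) } ,
    (λ x y → good P (mem x y)) , λ x y x≢ y≢ → sym (adjoin-off F z a x≢ y≢)
    where
    F′ : Fin n → Fin n → Label
    F′ = adjoin F z a
    mem : ∀ x y → (F′ x y , G′ x y) ∈ₗ qs
    mem x y with x Fin.≟ z | y Fin.≟ z
    ... | yes refl | _        = ∈qs y
    ... | no _     | yes refl = subst (λ b → (a x , b) ∈ₗ qs) (IsMatrix.symmetric isM z x) (∈qs x)
    ... | no x≢    | no y≢    = subst (λ b → (F x y , b) ∈ₗ qs) (same x y x≢ y≢) (⊆qs (∈-pairs F G x y))

-- Representations of the two term algebras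

module TermAlgebras (em : ∀ {ℓ} → ExcludedMiddle ℓ) (n : ℕ) (2<n : 2 < n) where

  open Matrices em n 2<n
  open Model em B N
  open MatrixExtension B n N (ℕ.n≤1+n _)

  private
    module 𝑹 = Algebra 𝑹

  tuple-labels : (Fin n → Node) → Fin n → Fin n → Label
  tuple-labels s x y = label (s x) (s y)

  tuple-isMatrix : ∀ s → IsMatrix (tuple-labels s)
  tuple-isMatrix s = record
    { diagonal   = λ x → label-refl (s x)
    ; symmetric  = λ x y → label-sym (s x) (s y)
    ; triangular = λ x y z → label-triangle (s x) (s y) (s z)
    }

  tuple-good : ∀ s x y → Good true (tuple-labels s x y)
  tuple-good s x y = label-good (s x) (s y)

  other-than : ∀ (z : Fin n) → ∃[ w ] w ≢ z
  other-than z with x₀ Fin.≟ z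
  ... | no x₀≢z  = x₀ , x₀≢z
  ... | yes refl = x₁ , x₁≢x₀

  replace : ∀ {A : Set} → (Fin n → A) → Fin n → A → Fin n → A
  replace s z m x with x Fin.≟ z
  ... | yes _ = m
  ... | no _  = s x

  module _ {A : Set} (s : Fin n → A) {z : Fin n} (m : A) where

    replace-at : replace s z m z ≡ m
    replace-at with z Fin.≟ z
    ... | yes _ = refl
    ... | no ≢  = contradiction refl ≢

    replace-off : ∀ {x} → x ≢ z → replace s z m x ≡ s x
    replace-off {x} x≢ with x Fin.≟ z
    ... | yes e = contradiction e x≢
    ... | no _  = refl

  replace-avoids : ∀ {z w} → w ≢ z → ∀ x → replace id z w x ≢ z
  replace-avoids {z} w≢ x with x Fin.≟ z
  ... | yes _  = w≢
  ... | no x≢z = x≢z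

  -- Index z is redirected to another vertex w before `realise` is applied, so that the old node at
  -- z imposes no condition on the new one.
  realise-off : ∀ (s : Fin n → Node) z {F} → IsMatrix F → (∀ x y → Good true (F x y)) →
    (∀ x y → x ≢ z → y ≢ z → tuple-labels s x y ≡ F x y) →
    Σ[ t ∈ (Fin n → Node) ] ((∀ x → x ≢ z → t x ≡ s x) × ∀ x y → tuple-labels t x y ≡ F x y)
  realise-off s z {F} isM good same
    with w , w≢z ← other-than z
    with m , eq ← realise (ℕ.n<1+n n) (s ∘ replace id z w) (F z ∘ replace id z w) (λ x → good z _)
           (λ x y → subst (Triangle _ _) (sym (same _ _ (replace-avoids w≢z x) (replace-avoids w≢z y)))
                      (IsMatrix.star isM z _ _)) =
    replace s z m , (λ x x≢ → replace-off s {z} m x≢) , λ x y → all x y (x Fin.≟ z) (y Fin.≟ z)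
    where
    open IsMatrix isM
    new : ∀ {y} → y ≢ z → label m (s y) ≡ F z y
    new {y} y≢ = subst (λ v → label m (s v) ≡ F z v) (replace-off id {z} w y≢) (eq y)
    all : ∀ x y → Dec (x ≡ z) → Dec (y ≡ z) → tuple-labels (replace s z m) x y ≡ F x y
    all x y (yes refl) (yes refl) = trans (label-refl (replace s z m z)) (sym (diagonal z))
    all x y (yes refl) (no y≢) = trans (cong₂ label (replace-at s {z} m) (replace-off s {z} m y≢)) (new y≢)
    all x y (no x≢) (yes refl) = trans (cong₂ label (replace-off s {z} m x≢) (replace-at s {z} m))
      (trans (label-sym (s x) m) (trans (new x≢) (symmetric z x)))
    all x y (no x≢) (no y≢) = trans (cong₂ label (replace-off s {z} m x≢) (replace-off s {z} m y≢)) (same x y x≢ y≢)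

  below : ℕ → Fin n → Fin n
  below k x with toℕ x ℕ.<? k
  ... | yes _ = x
  ... | no _  = x₀

  below-all : ∀ x → below n x ≡ x
  below-all x with toℕ x ℕ.<? n
  ... | yes _ = refl
  ... | no ≮  = contradiction (Fin.toℕ<n x) ≮

  below-suc : ∀ {k x} → toℕ x ≢ k → below k x ≡ below (suc k) x
  below-suc {k} {x} ≢ with toℕ x ℕ.<? k | toℕ x ℕ.<? suc k
  ... | yes _  | yes _  = refl
  ... | no _   | no _   = refl
  ... | yes <k | no ≮   = contradiction (ℕ.m<n⇒m<1+n <k) ≮
  ... | no ≮k  | yes <  = contradiction (ℕ.≤∧≢⇒< (ℕ.≤-pred <) ≢) ≮k

  ≢-fromℕ< : ∀ {k x} (k<n : k < n) → x ≢ fromℕ< k<n → toℕ x ≢ k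
  ≢-fromℕ< k<n x≢ e = x≢ (Fin.toℕ-injective (trans e (sym (Fin.toℕ-fromℕ< k<n))))

  -- The vertices of the matrix are placed one after the other; those not yet
  -- placed coincide with the vertex x₀.
  realise-below : ∀ {F} → IsMatrix F → (∀ x y → Good true (F x y)) → ∀ k → k ≤ n →
    Σ[ s ∈ (Fin n → Node) ] ∀ x y → tuple-labels s x y ≡ F (below k x) (below k y)
  -- With no neighbours prescribed, `realise` merely supplies some node.
  realise-below isM good zero _ with m , _ ← realise {0} z<s (λ ()) (λ ()) (λ ()) (λ ()) =
    (λ _ → m) , λ _ _ → trans (label-refl m) (sym (IsMatrix.diagonal isM x₀))
  realise-below {F} isM good (suc k) k<n
    with s , eq ← realise-below isM good k (ℕ.<⇒≤ k<n)
    with t , _ , eq′ ← realise-off s (fromℕ< k<n) (isMatrix-∘ (below (suc k)) isM) (λ _ _ → good _ _)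
           (λ x y x≢ y≢ → trans (eq x y) (cong₂ F (below-suc (≢-fromℕ< k<n x≢)) (below-suc (≢-fromℕ< k<n y≢)))) = t , eq′

  realise-matrix : ∀ {F} → IsMatrix F → (∀ x y → Good true (F x y)) →
    Σ[ s ∈ (Fin n → Node) ] ∀ x y → tuple-labels s x y ≡ F x y
  realise-matrix {F} isM good with s , eq ← realise-below isM good n ℕ.≤-refl =
    s , λ x y → trans (eq x y) (cong₂ F (below-all x) (below-all y))

  vec-labels : Vec Node n → Fin n → Fin n → Label
  vec-labels s = tuple-labels (lookup s)

  _~[_]_ : Vec Node n → ℕ → 𝑴 → Set
  s ~[ K ] f = Similar K (vec-labels s) (labels f)

  labels-good′ : ∀ f x y → Good true (labels f x y)
  labels-good′ f x y = good-weaken (labels-good f x y)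

  shadow : ∀ K s → ∃[ f ] s ~[ K ] f
  shadow K s
    with F , S , F-good ← finite-copy K (tuple-good (lookup s))
    with f , eq ← matrix (similar-isMatrix S (tuple-isMatrix (lookup s))) F-good =
    f , similar-resp (λ _ _ → refl) (λ x y → sym (eq x y)) (similar-sym S)

  -- The graph also contains the labels of the finite cliques, so a basic matrix is realised
  -- exactly, and hence at every level.
  cast : ∀ K f → ∃[ s ] s ~[ K ] f
  cast K f with s , eq ← realise-matrix (labels-isMatrix f) (labels-good′ f) =
    tabulate s , equal⇒similar λ x y →
      trans (cong₂ label (Vec.lookup∘tabulate s x) (Vec.lookup∘tabulate s y)) (eq x y)

  clique-bound : ∀ f → ∃[ K ] ∀ x y → Fixed K (labels f x y)
  clique-bound f with K , ≤K ← upper-bound (λ x → proj₁ (upper-bound λ y → clique-number (labels f x y))) =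
    K , λ x y → finite⇒fixed (labels-good f x y) (ℕ.≤-trans (proj₂ (row x) y) (≤K x))
    where
    row : ∀ x → ∃[ K ] ∀ y → clique-number (labels f x y) ≤ K
    row x = upper-bound λ y → clique-number (labels f x y)

  -- Once K bounds the clique numbers in f₀, all its entries are fixed. A tuple related to f₀ then
  -- carries just these labels, and so does every matrix related to that tuple.
  isolate : ∀ f₀ → ∃[ K ] ∀ {s f g} → s ~[ K ] f → s ~[ K ] g → f ≈ᴹ f₀ → g ≈ᴹ f₀
  isolate f₀ with K , fix ← clique-bound f₀ = K , λ {s} {f} {g} S T f≈f₀ x y →
    let F≡ = ≈ᴹ⇒ {f} {f₀} f≈f₀ x y
        s≡ = trans (agree-fixed (Similar.agree S x y) (subst (Fixed K) (sym F≡) (fix x y))) F≡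
    in ⇒≈ g f₀ (trans (agree-fixed (agree-sym (Similar.agree T x y)) (subst (Fixed K) (sym s≡) (fix x y))) s≡)

  -- Row z of g is copied over the labels of s, and universality of the graph supplies a node with
  -- the copied row.
  forth : ∀ {K s f g} z → s ~[ K ] f → AgreeOff n 𝑹 z f g →
    ∃[ t ] ((∀ j → j ≢ z → lookup t j ≡ lookup s j) × t ~[ K ] g)
  forth {s = s} {f} {g} z S f≡g
    with F , S′ , good , same ← extend-similar z S (tuple-good (lookup s)) (labels-good′ g) (labels-isMatrix g)
           (λ x y x≢ y≢ → off {z} {f} {g} f≡g x≢ y≢)
    with t , t≡s , eq ← realise-off (lookup s) z (similar-isMatrix S′ (labels-isMatrix g)) good same =
    tabulate t , (λ j j≢ → trans (Vec.lookup∘tabulate t j) (t≡s j j≢)) ,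
    similar-resp (λ x y → trans (sym (eq x y)) (sym (cong₂ label (Vec.lookup∘tabulate t x) (Vec.lookup∘tabulate t y))))
      (λ _ _ → refl) S′

  -- Here the copy must stay within the atoms: labels of an infinite clique in row z of t are
  -- imitated in a finite clique, which has room for the n * n + n labels involved.
  back : ∀ {K s f t} z → s ~[ K ] f → (∀ j → j ≢ z → lookup t j ≡ lookup s j) →
    ∃[ g ] (AgreeOff n 𝑹 z f g × t ~[ K ] g)
  back {s = s} {f} {t} z S t≡s
    with F , S′ , good , same ← extend-similar z (similar-sym S) (labels-good f) (tuple-good (lookup t)) (tuple-isMatrix (lookup t))
           (λ x y x≢ y≢ → sym (cong₂ label (t≡s x x≢) (t≡s y y≢)))
    with g , eq ← matrix (similar-isMatrix S′ (tuple-isMatrix (lookup t))) good =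
    g , (λ x y x≢ y≢ → ⇒≈ f g (trans (same x y x≢ y≢) (sym (eq x y)))) ,
    similar-resp (λ _ _ → refl) (λ x y → sym (eq x y)) (similar-sym S′)

  ∘-similar : ∀ {K s f} (τ : Fin n → Fin n) → s ~[ K ] f → (_∘ₛ_ n Node s τ) ~[ K ] (_∘ₘ_ n 𝑹 f τ)
  ∘-similar {s = s} τ S = similar-resp
    (λ x y → sym (cong₂ label (Vec.lookup∘tabulate (lookup s ∘ τ) x) (Vec.lookup∘tabulate (lookup s ∘ τ) y)))
    (λ _ _ → refl) (similar-∘ τ S)

  private
    module Matrix-shadow = Shadow (Mat n 𝑹) _~[_]_ similar-coarsen shadow
  open Matrix-shadow using (Invariant; lift; lift-⇔)

  vec-one⇔ : ∀ (s : Vec Node n) i j → (vec-labels s i j ≡ one) ⇔ (lookup s i ≡ lookup s j)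
  vec-one⇔ s i j = mk⇔ (label-one _ _)
    (λ e → trans (cong (λ x → label x (lookup s j)) e) (label-refl (lookup s j)))

  agree-one⇔ : ∀ {K a b} → Agree K a b → (a ≡ one) ⇔ (b ≡ one)
  agree-one⇔ A = mk⇔ (agree-one A) (agree-one (agree-sym A))

  matrix-step : ∀ o {K} (Ys : Vec (Subset (Mat n 𝑹)) (Signature.arity (Polyadic n pea) o)) →
    (∀ k → Invariant K (proj₁ (lookup Ys k))) → ∀ {s f} → s ~[ K ] f →
    (f ∈ proj₁ (Algebra.op (Cm (Mat n 𝑹)) o Ys)) ⇔ (s ∈ setOp n Node o (map (lift ∘ proj₁) Ys))
  matrix-step (cyl i) (Y ∷ []) inv {s} {f} S = mk⇔ ⇒ ⇐
    where
    ⇒ : f ∈ proj₁ (Algebra.op (Cm (Mat n 𝑹)) (cyl i) (Y ∷ [])) → s ∈ setOp n Node (cyl i) (lift (proj₁ Y) ∷ [])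
    ⇒ ((g ∷ []) , g∈ , f≡g) =
      let t , t≡s , T = forth {s = s} {f} {g} i S f≡g in
      t , to (lift-⇔ {x = t} {g} (inv zero) T) (g∈ zero) , t≡s
    ⇐ : s ∈ setOp n Node (cyl i) (lift (proj₁ Y) ∷ []) → f ∈ proj₁ (Algebra.op (Cm (Mat n 𝑹)) (cyl i) (Y ∷ []))
    ⇐ (t , t∈ , t≡s) =
      let g , f≡g , T = back {s = s} {f} {t} i S t≡s in
      (g ∷ []) , (λ { zero → from (lift-⇔ {x = t} {g} (inv zero) T) t∈ }) , f≡g
  matrix-step (diag _ i j) [] inv {s} {f} S = ⇔-trans
    (mk⇔ (λ { ([] , _ , r) → to (≤1′⇔ (BasicMatrix.entry f i j)) r })
         (λ e → [] , (λ ()) , from (≤1′⇔ (BasicMatrix.entry f i j)) e))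
    (⇔-trans (⇔-sym (agree-one⇔ (Similar.agree S i j))) (vec-one⇔ s i j))
  matrix-step (repl _ i j) (Y ∷ []) inv {s} {f} S = mk⇔
    (λ { ((g ∷ []) , g∈ , f∘≈g) → to shifted (proj₂ Y {g} {_∘ₘ_ n 𝑹 f τ} (AtomStructure.sym (Mat n 𝑹) {_∘ₘ_ n 𝑹 f τ} {g} f∘≈g) (g∈ zero)) })
    (λ s∈ → (_∘ₘ_ n 𝑹 f τ ∷ []) , (λ { zero → from shifted s∈ }) , λ _ _ → 𝑹.refl)
    where
    τ = [ i ∣ j ]
    shifted : (_∘ₘ_ n 𝑹 f τ ∈ proj₁ Y) ⇔ (_∘ₛ_ n Node s τ ∈ lift (proj₁ Y))
    shifted = lift-⇔ {x = _∘ₛ_ n Node s τ} {_∘ₘ_ n 𝑹 f τ} (inv zero) (∘-similar {s = s} {f} τ S)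
  matrix-step (swap _ i j) (Y ∷ []) inv {s} {f} S = mk⇔
    (λ { ((g ∷ []) , g∈ , f∘≈g) → to shifted (proj₂ Y {g} {_∘ₘ_ n 𝑹 f τ} (AtomStructure.sym (Mat n 𝑹) {_∘ₘ_ n 𝑹 f τ} {g} f∘≈g) (g∈ zero)) })
    (λ s∈ → (_∘ₘ_ n 𝑹 f τ ∷ []) , (λ { zero → from shifted s∈ }) , λ _ _ → 𝑹.refl)
    where
    τ = (transpose i j)
    shifted : (_∘ₘ_ n 𝑹 f τ ∈ proj₁ Y) ⇔ (_∘ₛ_ n Node s τ ∈ lift (proj₁ Y))
    shifted = lift-⇔ {x = _∘ₛ_ n Node s τ} {_∘ₘ_ n 𝑹 f τ} (inv zero) (∘-similar {s = s} {f} τ S)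

  Tm-Mat-embedding : Embedding (Tm (Mat n 𝑹)) (setAlgebra n Node)
  Tm-Mat-embedding = Matrix-shadow.Simulation.embedding cast isolate (setOp n Node)
    (Algebra.op-cong (setAlgebra n Node)) matrix-step

  -- `reduct pea` splits on the operation, so it agrees with the original algebra only case by case
  -- and not by definition.
  to-reduct : Embedding (setAlgebra n Node) (reduct pea (setAlgebra n Node))
  to-reduct = record
    { to = id ; cong = id ; injective = id
    ; ∨-homo = λ _ _ → A.refl ; ∧-homo = λ _ _ → A.refl ; ∁-homo = λ _ → A.refl
    ; 𝟙-homo = A.refl ; 𝟘-homo = A.refl
    ; op-homo = λ where
        (cyl i)      (X ∷ []) → A.refl
        (diag _ i j) []       → A.refl
        (repl _ i j) (X ∷ []) → A.refl
        (swap _ i j) (X ∷ []) → A.refl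
    }
    where module A = Algebra (setAlgebra n Node)

  Tm-Mat-representable : Representable n pea (Tm (Mat n 𝑹))
  Tm-Mat-representable = representable (λ U → reduct pea (setAlgebra n U)) Node (to-reduct ∘ₑ Tm-Mat-embedding)

  _≃[_]_ : Node × Node → ℕ → Atom → Set
  (x , y) ≃[ K ] α = Agree K (label x y) (paint α)

  small : ∀ {k} → k ≤ 3 → k ≤ N
  small k≤3 = ℕ.≤-trans k≤3 (ℕ.≤-trans 2<n (ℕ.≤-trans (ℕ.m≤n+m n (n * n)) (ℕ.n≤1+n _)))

  paint-good′ : ∀ α → Good true (paint α)
  paint-good′ α = good-weaken (ι-good (el α))

  -- The analogue of `extend-similar` for one triangle: two labels are copied over a known pair, so
  -- three positions in a clique are enough.
  third-side : ∀ {ω K a a′ b′ c′} → Agree K a a′ → Good ω a → Good true b′ → Good true c′ →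
    Triangle b′ c′ a′ →
    ∃[ b ] ∃[ c ] (Good ω b × Good ω c × Agree K b b′ × Agree K c c′ × Triangle b c a)
  third-side {ω} {K} {a} {a′} {b′} {c′} A a-good b′-good c′-good t
    with d , qs , P , ⊆ , ∈qs ← extend {2} {ω} {K} {(a , a′) List.∷ []} (record
           { good  = λ { (here refl) → a-good }
           ; agree = λ { (here refl) → A }
           ; like  = λ { (here refl) (here refl) → alike-refl } })
           (small ℕ.≤-refl) (λ { zero → b′ ; (suc zero) → c′ }) (λ { zero → b′-good ; (suc zero) → c′-good })
    with b∈ ← ∈qs zero | c∈ ← ∈qs (suc zero) | a∈ ← ⊆ (here refl) =
    d zero , d (suc zero) , good b∈ , good c∈ , agree b∈ , agree c∈ ,
    triangle-transfer (agree-sym (agree b∈)) (agree-sym (agree c∈)) (agree-sym A)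
      (alike-flip (like b∈ c∈)) (alike-flip (like c∈ a∈)) (alike-flip (like b∈ a∈)) t
    where open Pattern P

  atom-shadow : ∀ K p → ∃[ α ] p ≃[ K ] α
  atom-shadow K (x , y)
    -- A single label is copied as a degenerate triangle over the side `one`.
    with b , _ , b-good , _ , A , _ ← third-side {false} {K} {one} (agree-refl K one) one
           (label-good x y) (label-good x y) one₃
    with α , refl ← paint-surjective b-good = α , agree-sym A

  atom-cast : ∀ K α → ∃[ p ] p ≃[ K ] α
  atom-cast K α
    with x , _ ← realise {0} z<s (λ ()) (λ ()) (λ ()) (λ ())
    with y , eq ← realise {1} (s≤s (ℕ.≤-trans (s≤s z≤n) 2<n)) (λ _ → x) (λ _ → paint α) (λ _ → paint-good′ α)
           (λ _ _ → subst (Triangle (paint α) (paint α)) (sym (label-refl x)) one₃) =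
    (y , x) , subst (Agree K (label y x)) (eq zero) (agree-refl K _)

  atom-isolate : ∀ α → ∃[ K ] ∀ {p β γ} → p ≃[ K ] β → p ≃[ K ] γ →
                 proj₁ β 𝑹.≈ proj₁ α → proj₁ γ 𝑹.≈ proj₁ α
  atom-isolate α = clique-number (paint α) , λ {p} {β} {γ} A B β≈α →
    let fix = finite⇒fixed (ι-good (el α)) ℕ.≤-refl
        β≡ = paint-cong {β} {α} β≈α
        p≡ = trans (agree-fixed A (subst (Fixed _) (sym β≡) fix)) β≡
    in paint-injective {γ} {α} (trans (agree-fixed (agree-sym B) (subst (Fixed _) (sym p≡) fix)) p≡)

  private
    module Atom-shadow = Shadow (At 𝑹) _≃[_]_ agree-antimono atom-shadow

  realise-triangle : ∀ {x y b c} → Good true b → Good true c → Triangle b c (label x y) →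
    ∃[ z ] (label z x ≡ b × label z y ≡ c)
  realise-triangle {x} {y} {b} {c} b-good c-good t
    with z , eq ← realise {2} (s≤s (ℕ.<⇒≤ 2<n)) (λ { zero → x ; (suc zero) → y })
             (λ { zero → b ; (suc zero) → c }) (λ { zero → b-good ; (suc zero) → c-good })
             (λ { zero zero → subst (Triangle b b) (sym (label-refl x)) one₃
                ; zero (suc zero) → t
                ; (suc zero) zero → subst (Triangle c b) (label-sym x y) (swap-triangle t)
                ; (suc zero) (suc zero) → subst (Triangle c c) (sym (label-refl y)) one₃ }) =
    z , eq zero , eq (suc zero)

  atom-step : ∀ o {K} (Ys : Vec (Subset (At 𝑹)) (Signature.arity Relational o)) →
    (∀ k → Atom-shadow.Invariant K (proj₁ (lookup Ys k))) → ∀ {p α} → p ≃[ K ] α →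
    (α ∈ proj₁ (Algebra.op (Cm (At 𝑹)) o Ys)) ⇔ (p ∈ relationOp Node o (map (Atom-shadow.lift ∘ proj₁) Ys))
  atom-step identity [] inv {x , y} {α} A = ⇔-trans
    (mk⇔ (λ { ([] , _ , r) → to (≤1′⇔ α) r }) (λ e → [] , (λ ()) , from (≤1′⇔ α) e))
    (⇔-trans (⇔-sym (agree-one⇔ A))
      (mk⇔ (label-one x y) (λ e → trans (cong (λ x → label x y) e) (label-refl y))))
  atom-step converse {K} (Y ∷ []) inv {x , y} {α} A = mk⇔
    (λ { ((β ∷ []) , β∈ , r) → to shifted (proj₂ Y {β} {α} (el-injective {β} {α} (sym (to (R-iso converse α (β ∷ [])) r))) (β∈ zero)) })
    (λ p∈ → (α ∷ []) , (λ { zero → from shifted p∈ }) , from (R-iso converse α (α ∷ [])) refl)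
    where
    shifted : (α ∈ proj₁ Y) ⇔ ((y , x) ∈ Atom-shadow.lift (proj₁ Y))
    shifted = Atom-shadow.lift-⇔ {K} {x = y , x} {α} (inv zero) (subst (λ a → Agree K a (paint α)) (label-sym x y) A)
  atom-step composition {K} (Y ∷ Z ∷ []) inv {x , y} {α} A = mk⇔ ⇒ ⇐
    where
    ⇒ : α ∈ proj₁ (Algebra.op (Cm (At 𝑹)) composition (Y ∷ Z ∷ [])) →
        (x , y) ∈ relationOp Node composition (map (Atom-shadow.lift ∘ proj₁) (Y ∷ Z ∷ []))
    ⇒ ((β ∷ γ ∷ []) , ∈s , r) =
      let b , c , b-good , c-good , B , C , t = third-side {true} A (label-good x y)
            (paint-good′ β) (paint-good′ γ) (to (≤⨾⇔ β γ α) r)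
          z , zx , zy = realise-triangle {x} {y} b-good c-good t
      in z , to (Atom-shadow.lift-⇔ {x = x , z} {β} (inv zero)
               (subst (λ a → Agree K a (paint β)) (trans (sym zx) (label-sym z x)) B)) (∈s zero) ,
             to (Atom-shadow.lift-⇔ {x = z , y} {γ} (inv (suc zero))
               (subst (λ a → Agree K a (paint γ)) (sym zy) C)) (∈s (suc zero))
    ⇐ : (x , y) ∈ relationOp Node composition (map (Atom-shadow.lift ∘ proj₁) (Y ∷ Z ∷ [])) →
        α ∈ proj₁ (Algebra.op (Cm (At 𝑹)) composition (Y ∷ Z ∷ []))
    ⇐ (z , xz∈ , zy∈) =
      let b , c , b-good , c-good , B , C , t = third-side {false} (agree-sym A) (ι-good (el α))
            (label-good x z) (label-good z y) (label-triangle x z y)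
          β , β≡ = paint-surjective b-good
          γ , γ≡ = paint-surjective c-good
      in (β ∷ γ ∷ []) ,
        (λ { zero → from (Atom-shadow.lift-⇔ {x = x , z} {β} (inv zero)
                      (subst (Agree K (label x z)) (sym β≡) (agree-sym B))) xz∈
           ; (suc zero) → from (Atom-shadow.lift-⇔ {x = z , y} {γ} (inv (suc zero))
                      (subst (Agree K (label z y)) (sym γ≡) (agree-sym C))) zy∈ }) ,
        from (≤⨾⇔ β γ α) (subst₂ (λ b c → Triangle b c (paint α)) (sym β≡) (sym γ≡) t)

  Tm-At-representable : RepresentableRA (Tm (At 𝑹))
  Tm-At-representable = representable fullRelationAlgebra Node
    (Atom-shadow.Simulation.embedding atom-cast atom-isolate (relationOp Node)
      (Algebra.op-cong (fullRelationAlgebra Node)) atom-step)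

-- The polyadic equality algebra of matrices

[∣]-at : ∀ {n} (i j : Fin n) → [ i ∣ j ] i ≡ j
[∣]-at i j with i Fin.≟ i
... | yes _ = refl
... | no ≢  = contradiction refl ≢

[∣]-off : ∀ {n} (i j : Fin n) {k} → k ≢ i → [ i ∣ j ] k ≡ k
[∣]-off i j {k} k≢i with k Fin.≟ i
... | yes e = contradiction e k≢i
... | no _  = refl

transpose-cases : ∀ {n} (i j k : Fin n) →
  (k ≡ i × transpose i j k ≡ j) ⊎ (k ≢ i × k ≡ j × transpose i j k ≡ i) ⊎
  (k ≢ i × k ≢ j × transpose i j k ≡ k)
transpose-cases i j k with k Fin.≟ i
... | yes k≡i = inj₁ (k≡i , refl)
... | no k≢i with k Fin.≟ j
...   | yes k≡j = inj₂ (inj₁ (k≢i , k≡j , refl))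
...   | no k≢j  = inj₂ (inj₂ (k≢i , k≢j , refl))

transposeˡ : ∀ {n} (i j : Fin n) → transpose i j i ≡ j
transposeˡ i j with transpose-cases i j i
... | inj₁ (_ , e)         = e
... | inj₂ (inj₁ (≢ , _))  = contradiction refl ≢
... | inj₂ (inj₂ (≢ , _))  = contradiction refl ≢

transposeʳ : ∀ {n} (i j : Fin n) → transpose i j j ≡ i
transposeʳ i j with transpose-cases i j j
... | inj₁ (e , e′)               = trans e′ e
... | inj₂ (inj₁ (_ , _ , e))     = e
... | inj₂ (inj₂ (_ , ≢ , _))     = contradiction refl ≢

transpose-off : ∀ {n} (i j : Fin n) {k} → k ≢ i → k ≢ j → transpose i j k ≡ k
transpose-off i j {k} k≢i k≢j with transpose-cases i j k
... | inj₁ (e , _)               = contradiction e k≢i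
... | inj₂ (inj₁ (_ , e , _))    = contradiction e k≢j
... | inj₂ (inj₂ (_ , _ , e))    = e

transpose-id : ∀ {n} (i k : Fin n) → transpose i i k ≡ k
transpose-id i k with transpose-cases i i k
... | inj₁ (e , e′)              = trans e′ (sym e)
... | inj₂ (inj₁ (_ , e , e′))   = trans e′ (sym e)
... | inj₂ (inj₂ (_ , _ , e))    = e

transpose-sym : ∀ {n} (i j k : Fin n) → transpose i j k ≡ transpose j i k
transpose-sym i j k with transpose-cases i j k
... | inj₁ (refl , e)            = trans e (sym (transposeʳ j i))
... | inj₂ (inj₁ (_ , refl , e)) = trans e (sym (transposeˡ j i))
... | inj₂ (inj₂ (≢i , ≢j , e))  = trans e (sym (transpose-off j i ≢j ≢i))

transpose-involutive : ∀ {n} (i j k : Fin n) → transpose i j (transpose i j k) ≡ k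
transpose-involutive i j k with transpose-cases i j k
... | inj₁ (refl , e)            = trans (cong (transpose i j) e) (transposeʳ i j)
... | inj₂ (inj₁ (_ , refl , e)) = trans (cong (transpose i j) e) (transposeˡ i j)
... | inj₂ (inj₂ (≢i , ≢j , e))  = trans (cong (transpose i j) e) e

transpose-braid : ∀ {n} {i j k : Fin n} → i ≢ j → i ≢ k → j ≢ k → ∀ x →
  transpose i j (transpose i k x) ≡ transpose j k (transpose i j x)
transpose-braid {_} {i} {j} {k} i≢j i≢k j≢k x with transpose-cases i k x
... | inj₁ (refl , e) = trans (cong (transpose i j) e) (trans (transpose-off i j (i≢k ∘ sym) (j≢k ∘ sym))
        (sym (trans (cong (transpose j k) (transposeˡ i j)) (transposeˡ j k))))
... | inj₂ (inj₁ (_ , refl , e)) = trans (cong (transpose i j) e) (trans (transposeˡ i j)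
        (sym (trans (cong (transpose j k) (transpose-off i j (i≢k ∘ sym) (j≢k ∘ sym))) (transposeʳ j k))))
... | inj₂ (inj₂ (x≢i , x≢k , e)) with transpose-cases i j x
...   | inj₁ (x≡i , _) = contradiction x≡i x≢i
...   | inj₂ (inj₁ (_ , refl , e′)) = trans (cong (transpose i j) e) (trans e′
          (sym (trans (cong (transpose j k) e′) (transpose-off j k i≢j i≢k))))
...   | inj₂ (inj₂ (_ , x≢j , e′)) = trans (cong (transpose i j) e) (trans e′
          (sym (trans (cong (transpose j k) e′) (transpose-off j k x≢j x≢k))))

transpose-[∣] : ∀ {n} (i j k : Fin n) → transpose i j ([ i ∣ j ] k) ≡ [ j ∣ i ] k
transpose-[∣] i j k with k Fin.≟ i
... | yes refl with k Fin.≟ j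
...   | yes refl = transpose-id i i
...   | no _     = transposeʳ i j
transpose-[∣] i j k | no k≢i with k Fin.≟ j
...   | yes refl = transposeʳ i j
...   | no k≢j   = transpose-off i j k≢i k≢j

module PolyadicEquality (em : ∀ {ℓ} → ExcludedMiddle ℓ) (n : ℕ) (2<n : 2 < n) where

  open Matrices em n 2<n

  private
    𝑺 = Mat n 𝑹
    module 𝑹 = Algebra 𝑹
    module C = Algebra (Cm 𝑺)

  infixl 9 _⊙_
  _⊙_ : 𝑴 → (Fin n → Fin n) → 𝑴
  f ⊙ τ = _∘ₘ_ n 𝑹 f τ

  respects : ∀ (X : Subset 𝑺) {f g} → (∀ x y → labels f x y ≡ labels g x y) → f ∈ proj₁ X → g ∈ proj₁ X
  respects X {f} {g} e = proj₂ X {f} {g} λ x y → ⇒≈ f g (e x y)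

  ⊙-cong : ∀ (X : Subset 𝑺) f {τ σ : Fin n → Fin n} → (∀ x → τ x ≡ σ x) → f ⊙ τ ∈ proj₁ X → f ⊙ σ ∈ proj₁ X
  ⊙-cong X f {τ} {σ} e = respects X {f ⊙ τ} {f ⊙ σ} λ x y → cong₂ (labels f) (e x) (e y)

  c : Fin n → Subset 𝑺 → Subset 𝑺
  c i X = C.op (cyl i) (X ∷ [])
  d : Fin n → Fin n → Subset 𝑺
  d i j = C.op (diag tt i j) []
  s p : Fin n → Fin n → Subset 𝑺 → Subset 𝑺
  s i j X = C.op (repl tt i j) (X ∷ [])
  p i j X = C.op (swap tt i j) (X ∷ [])

  c⇔ : ∀ {i} X {f} → f ∈ proj₁ (c i X) ⇔ (∃[ g ] (g ∈ proj₁ X × AgreeOff n 𝑹 i f g))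
  c⇔ X = mk⇔ (λ { ((g ∷ []) , g∈ , f≡g) → g , g∈ zero , f≡g }) (λ (g , g∈ , f≡g) → (g ∷ []) , (λ { zero → g∈ }) , f≡g)

  s⇔ : ∀ {i j} X {f} → f ∈ proj₁ (s i j X) ⇔ (f ⊙ [ i ∣ j ] ∈ proj₁ X)
  s⇔ {i} {j} X {f} = mk⇔
    (λ { ((g ∷ []) , g∈ , e) → proj₂ X {g} {f ⊙ [ i ∣ j ]} (AtomStructure.sym 𝑺 {f ⊙ [ i ∣ j ]} {g} e) (g∈ zero) })
    (λ f∈ → (f ⊙ [ i ∣ j ] ∷ []) , (λ { zero → f∈ }) , λ _ _ → 𝑹.refl)

  p⇔ : ∀ {i j} X {f} → f ∈ proj₁ (p i j X) ⇔ (f ⊙ transpose i j ∈ proj₁ X)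
  p⇔ {i} {j} X {f} = mk⇔
    (λ { ((g ∷ []) , g∈ , e) → proj₂ X {g} {f ⊙ transpose i j} (AtomStructure.sym 𝑺 {f ⊙ transpose i j} {g} e) (g∈ zero) })
    (λ f∈ → (f ⊙ transpose i j ∷ []) , (λ { zero → f∈ }) , λ _ _ → 𝑹.refl)

  d⇔ : ∀ {i j f} → f ∈ proj₁ (d i j) ⇔ (labels f i j ≡ one)
  d⇔ {i} {j} {f} = mk⇔ (λ { ([] , _ , r) → Equivalence.to (≤1′⇔ (BasicMatrix.entry f i j)) r })
    (λ e → [] , (λ ()) , Equivalence.from (≤1′⇔ (BasicMatrix.entry f i j)) e)

  ⊙-⇔ : ∀ X f {τ σ : Fin n → Fin n} → (∀ x → τ x ≡ σ x) → (f ⊙ τ ∈ proj₁ X) ⇔ (f ⊙ σ ∈ proj₁ X)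
  ⊙-⇔ X f e = mk⇔ (⊙-cong X f e) (⊙-cong X f (sym ∘ e))

  equal : ∀ {X Y : Subset 𝑺} → (∀ f → (f ∈ proj₁ X) ⇔ (f ∈ proj₁ Y)) → X C.≈ Y
  equal e = (λ {f} → Equivalence.to (e f)) , (λ {f} → Equivalence.from (e f))

  [∣]-fixes-target : ∀ (i j : Fin n) → [ i ∣ j ] j ≡ j
  [∣]-fixes-target i j with j Fin.≟ i
  ... | yes _ = refl
  ... | no _  = refl

  [∣]-id : ∀ (i x : Fin n) → [ i ∣ i ] x ≡ x
  [∣]-id i x with x Fin.≟ i
  ... | yes e = sym e
  ... | no _  = refl

  [∣]-avoids : ∀ {i j k : Fin n} → j ≢ k → ∀ {x} → x ≢ k → [ i ∣ j ] x ≢ k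
  [∣]-avoids {i} j≢k {x} x≢k with x Fin.≟ i
  ... | yes _ = j≢k
  ... | no _  = x≢k

  [∣]-misses : ∀ {i j : Fin n} → i ≢ j → ∀ x → [ i ∣ j ] x ≢ i
  [∣]-misses {i} i≢j x with x Fin.≟ i
  ... | yes _   = i≢j ∘ sym
  ... | no x≢i  = x≢i

  labels-[∣] : ∀ f {i j} → labels f i j ≡ one → ∀ x y → labels f x y ≡ labels f ([ i ∣ j ] x) ([ i ∣ j ] y)
  labels-[∣] f {i} {j} e x y = trans (moveˡ x y) (trans (symᴹ f _ _) (trans (moveˡ y _) (symᴹ f _ _)))
    where
    moveˡ : ∀ x y → labels f x y ≡ labels f ([ i ∣ j ] x) y
    moveˡ x y with x Fin.≟ i
    ... | yes refl = IsMatrix.merge (labels-isMatrix f) y e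
    ... | no _     = refl

  off-trans : ∀ {i f g h} → AgreeOff n 𝑹 i f g → AgreeOff n 𝑹 i g h → AgreeOff n 𝑹 i f h
  off-trans f≡g g≡h x y x≢ y≢ = 𝑹.trans (f≡g x y x≢ y≢) (g≡h x y x≢ y≢)

  off-sym : ∀ {i f g} → AgreeOff n 𝑹 i f g → AgreeOff n 𝑹 i g f
  off-sym f≡g x y x≢ y≢ = 𝑹.sym (f≡g x y x≢ y≢)

  off-[∣] : ∀ f i j → AgreeOff n 𝑹 i f (f ⊙ [ i ∣ j ])
  off-[∣] f i j x y x≢ y≢ = ⇒≈ f f (sym (cong₂ (labels f) ([∣]-off i j x≢) ([∣]-off i j y≢)))

  s-c-law : ∀ i j X → s i j (c i X) C.≈ c i X
  s-c-law i j X = equal {s i j (c i X)} {c i X} λ f → ⇔-trans (s⇔ (c i X)) (⇔-trans (c⇔ X) (⇔-trans (shift f) (⇔-sym (c⇔ X))))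
    where
    shift : ∀ f → (∃[ g ] (g ∈ proj₁ X × AgreeOff n 𝑹 i (f ⊙ [ i ∣ j ]) g)) ⇔ (∃[ g ] (g ∈ proj₁ X × AgreeOff n 𝑹 i f g))
    shift f = mk⇔
      (λ (g , g∈ , e) → g , g∈ , off-trans {i} {f} {f ⊙ [ i ∣ j ]} {g} (off-[∣] f i j) e)
      (λ (g , g∈ , e) → g , g∈ , off-trans {i} {f ⊙ [ i ∣ j ]} {f} {g} (off-sym {i} {f} {f ⊙ [ i ∣ j ]} (off-[∣] f i j)) e)

  c-s-law : ∀ i j X → i ≢ j → c i (s i j X) C.≈ s i j X
  c-s-law i j X i≢j = equal {c i (s i j X)} {s i j X} λ f → ⇔-trans (c⇔ (s i j X)) (mk⇔
    (λ (g , g∈ , f≡g) → Equivalence.from (s⇔ X {f}) (respects X {g ⊙ [ i ∣ j ]} {f ⊙ [ i ∣ j ]}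
      (λ x y → sym (off {i} {f} {g} f≡g ([∣]-misses i≢j x) ([∣]-misses i≢j y))) (Equivalence.to (s⇔ X {g}) g∈)))
    (λ f∈ → f , f∈ , λ _ _ _ _ → 𝑹.refl))

  -- From left to right this is amalgamation: h is to agree with f off k and with g off i. Since g
  -- identifies i with j, substituting j for i in h gives back g.
  s-c-comm-law : ∀ i j k X → k ≢ i → k ≢ j → s i j (c k X) C.≈ c k (s i j X)
  s-c-comm-law i j k X k≢i k≢j = equal {s i j (c k X)} {c k (s i j X)} λ f →
    ⇔-trans (s⇔ (c k X)) (⇔-trans (c⇔ X) (⇔-trans (mk⇔ (⇒ f) (⇐ f)) (⇔-sym (c⇔ (s i j X)))))
    where
    ⇐ : ∀ f → ∃[ h ] (h ∈ proj₁ (s i j X) × AgreeOff n 𝑹 k f h) →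
        ∃[ g ] (g ∈ proj₁ X × AgreeOff n 𝑹 k (f ⊙ [ i ∣ j ]) g)
    ⇐ f (h , h∈ , f≡h) = h ⊙ [ i ∣ j ] , Equivalence.to (s⇔ X) h∈ , λ x y x≢ y≢ →
      f≡h _ _ ([∣]-avoids (k≢j ∘ sym) x≢) ([∣]-avoids (k≢j ∘ sym) y≢)
    ⇒ : ∀ f → ∃[ g ] (g ∈ proj₁ X × AgreeOff n 𝑹 k (f ⊙ [ i ∣ j ]) g) →
        ∃[ h ] (h ∈ proj₁ (s i j X) × AgreeOff n 𝑹 k f h)
    ⇒ f (g , g∈ , f≡g) = by-cases (i Fin.≟ j)
      where
      Goal : Set
      Goal = ∃[ h ] (h ∈ proj₁ (s i j X) × AgreeOff n 𝑹 k f h)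
      f≡g′ : ∀ {x y} → x ≢ k → y ≢ k → labels f ([ i ∣ j ] x) ([ i ∣ j ] y) ≡ labels g x y
      f≡g′ = off {k} {f ⊙ [ i ∣ j ]} {g} f≡g
      by-cases : Dec (i ≡ j) → Goal
      by-cases (yes refl) = g ,
        Equivalence.from (s⇔ X) (⊙-cong X g (λ x → sym ([∣]-id i x)) g∈) ,
        λ x y x≢ y≢ → ⇒≈ f g (trans (sym (cong₂ (labels f) ([∣]-id i x) ([∣]-id i y))) (f≡g′ x≢ y≢))
      by-cases (no i≢j) =
        let h , f≡h , g≡h = amalgam f g k i λ x y x≢k x≢i y≢k y≢i → ⇒≈ f g
              (trans (sym (cong₂ (labels f) ([∣]-off i j x≢i) ([∣]-off i j y≢i))) (f≡g′ x≢k y≢k))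
        in h , Equivalence.from (s⇔ X) (respects X {g} {h ⊙ [ i ∣ j ]}
                 (λ x y → trans (labels-[∣] g g-ij x y) (off {i} {g} {h} g≡h ([∣]-misses i≢j x) ([∣]-misses i≢j y))) g∈) , f≡h
        where
        g-ij : labels g i j ≡ one
        g-ij = trans (sym (f≡g′ (k≢i ∘ sym) (k≢j ∘ sym)))
          (trans (cong₂ (labels f) ([∣]-at i j) ([∣]-fixes-target i j)) (IsMatrix.diagonal (labels-isMatrix f) j))

  Cm-isPolyadicEqualityAlgebra : IsPolyadicEqualityAlgebra (Cm 𝑺)
  Cm-isPolyadicEqualityAlgebra = record
    { isBooleanAlgebra = ComplexAlgebra.Cm-isBooleanAlgebra em 𝑺
    ; s-id        = λ i X → equal {s i i X} {X} λ f → ⇔-trans (s⇔ X) (⊙-⇔ X f ([∣]-id i))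
    ; p-id        = λ i X → equal {p i i X} {X} λ f → ⇔-trans (p⇔ X) (⊙-⇔ X f (transpose-id i))
    ; p-sym       = λ i j X → equal {p i j X} {p j i X} λ f →
        ⇔-trans (p⇔ X) (⇔-trans (⊙-⇔ X f (transpose-sym i j)) (⇔-sym (p⇔ X)))
    ; c-increases = λ i X → proj₁ , λ {f} f∈ → f∈ , Equivalence.from (c⇔ X) (f , f∈ , λ _ _ _ _ → 𝑹.refl)
    ; c-∨         = λ i X Y → equal {c i (X C.∨ Y)} {c i X C.∨ c i Y} λ f → mk⇔
        (λ { ((g ∷ []) , g∈ , e) → Sum.map
               (λ h → Equivalence.from (c⇔ X) (g , h , e)) (λ h → Equivalence.from (c⇔ Y) (g , h , e)) (g∈ zero) })
        (λ { (inj₁ ((g ∷ []) , g∈ , e)) → Equivalence.from (c⇔ (X C.∨ Y)) (g , inj₁ (g∈ zero) , e)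
           ; (inj₂ ((g ∷ []) , g∈ , e)) → Equivalence.from (c⇔ (X C.∨ Y)) (g , inj₂ (g∈ zero) , e) })
    ; s-c         = s-c-law
    ; c-s         = c-s-law
    ; s-c-comm    = s-c-comm-law
    ; s-∨         = λ i j X Y → equal {s i j (X C.∨ Y)} {s i j X C.∨ s i j Y} λ f →
        ⇔-trans (s⇔ (X C.∨ Y)) (⇔-sym (s⇔ X) ⊎-⇔ ⇔-sym (s⇔ Y))
    ; s-∁         = λ i j X → equal {s i j (C.∁ X)} {C.∁ (s i j X)} λ f →
        ⇔-trans (s⇔ (C.∁ X)) (mk⇔ (_∘ Equivalence.to (s⇔ X {f})) (_∘ Equivalence.from (s⇔ X {f})))
    ; p-∨         = λ i j X Y → equal {p i j (X C.∨ Y)} {p i j X C.∨ p i j Y} λ f →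
        ⇔-trans (p⇔ (X C.∨ Y)) (⇔-sym (p⇔ X) ⊎-⇔ ⇔-sym (p⇔ Y))
    ; p-∁         = λ i j X → equal {p i j (C.∁ X)} {C.∁ (p i j X)} λ f →
        ⇔-trans (p⇔ (C.∁ X)) (mk⇔ (_∘ Equivalence.to (p⇔ X {f})) (_∘ Equivalence.from (p⇔ X {f})))
    ; p-invol     = λ i j X → equal {p i j (p i j X)} {X} λ f →
        ⇔-trans (p⇔ (p i j X)) (⇔-trans (p⇔ X {f ⊙ transpose i j}) (⊙-⇔ X f (transpose-involutive i j)))
    ; p-braid     = λ i j k X i≢j i≢k j≢k → equal {p i j (p i k X)} {p j k (p i j X)} λ f →
        ⇔-trans (p⇔ (p i k X)) (⇔-trans (p⇔ X {f ⊙ transpose i j})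
          (⇔-trans (⊙-⇔ X f (transpose-braid i≢j i≢k j≢k))
            (⇔-sym (⇔-trans (p⇔ (p i j X)) (p⇔ X {f ⊙ transpose j k})))))
    ; p-s         = λ i j X → equal {p i j (s i j X)} {s j i X} λ f →
        ⇔-trans (p⇔ (s i j X)) (⇔-trans (s⇔ X {f ⊙ transpose i j})
          (⇔-trans (⊙-⇔ X f (transpose-[∣] i j)) (⇔-sym (s⇔ X))))
    ; s-d         = λ i j → _ , λ {f} _ → Equivalence.from (s⇔ (d i j)) (Equivalence.from (d⇔ {f = f ⊙ [ i ∣ j ]})
        (trans (cong₂ (labels f) ([∣]-at i j) ([∣]-fixes-target i j)) (IsMatrix.diagonal (labels-isMatrix f) j)))
    ; d-s         = λ i j X → proj₁ , λ {f} (f∈ , f∈d) → (f∈ , f∈d) , Equivalence.from (s⇔ X)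
        (respects X {f} {f ⊙ [ i ∣ j ]} (labels-[∣] f (Equivalence.to (d⇔ {f = f}) f∈d)) f∈)
    }

-- Nonrepresentability of the complex algebras

module Ramsey (em : ∀ {ℓ} → ExcludedMiddle ℓ) where

  -- Otherwise every colour stops occurring from some index on, and the term at the maximum of these
  -- indices has no colour left.
  infinite-class : ∀ {C} (c : ℕ → Fin C) → ∃[ p ] ∀ m → ∃[ l ] (m ≤ l × c l ≡ p)
  infinite-class {C} c with em {P = ∃[ p ] ∀ m → ∃[ l ] (m ≤ l × c l ≡ p)}
  ... | yes p = p
  ... | no ¬p = contradiction refl (proj₂ (last (c K)) K (proj₂ bound (c K)))
    where
    last : ∀ p → ∃[ m ] ∀ l → m ≤ l → c l ≢ p
    last p with em {P = ∃[ m ] ∀ l → m ≤ l → c l ≢ p}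
    ... | yes b = b
    ... | no ¬b = ⊥-elim (¬p (p , later))
      where
      later : ∀ m → ∃[ l ] (m ≤ l × c l ≡ p)
      later m with em {P = ∃[ l ] (m ≤ l × c l ≡ p)}
      ... | yes l = l
      ... | no ¬l = ⊥-elim (¬b (m , λ l m≤l e → ¬l (l , m≤l , e)))
    bound = upper-bound (proj₁ ∘ last)
    K = proj₁ bound

  -- Infinitely many numbers are joined to 0 in one colour p. If two of them are joined in p, they
  -- complete the triangle with 0; if not, p is absent among them and one colour fewer remains.
  monochromatic : ∀ {C} (Q : Fin C → ℕ → ℕ → Set) → (∀ {m l} → m < l → ∃[ p ] Q p m l) →
    ∃[ p ] ∃[ k ] ∃[ l ] ∃[ m ] (k < l × l < m × Q p k l × Q p l m × Q p k m)
  monochromatic {zero} Q colour with () ← proj₁ (colour {0} {1} z<s)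
  monochromatic {suc C} Q colour
    with p , often ← infinite-class (λ l → proj₁ (colour {0} {suc l} z<s)) = by-cases em
    where
    f : ℕ → ℕ
    f zero    = proj₁ (often 0)
    f (suc k) = proj₁ (often (suc (f k)))
    f-p : ∀ k → proj₁ (colour {0} {suc (f k)} z<s) ≡ p
    f-p zero    = proj₂ (proj₂ (often 0))
    f-p (suc k) = proj₂ (proj₂ (often (suc (f k))))
    from-0 : ∀ k → Q p 0 (suc (f k))
    from-0 k = subst (λ q → Q q 0 (suc (f k))) (f-p k) (proj₂ (colour {0} {suc (f k)} z<s))
    increasing : ∀ {k l} → k < l → f k < f l
    increasing {k} {suc l} (s≤s k≤l) with ℕ.m≤n⇒m<n∨m≡n k≤l
    ... | inj₁ k<l  = ℕ.<-trans (increasing k<l) (proj₁ (proj₂ (often (suc (f l)))))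
    ... | inj₂ refl = proj₁ (proj₂ (often (suc (f l))))
    by-cases : Dec (∃[ k ] ∃[ l ] (k < l × Q p (suc (f k)) (suc (f l)))) → _
    by-cases (yes (k , l , k<l , q)) =
      p , 0 , suc (f k) , suc (f l) , z<s , s<s (increasing k<l) , from-0 k , q , from-0 l
    by-cases (no ¬q)
      with p′ , k , l , m , k<l , l<m , kl , lm , km ← monochromatic
             (λ p′ k l → Q (punchIn p p′) (suc (f k)) (suc (f l)))
             (λ {k} {l} k<l → let q , kl = colour (s<s (increasing k<l))
                                  p≢q = λ e → ¬q (k , l , k<l , subst (λ q → Q q (suc (f k)) (suc (f l))) (sym e) kl) in
               punchOut p≢q , subst (λ q → Q q _ _) (sym (Fin.punchIn-punchOut p≢q)) kl) =
      punchIn p p′ , suc (f k) , suc (f l) , suc (f m) , s<s (increasing k<l) , s<s (increasing l<m) , kl , lm , km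

representation : ∀ {Ω} (K : Set → Algebra Ω 1ℓ 0ℓ) {A : Algebra Ω 1ℓ 0ℓ} → RepresentableBy K A →
  Σ[ I ∈ Set ] Σ[ U ∈ (I → Set) ] Embedding A (Product I (K ∘ U))
representation K {A} (I , U , B , iso) = I , U , record
  { to        = proj₁ ∘ to′
  ; cong      = cong′
  ; injective = injective
  ; ∨-homo    = ∨-homo
  ; ∧-homo    = ∧-homo
  ; ∁-homo    = ∁-homo
  ; 𝟙-homo    = 𝟙-homo
  ; 𝟘-homo    = 𝟘-homo
  ; op-homo   = λ o xs → subst (λ ys → proj₁ (to′ (Algebra.op A o xs)) P.≈ P.op o ys)
                  (sym (Vec.map-∘ proj₁ to′ xs)) (op-homo o xs)
  }
  where
  module P = Algebra (Product I (K ∘ U))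
  open _≅_ iso using (bijection; ∨-homo; ∧-homo; ∁-homo; 𝟙-homo; 𝟘-homo; op-homo) renaming (to to to′)
  open Function.Bundles.Bijection bijection using (injective) renaming (cong to cong′)

-- What a representation leaves on one factor of the product: the Boolean structure survives, though
-- injectivity may be lost.
record PartialRepresentation {Ω} (S : AtomStructure Ω 0ℓ 0ℓ) (X : Set) : Set₁ where
  private
    module C = Algebra (Cm S)
  field
    H       : Subset S → Pred X 0ℓ
    mono    : ∀ {Y Z} → proj₁ Y ⊆ proj₁ Z → H Y ⊆ H Z
    meet    : ∀ {Y Z x} → x ∈ H Y → x ∈ H Z → x ∈ H (Y C.∧ Z)
    join    : ∀ {Y Z x} → x ∈ H (Y C.∨ Z) → x ∈ H Y ⊎ x ∈ H Z
    total   : ∀ {x} → x ∈ H C.𝟙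
    empty   : ∀ {x} → ¬ x ∈ H C.𝟘

  disjoint : ∀ {Y Z x} → (∀ {a} → a ∈ proj₁ Y → ¬ a ∈ proj₁ Z) → x ∈ H Y → ¬ x ∈ H Z
  disjoint {Y} {Z} apart y z =
    empty (mono {Y C.∧ Z} {C.𝟘} (λ (y , z) → ⊥-elim (apart y z)) (meet {Y} {Z} y z))

  -- Only finite joins are preserved, so the members of the cover are split off one at a time. This
  -- is where the number of colours has to be finite.
  some : ∀ {C} (Ys : Fin C → Subset S) {Z x} → (∀ {a} → a ∈ proj₁ Z → ∃[ p ] a ∈ proj₁ (Ys p)) →
         x ∈ H Z → ∃[ p ] x ∈ H (Ys p)
  some {zero} Ys {Z} cover z = ⊥-elim (empty (mono {Z} {C.𝟘} (λ a∈ → ⊥-elim (Fin.¬Fin0 (proj₁ (cover a∈)))) z))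
  some {suc C} Ys {Z} cover z = split (join {Ys zero} {rest} (mono {Z} {Ys zero C.∨ rest} (λ a∈ → classify (cover a∈)) z))
    where
    rest : Subset S
    rest = (λ a → ∃[ p ] a ∈ proj₁ (Ys (suc p))) , λ e (p , a∈) → p , proj₂ (Ys (suc p)) e a∈
    classify : ∀ {a} → ∃[ p ] a ∈ proj₁ (Ys p) → a ∈ proj₁ (Ys zero) ⊎ a ∈ proj₁ rest
    classify (zero , a∈)  = inj₁ a∈
    classify (suc p , a∈) = inj₂ (p , a∈)
    split : _ ∈ H (Ys zero) ⊎ _ ∈ H rest → ∃[ p ] _ ∈ H (Ys p)
    split (inj₁ y) = zero , y
    split (inj₂ r) with p , y ← some (Ys ∘ suc) {rest} id r = suc p , y

-- Monochromatic triangles in a representation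

module Nonrepresentability (em : ∀ {ℓ} → ExcludedMiddle ℓ) (n : ℕ) (2<n : 2 < n) where

  open PolyadicEquality em n 2<n using (_⊙_; off-[∣])
  open Matrices em n 2<n
  open Ramsey em

  -- A Ramsey colour: a block and a position, coded as one number below `B * N`. The clique number
  -- is left free.
  record Class (k : Fin (B * N)) (a : Label) : Set where
    constructor class
    field
      proper      : a ≢ one
      in-block    : block a ≡ toℕ (proj₁ (remQuot {B} N k))
      at-position : position a ≡ toℕ (proj₂ (remQuot {B} N k))

  One : Pred Label 0ℓ
  One a = a ≡ one

  -- One atom from each clique of block 0. These infinitely many atoms force infinitely many points
  -- around a given one.
  Equals : ℕ → Pred Label 0ℓ
  Equals k a = a ≡ lab 0 (suc k) 0

  good-Equals : ∀ k → Good false (lab 0 (suc k) 0)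
  good-Equals k = finite z<s z<s z<s

  classes : ∀ {a} → Good false a → a ≡ one ⊎ ∃[ k ] Class k a
  classes one = inj₁ refl
  classes (finite i<B p<N _) = inj₂ (combine i p , class (λ ())
    (trans (sym (Fin.toℕ-fromℕ< i<B)) (cong (toℕ ∘ proj₁) (sym (Fin.remQuot-combine i p))))
    (trans (sym (Fin.toℕ-fromℕ< p<N)) (cong (toℕ ∘ proj₂) (sym (Fin.remQuot-combine i p)))))
    where
    i = fromℕ< i<B
    p = fromℕ< p<N

  class-triangle : ∀ {k a b c} → Class k a → Class k b → Class k c → ¬ Triangle a b c
  class-triangle (class a≢ ai ap) (class b≢ bi bp) (class c≢ ci cp) =
    no-monochromatic-triangle a≢ b≢ c≢ (trans ai (sym bi)) (trans bi (sym ci)) (trans ap (sym bp)) (trans bp (sym cp))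


  Kind : Fin (suc (B * N)) → Pred Label 0ℓ
  Kind zero    = One
  Kind (suc k) = Class k

  kinds : ∀ {a} → Good false a → ∃[ k ] Kind k a
  kinds g with classes g
  ... | inj₁ e       = zero , e
  ... | inj₂ (k , c) = suc k , c

  -- The common core of both arguments: `E P k l` is to say that the points numbered k and l are
  -- joined inside P. Distinct points exclude `One`, so Ramsey's theorem applies to the classes.
  no-colouring : (E : Pred Label 0ℓ → ℕ → ℕ → Set) →
    (∀ k l → ∃[ p ] E (Kind p) k l) → (∀ k l → k < l → ¬ E One k l) →
    (∀ p k l m → E (Class p) k l → E (Class p) l m → ¬ E (Class p) k m) → ⊥
  no-colouring E colour proper triangle =
    let p , k , l , m , _ , _ , kl , lm , km = monochromatic (E ∘ Class) (λ {k} {l} k<l → by-class k l k<l (colour k l)) in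
    triangle p k l m kl lm km
    where
    by-class : ∀ k l → k < l → ∃[ p ] E (Kind p) k l → ∃[ p ] E (Class p) k l
    by-class k l k<l (zero  , e) = ⊥-elim (proper k l k<l e)
    by-class k l k<l (suc p , e) = p , e

  module Relation-algebra where

    private
      module C = Algebra (Cm (At 𝑹))
    open RelationOps (Cm (At 𝑹))

    open PartialRepresentation using (H)

    painted : Pred Label 0ℓ → Subset (At 𝑹)
    painted P = (λ α → P (paint α)) , λ {α} {β} e → subst P (paint-cong {α} {β} e)

    compose′ : ∀ {X Y : Subset (At 𝑹)} {α β γ} → α ∈ proj₁ X → β ∈ proj₁ Y →
               Triangle (paint α) (paint β) (paint γ) → γ ∈ proj₁ (X ⨾ Y)
    compose′ {α = α} {β} {γ} α∈ β∈ t = (α ∷ β ∷ []) , (λ { zero → α∈ ; (suc zero) → β∈ }) , from (≤⨾⇔ α β γ) t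

    decompose′ : ∀ {P Q : Pred Label 0ℓ} {γ} → γ ∈ proj₁ (painted P ⨾ painted Q) →
                 ∃[ a ] ∃[ b ] (P a × Q b × Triangle a b (paint γ))
    decompose′ {γ = γ} ((α ∷ β ∷ []) , h , r) = paint α , paint β , h zero , h (suc zero) , to (≤⨾⇔ α β γ) r

    -- The identity lies below the square of each atom, so every atom `Equals k` leads from x to
    -- some point `y k`. Two such points joined by `One` would make different atoms meet.
    contradictory : ∀ {V : Set} (rep : PartialRepresentation (At 𝑹) (V × V)) →
      (∀ {X Y x y} → (x , y) ∈ H rep (X ⨾ Y) → ∃[ z ] ((x , z) ∈ H rep X × (z , y) ∈ H rep Y)) →
      (∀ {X Y x y z} → (x , z) ∈ H rep X → (z , y) ∈ H rep Y → (x , y) ∈ H rep (X ⨾ Y)) →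
      (∀ {x} → (x , x) ∈ H rep 1′) → ¬ V
    contradictory {V} rep split join-up unit x =
      no-colouring E (λ k l → some (painted ∘ Kind) {C.𝟙} {y k , y l} (λ {α} _ → kinds (ι-good (el α))) total) proper triangle
      where
      open PartialRepresentation rep hiding (H)
      spoke : ∀ k → ∃[ y ] ((x , y) ∈ H rep (painted (Equals k)) × (y , x) ∈ H rep (painted (Equals k)))
      spoke k = split {painted (Equals k)} {painted (Equals k)} (mono {1′} {painted (Equals k) ⨾ painted (Equals k)} (λ {β} → unit-spoke {β}) unit)
        where
        α = proj₁ (paint-surjective (good-Equals k))
        α≡ = proj₂ (paint-surjective (good-Equals k))
        unit-spoke : proj₁ 1′ ⊆ proj₁ (painted (Equals k) ⨾ painted (Equals k))
        unit-spoke {β} ([] , _ , r) = compose′ {painted (Equals k)} {painted (Equals k)} {α} {α} {β} α≡ α≡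
          (subst (Triangle (paint α) (paint α)) (sym (to (≤1′⇔ β) r)) one₃)
      y : ℕ → V
      y k = proj₁ (spoke k)
      E : Pred Label 0ℓ → ℕ → ℕ → Set
      E P k l = (y k , y l) ∈ H rep (painted P)
      proper : ∀ k l → k < l → ¬ E One k l
      proper k l k<l e = disjoint {painted (Equals k)} {painted (Equals l)} (λ {α} → apart {α})
        (mono {painted (Equals k) ⨾ painted One} {painted (Equals k)} (λ {γ} → absorb {γ})
          (join-up {painted (Equals k)} {painted One} (proj₁ (proj₂ (spoke k))) e)) (proj₁ (proj₂ (spoke l)))
        where
        apart : ∀ {α} → paint α ≡ lab 0 (suc k) 0 → ¬ paint α ≡ lab 0 (suc l) 0
        apart e e′ = ℕ.<⇒≢ k<l (ℕ.suc-injective (proj₁ (proj₂ (lab-injective (trans (sym e) e′)))))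
        absorb : proj₁ (painted (Equals k) ⨾ painted One) ⊆ proj₁ (painted (Equals k))
        absorb {γ} γ∈ = let a , _ , a≡ , b≡ , t = decompose′ {Equals k} {One} {γ} γ∈ in
          trans (sym (triangle-one₂ (subst (λ b → Triangle a b (paint γ)) b≡ t))) a≡
      triangle : ∀ p k l m → E (Class p) k l → E (Class p) l m → ¬ E (Class p) k m
      triangle p k l m kl lm km = disjoint {painted (Class p) ⨾ painted (Class p)} {painted (Class p)}
        (λ {γ} γ∈ γ-p → let _ , _ , a-p , b-p , t = decompose′ {Class p} {Class p} {γ} γ∈ in class-triangle a-p b-p γ-p t)
        (join-up {painted (Class p)} {painted (Class p)} kl lm) km

  module Cylindric where

    private
      module C = Algebra (Cm (Mat n 𝑹))

    open PartialRepresentation using (H)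

    x₂ : Fin n
    x₂ = fromℕ< 2<n

    x₂≢x₀ : x₂ ≢ x₀
    x₂≢x₀ e with () ← trans (sym (Fin.toℕ-fromℕ< 2<n)) (trans (cong toℕ e) (Fin.toℕ-fromℕ< (ℕ.<-trans (z<s {1}) 2<n)))

    x₂≢x₁ : x₂ ≢ x₁
    x₂≢x₁ e with () ← trans (sym (Fin.toℕ-fromℕ< 2<n)) (trans (cong toℕ e) (Fin.toℕ-fromℕ< (ℕ.<-trans (s<s (z<s {0})) 2<n)))

    cᶜ : Fin n → Subset (Mat n 𝑹) → Subset (Mat n 𝑹)
    cᶜ i X = C.op (cyl i) (X ∷ [])

    edge-in : Fin n → Fin n → Pred Label 0ℓ → Subset (Mat n 𝑹)
    edge-in x y P = (λ f → P (labels f x y)) , λ {f} {g} e → subst P (≈ᴹ⇒ {f} {g} e x y)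

    c-edge-in : ∀ {w x y} P → w ≢ x → w ≢ y → proj₁ (cᶜ w (edge-in x y P)) ⊆ proj₁ (edge-in x y P)
    c-edge-in {w} P w≢x w≢y {f} ((g ∷ []) , g∈ , f≡g) =
      subst P (sym (off {w} {f} {g} f≡g (w≢x ∘ sym) (w≢y ∘ sym))) (g∈ zero)

    c-diagonal : ∀ {u v} → u ≢ v → ∀ f → f ∈ proj₁ (cᶜ u (edge-in u v One))
    c-diagonal {u} {v} u≢v f = (f ⊙ [ u ∣ v ] ∷ []) ,
      (λ { zero → trans (cong₂ (labels f) ([∣]-at u v) ([∣]-off u v (u≢v ∘ sym))) (IsMatrix.diagonal (labels-isMatrix f) v) }) ,
      off-[∣] f u v

    c-diagonal′ : ∀ f → f ∈ proj₁ (cᶜ x₂ (edge-in x₁ x₂ One))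
    c-diagonal′ f with (g ∷ []) , g∈ , f≡g ← c-diagonal x₂≢x₁ f =
      (g ∷ []) , (λ { zero → trans (symᴹ g x₁ x₂) (g∈ zero) }) , f≡g

    c-spoke : ∀ k f → f ∈ proj₁ (cᶜ x₁ (edge-in x₀ x₁ (Equals k)))
    c-spoke k f =
      let α , α≡ = paint-surjective (good-Equals k)
          g , f≡g , e , _ = witness f x₀ x₀ x₁ α α
            (subst (Triangle (paint α) (paint α)) (sym (IsMatrix.diagonal (labels-isMatrix f) x₀)) one₃) x₁≢x₀ x₁≢x₀
      in (g ∷ []) , (λ { zero → trans e α≡ }) , f≡g

    module _ {V : Set} (s₀ : Vec V n) where

      point : V → V → V → Fin n → V
      point a b c j with j Fin.≟ x₀ | j Fin.≟ x₁ | j Fin.≟ x₂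
      ... | yes _ | _     | _     = a
      ... | no _  | yes _ | _     = b
      ... | no _  | no _  | yes _ = c
      ... | no _  | no _  | no _  = lookup s₀ j

      point₀ : ∀ a b c → point a b c x₀ ≡ a
      point₀ a b c with x₀ Fin.≟ x₀
      ... | yes _ = refl
      ... | no ≢  = contradiction refl ≢

      point₁ : ∀ a b c → point a b c x₁ ≡ b
      point₁ a b c with x₁ Fin.≟ x₀ | x₁ Fin.≟ x₁
      ... | yes e | _     = contradiction e x₁≢x₀
      ... | no _  | yes _ = refl
      ... | no _  | no ≢  = contradiction refl ≢

      point₂ : ∀ a b c → point a b c x₂ ≡ c
      point₂ a b c with x₂ Fin.≟ x₀ | x₂ Fin.≟ x₁ | x₂ Fin.≟ x₂
      ... | yes e | _     | _     = contradiction e x₂≢x₀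
      ... | no _  | yes e | _     = contradiction e x₂≢x₁
      ... | no _  | no _  | yes _ = refl
      ... | no _  | no _  | no ≢  = contradiction refl ≢

      point-off₀ : ∀ a a′ b c {j} → j ≢ x₀ → point a b c j ≡ point a′ b c j
      point-off₀ a a′ b c {j} j≢ with j Fin.≟ x₀ | j Fin.≟ x₁ | j Fin.≟ x₂
      ... | yes e | _     | _     = contradiction e j≢
      ... | no _  | yes _ | _     = refl
      ... | no _  | no _  | yes _ = refl
      ... | no _  | no _  | no _  = refl

      point-off₁ : ∀ a b b′ c {j} → j ≢ x₁ → point a b c j ≡ point a b′ c j
      point-off₁ a b b′ c {j} j≢ with j Fin.≟ x₀ | j Fin.≟ x₁ | j Fin.≟ x₂
      ... | yes _ | _     | _     = refl
      ... | no _  | yes e | _     = contradiction e j≢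
      ... | no _  | no _  | yes _ = refl
      ... | no _  | no _  | no _  = refl

      point-off₂ : ∀ a b c c′ {j} → j ≢ x₂ → point a b c j ≡ point a b c′ j
      point-off₂ a b c c′ {j} j≢ with j Fin.≟ x₀ | j Fin.≟ x₁ | j Fin.≟ x₂
      ... | yes _ | _     | _     = refl
      ... | no _  | yes _ | _     = refl
      ... | no _  | no _  | yes e = contradiction e j≢
      ... | no _  | no _  | no _  = refl

      -- Without diagonals the coordinates x₀, x₁, x₂ behave like three sorts.
      -- The elements edge-in x y One translate between them.
      contradictory : (rep : PartialRepresentation (Mat n 𝑹) (Vec V n)) →
        (∀ i {X s} → s ∈ H rep (cᶜ i X) → ∃[ t ] (t ∈ H rep X × (∀ j → j ≢ i → lookup t j ≡ lookup s j))) →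
        (∀ i {X s t} → t ∈ H rep X → (∀ j → j ≢ i → lookup t j ≡ lookup s j) → s ∈ H rep (cᶜ i X)) → ⊥
      contradictory rep open-cylinder close-cylinder =
        no-colouring E (λ k l → some (edge-in x₁ x₂ ∘ Kind) {C.𝟙} {tuple a₀ (b k) (d l)} (λ {f} _ → kinds (labels-good f x₁ x₂)) total)
          proper triangle
        where
        open PartialRepresentation rep hiding (H)
        a₀ b₀ c₀ : V
        a₀ = lookup s₀ x₀
        b₀ = lookup s₀ x₁
        c₀ = lookup s₀ x₂
        tuple : V → V → V → Vec V n
        tuple a b c = tabulate (point a b c)
        R : Fin n → Fin n → Pred Label 0ℓ → V → V → V → Set
        R x y P a b c = tuple a b c ∈ H rep (edge-in x y P)
        agree : ∀ {f g : Fin n → V} {i} → (∀ {j} → j ≢ i → f j ≡ g j) → ∀ j → j ≢ i → lookup (tabulate f) j ≡ lookup (tabulate g) j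
        agree {f} {g} e j j≢ = trans (Vec.lookup∘tabulate f j) (trans (e j≢) (sym (Vec.lookup∘tabulate g j)))
        -- `edge-in x y P` is closed under the cylindrification at any other coordinate w, so the
        -- value there may be changed freely.
        slide : ∀ {x y P f g} w → w ≢ x → w ≢ y → (∀ {j} → j ≢ w → f j ≡ g j) →
          tabulate f ∈ H rep (edge-in x y P) → tabulate g ∈ H rep (edge-in x y P)
        slide {x} {y} {P} w w≢x w≢y e h = mono {cᶜ w (edge-in x y P)} {edge-in x y P}
          (λ {f} → c-edge-in {w} {x} {y} P w≢x w≢y {f}) (close-cylinder w h (agree e))
        slide₂ : ∀ {P a b} c c′ → R x₀ x₁ P a b c → R x₀ x₁ P a b c′
        slide₂ {P} {a} {b} c c′ = slide x₂ x₂≢x₀ x₂≢x₁ (point-off₂ a b c c′)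
        slide₁ : ∀ {P a c} b b′ → R x₀ x₂ P a b c → R x₀ x₂ P a b′ c
        slide₁ {P} {a} {c} b b′ = slide x₁ x₁≢x₀ (x₂≢x₁ ∘ sym) (point-off₁ a b b′ c)
        slide₀ : ∀ {P b c} a a′ → R x₁ x₂ P a b c → R x₁ x₂ P a′ b c
        slide₀ {P} {b} {c} a a′ = slide x₀ (x₁≢x₀ ∘ sym) (x₂≢x₀ ∘ sym) (point-off₀ a a′ b c)
        move : ∀ {X : Subset (Mat n 𝑹)} i (f : Fin n → V) → (∀ g → g ∈ proj₁ (cᶜ i X)) →
          ∃[ t ] (t ∈ H rep X × (∀ j → j ≢ i → lookup t j ≡ f j))
        move {X} i f all = let t , t∈ , e = open-cylinder i {X} {tabulate f} (mono {C.𝟙} {cᶜ i X} (λ {g} _ → all g) total) in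
          t , t∈ , λ j j≢ → trans (e j j≢) (Vec.lookup∘tabulate f j)
        fill : ∀ {t : Vec V n} {i} (f g : Fin n → V) → (∀ j → j ≢ i → lookup t j ≡ f j) →
               (∀ {j} → j ≢ i → f j ≡ g j) → lookup t i ≡ g i → t ≡ tabulate g
        fill {t} {i} f g t≡f f≡g at-i =
          trans (sym (Vec.tabulate∘lookup t)) (Vec.tabulate-cong λ j → at j (j Fin.≟ i))
          where
          at : ∀ j → Dec (j ≡ i) → lookup t j ≡ g j
          at j (yes refl) = at-i
          at j (no j≢)    = trans (t≡f j j≢) (f≡g j≢)
        move₀ : ∀ {X : Subset (Mat n 𝑹)} a b c → (∀ g → g ∈ proj₁ (cᶜ x₀ X)) → ∃[ a′ ] tuple a′ b c ∈ H rep X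
        move₀ {X} a b c all = let t , t∈ , e = move {X} x₀ (point a b c) all in lookup t x₀ ,
          subst (H rep X) (fill (point a b c) (point (lookup t x₀) b c) e (point-off₀ a (lookup t x₀) b c) (sym (point₀ (lookup t x₀) b c))) t∈
        move₁ : ∀ {X : Subset (Mat n 𝑹)} a b c → (∀ g → g ∈ proj₁ (cᶜ x₁ X)) → ∃[ b′ ] tuple a b′ c ∈ H rep X
        move₁ {X} a b c all = let t , t∈ , e = move {X} x₁ (point a b c) all in lookup t x₁ ,
          subst (H rep X) (fill (point a b c) (point a (lookup t x₁) c) e (point-off₁ a b (lookup t x₁) c) (sym (point₁ a (lookup t x₁) c))) t∈
        move₂ : ∀ {X : Subset (Mat n 𝑹)} a b c → (∀ g → g ∈ proj₁ (cᶜ x₂ X)) → ∃[ c′ ] tuple a b c′ ∈ H rep X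
        move₂ {X} a b c all = let t , t∈ , e = move {X} x₂ (point a b c) all in lookup t x₂ ,
          subst (H rep X) (fill (point a b c) (point a b (lookup t x₂)) e (point-off₂ a b c (lookup t x₂)) (sym (point₂ a b (lookup t x₂)))) t∈
        through : ∀ {X Y Z : Subset (Mat n 𝑹)} {s} → (∀ f → f ∈ proj₁ X → f ∈ proj₁ Y → f ∈ proj₁ Z) →
                  s ∈ H rep X → s ∈ H rep Y → s ∈ H rep Z
        through {X} {Y} {Z} XY⊆Z x y = mono {X C.∧ Y} {Z} (λ {f} (f∈X , f∈Y) → XY⊆Z f f∈X f∈Y) (meet {X} {Y} x y)
        -- A label passes from one pair of coordinates to another when the endpoints exchanged are
        -- joined by the identity, since matrices identify such vertices.
        12→02 : ∀ {P a b c} → R x₁ x₂ P a b c → R x₀ x₁ One a b c → R x₀ x₂ P a b c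
        12→02 {P} = through {edge-in x₁ x₂ P} {edge-in x₀ x₁ One} {edge-in x₀ x₂ P}
          λ f f∈ e → subst P (sym (IsMatrix.merge (labels-isMatrix f) x₂ e)) f∈
        02→01 : ∀ {P a b c} → R x₀ x₂ P a b c → R x₁ x₂ One a b c → R x₀ x₁ P a b c
        02→01 {P} = through {edge-in x₀ x₂ P} {edge-in x₁ x₂ One} {edge-in x₀ x₁ P}
          λ f f∈ e → subst P (trans (symᴹ f x₀ x₂) (trans (sym (IsMatrix.merge (labels-isMatrix f) x₀ e)) (symᴹ f x₁ x₀))) f∈
        01→02 : ∀ {P a b c} → R x₀ x₁ P a b c → R x₁ x₂ One a b c → R x₀ x₂ P a b c
        01→02 {P} = through {edge-in x₀ x₁ P} {edge-in x₁ x₂ One} {edge-in x₀ x₂ P}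
          λ f f∈ e → subst P (trans (symᴹ f x₀ x₁) (trans (IsMatrix.merge (labels-isMatrix f) x₀ e) (symᴹ f x₂ x₀))) f∈
        spoke : ∀ k → ∃[ b ] R x₀ x₁ (Equals k) a₀ b c₀
        spoke k = move₁ {edge-in x₀ x₁ (Equals k)} a₀ b₀ c₀ (c-spoke k)
        b : ℕ → V
        b k = proj₁ (spoke k)
        copy : ∀ k → ∃[ c ] R x₁ x₂ One a₀ (b k) c
        copy k = move₂ {edge-in x₁ x₂ One} a₀ (b k) c₀ λ f → c-diagonal′ f
        d : ℕ → V
        -- `d k` stands in for `b k` at coordinate x₂; the edge from number k to number l is read
        -- between `b k` and `d l`.
        d k = proj₁ (copy k)
        E : Pred Label 0ℓ → ℕ → ℕ → Set
        E P k l = R x₁ x₂ P a₀ (b k) (d l)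
        -- If `b k` and `d l` were joined by the identity, the label `Equals l` of the spoke to
        -- `b l` would pass through its copy `d l` to `b k`, whose spoke carries `Equals k`.
        proper : ∀ k l → k < l → ¬ E One k l
        proper k l k<l e = disjoint {edge-in x₀ x₁ (Equals k)} {edge-in x₀ x₁ (Equals l)}
          (λ {f} e e′ → ℕ.<⇒≢ k<l (ℕ.suc-injective (proj₁ (proj₂ (lab-injective (trans (sym e) e′))))))
          (slide₂ c₀ (d l) (proj₂ (spoke k)))
          (02→01 (slide₁ (b l) (b k) (01→02 (slide₂ c₀ (d l) (proj₂ (spoke l))) (proj₂ (copy l)))) e)
        triangle : ∀ p k l m → E (Class p) k l → E (Class p) l m → ¬ E (Class p) k m
        triangle p k l m kl lm km =
          -- With a as a copy of `b k` at coordinate x₀, the triangle on k, l, m is read off the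
          -- tuple of a, `b l` and `d m`.
          let a , one-a = move₀ {edge-in x₀ x₁ One} a₀ (b k) (d l) (c-diagonal (x₁≢x₀ ∘ sym))
              a-bl = 02→01 {Class p} (slide₁ (b k) (b l) (12→02 {Class p} (slide₀ a₀ a kl) one-a)) (slide₀ a₀ a (proj₂ (copy l)))
              a-dm = 12→02 {Class p} (slide₀ a₀ a km) (slide₂ (d l) (d m) one-a)
          in disjoint {edge-in x₀ x₁ (Class p) C.∧ edge-in x₁ x₂ (Class p)} {edge-in x₀ x₂ (Class p)}
            (λ {f} (u , v) w → class-triangle u v w (IsMatrix.triangular (labels-isMatrix f) x₀ x₁ x₂))
            (meet {edge-in x₀ x₁ (Class p)} {edge-in x₁ x₂ (Class p)} (slide₂ (d l) (d m) a-bl) (slide₀ a₀ a lm))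
            (slide₁ (b k) (b l) a-dm)

partial-representation : ∀ {Ω} (S : AtomStructure Ω 0ℓ 0ℓ) {X : Set} (H : Subset S → Pred X 0ℓ) →
  (∀ {Y Z} → Algebra._≈_ (Cm S) Y Z → H Y ≐ H Z) →
  (∀ Y Z → H (Algebra._∨_ (Cm S) Y Z) ≐ H Y ∪ H Z) → (∀ Y Z → H (Algebra._∧_ (Cm S) Y Z) ≐ H Y ∩ H Z) →
  H (Algebra.𝟙 (Cm S)) ≐ (λ _ → Unit.⊤ {0ℓ}) → H (Algebra.𝟘 (Cm S)) ≐ (λ _ → Empty.⊥ {0ℓ}) → PartialRepresentation S X
partial-representation S H cong ∨-homo ∧-homo 𝟙-homo 𝟘-homo = record
  { H     = H
  -- An inclusion is turned into the equation of Y with its meet with Z, which H respects.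
  ; mono  = λ {Y} {Z} Y⊆Z y → proj₂ (proj₁ (∧-homo Y Z)
              (proj₂ (cong {Y C.∧ Z} {Y} (proj₁ , λ y → y , Y⊆Z y)) y))
  ; meet  = λ {Y} {Z} y z → proj₂ (∧-homo Y Z) (y , z)
  ; join  = λ {Y} {Z} → proj₁ (∨-homo Y Z)
  ; total = proj₂ 𝟙-homo _
  ; empty = λ e → Empty.⊥-elim (proj₁ 𝟘-homo e)
  }
  where module C = Algebra (Cm S)

-- Weak and strong representability of the two atom structures

module Conclusion (em : ∀ {ℓ} → ExcludedMiddle ℓ) (n : ℕ) (2<n : 2 < n) where

  open Matrices em n 2<n
  open TermAlgebras em n 2<n using (Tm-Mat-representable; Tm-At-representable)
  open PolyadicEquality em n 2<n using (Cm-isPolyadicEqualityAlgebra)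
  open Nonrepresentability em n 2<n

  private
    𝑺 = Mat n 𝑹

  module _ {Ω} (S : AtomStructure Ω 0ℓ 0ℓ) where
    open ComplexAlgebra em S

    Tm-inclusion : Embedding (Tm S) (Cm S)
    Tm-inclusion = inclusion (Cm S) (generatedBy (Cm S) (λ X → ∃[ s ] Algebra._≈_ (Cm S) X (singleton S s)))

    module Cm-atoms = Atoms (idₑ (Cm S)) (λ s → singleton S s , id , id)
    module Tm-atoms = Atoms Tm-inclusion
      (λ s → (singleton S s , gen (s , id , id)) , id , id)

  constant : 𝑴
  constant = proj₁ (matrix constant-isMatrix (λ _ _ → Good.one))

  no-cylindric-embedding : ∀ t {I : Set} {U : I → Set} →
    ¬ Embedding (reduct t (Cm 𝑺)) (Product I (λ i → reduct t (setAlgebra n (U i))))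
  no-cylindric-embedding t {I} {U} e = by-cases em
    where
    open Embedding e renaming (to to H; cong to H-cong)
    by-cases : Dec (Σ[ i ∈ I ] Vec (U i) n) → ⊥
    -- Injectivity supplies a nonempty factor: otherwise `𝟙` and `𝟘` would have the same image,
    -- although a basic matrix exists.
    by-cases (no none) = Empty.⊥-elim (proj₁ (injective {Algebra.𝟙 (Cm 𝑺)} {Algebra.𝟘 (Cm 𝑺)}
      λ i → (λ {s} _ → contradiction (i , s) none) , λ {s} _ → contradiction (i , s) none) {constant} _)
    by-cases (yes (i , s)) = Cylindric.contradictory s
      (partial-representation 𝑺 (λ X → H X i) (λ {X} {Y} e → H-cong {X} {Y} e i)
        (λ X Y → ∨-homo X Y i) (λ X Y → ∧-homo X Y i) (𝟙-homo i) (𝟘-homo i))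
      (λ j {X} {s} s∈ → proj₁ (op-homo (cyl j) (X ∷ []) i) s∈)
      (λ j {X} {s} {t} t∈ e → proj₂ (op-homo (cyl j) (X ∷ []) i) (t , t∈ , e))

  no-relational-embedding : ∀ {I : Set} {U : I → Set} →
    ¬ Embedding (Cm (At 𝑹)) (Product I (fullRelationAlgebra ∘ U))
  no-relational-embedding {I} {U} e = by-cases em
    where
    open Embedding e renaming (to to H; cong to H-cong)
    by-cases : Dec (Σ[ i ∈ I ] U i) → ⊥
    by-cases (no none) = Empty.⊥-elim (proj₁ (injective {Algebra.𝟙 (Cm (At 𝑹))} {Algebra.𝟘 (Cm (At 𝑹))}
      λ i → (λ {p} _ → contradiction (i , proj₁ p) none) , λ {p} _ → contradiction (i , proj₁ p) none) {BasicMatrix.entry constant x₀ x₀} _)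
    by-cases (yes (i , x)) = Relation-algebra.contradictory
      (partial-representation (At 𝑹) (λ X → H X i) (λ {X} {Y} e → H-cong {X} {Y} e i)
        (λ X Y → ∨-homo X Y i) (λ X Y → ∧-homo X Y i) (𝟙-homo i) (𝟘-homo i))
      (λ {X} {Y} → proj₁ (op-homo composition (X ∷ Y ∷ []) i))
      (λ {X} {Y} {x} {y} {z} xz zy → proj₂ (op-homo composition (X ∷ Y ∷ []) i) (z , xz , zy))
      (proj₂ (op-homo identity [] i) refl) x

  Cm-Mat-not-representable : ∀ t → ¬ Representable n t (reduct t (Cm 𝑺))
  Cm-Mat-not-representable t rep with I , U , e ← representation (λ U → reduct t (setAlgebra n U)) rep = no-cylindric-embedding t e

  reduct-embedding : Embedding (reduct pea (Cm 𝑺)) (Cm 𝑺)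
  reduct-embedding = record
    { to = id ; cong = id ; injective = id
    ; ∨-homo = λ _ _ → id , id ; ∧-homo = λ _ _ → id , id ; ∁-homo = λ _ → id , id
    ; 𝟙-homo = id , id ; 𝟘-homo = id , id
    ; op-homo = λ where
        (cyl i)      (X ∷ []) → id , id
        (diag _ i j) []       → id , id
        (repl _ i j) (X ∷ []) → id , id
        (swap _ i j) (X ∷ []) → id , id
    }

  Mat-hasAtomStructure : HasAtomStructure IsPolyadicEqualityAlgebra 𝑺 (Cm 𝑺)
  Mat-hasAtomStructure = Cm-isPolyadicEqualityAlgebra , Cm-atoms.atomic 𝑺 , Cm-atoms.At≅ 𝑺

  Mat-not-strongly-representable : ¬ StronglyRepresentable IsPolyadicEqualityAlgebra 𝑺 (Representable n pea)
  Mat-not-strongly-representable strong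
    with I , U , e ← representation (λ U → reduct pea (setAlgebra n U)) (strong (Cm 𝑺) Mat-hasAtomStructure) =
    no-cylindric-embedding pea (e ∘ₑ reduct-embedding)

  Cm-At-isRelationAlgebra : IsRelationAlgebra (Cm (At 𝑹))
  Cm-At-isRelationAlgebra = transfer-isRelationAlgebra (Cm-embedding At≅) Cm-isRelationAlgebra

  At-not-strongly-representable : ¬ StronglyRepresentable IsRelationAlgebra (At 𝑹) RepresentableRA
  At-not-strongly-representable strong
    with I , U , e ← representation fullRelationAlgebra (strong (Cm (At 𝑹))
      (Cm-At-isRelationAlgebra , Cm-atoms.atomic (At 𝑹) , Cm-atoms.At≅ (At 𝑹))) =
    no-relational-embedding e

  At-weakly-representable : WeaklyRepresentable IsRelationAlgebra (At 𝑹) RepresentableRA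
  At-weakly-representable = Tm (At 𝑹) ,
    (transfer-isRelationAlgebra (Tm-inclusion (At 𝑹)) Cm-At-isRelationAlgebra ,
     Tm-atoms.atomic (At 𝑹) , Tm-atoms.At≅ (At 𝑹)) ,
    Tm-At-representable

theorem3p3 : (∀ {ℓ} → ExcludedMiddle ℓ) →
    (n : ℕ) (2<n : 2 < n) →
    (Σ[ S ∈ AtomStructure (Polyadic n pea) 0ℓ 0ℓ ]
    ( IsAtomStructureOf IsPolyadicEqualityAlgebra S
    × Representable n pea (Tm S)
    × ¬ StronglyRepresentable IsPolyadicEqualityAlgebra S (Representable n pea)
    × ((t : Similarity) → ¬ Representable n t (reduct t (Cm S)))))
    ×
    (Σ[ R ∈ Algebra Relational 0ℓ 0ℓ ]
    ( IsRelationAlgebra R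
    × Algebra.Atomic R
    × IsPolyadicEqualityBasis n R 2<n U
    × Representable n pea (Tm (Mat n R))
    × ¬ Representable n df (reduct df (Cm (Mat n R)))
    × WeaklyRepresentable IsRelationAlgebra (At R) RepresentableRA
    × ¬ StronglyRepresentable IsRelationAlgebra (At R) RepresentableRA))
theorem3p3 em n 2<n =
  (Mat n 𝑹 , (Cm (Mat n 𝑹) , Mat-hasAtomStructure) , Tm-Mat-representable ,
    Mat-not-strongly-representable , Cm-Mat-not-representable) ,
  (𝑹 , 𝑹-isRelationAlgebra , atomic , isPolyadicEqualityBasis , Tm-Mat-representable ,
    Cm-Mat-not-representable df , At-weakly-representable , At-not-strongly-representable)
  where
  open Matrices em n 2<n using (𝑹; 𝑹-isRelationAlgebra; atomic; isPolyadicEqualityBasis)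
  open TermAlgebras em n 2<n using (Tm-Mat-representable)
  open Conclusion em n 2<n
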